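{- Let $\mathrm S$ be a dependent type theory with identity types and discrete identity types. The category $\mathcal C_{\mathrm S}$ of contexts in $\mathrm S$ may be extended to a locally groupoidal $2$-category $\mathfrak C_{\mathrm S}$ (i.e. one in which every $2$-cell is invertible) whose $2$-cells $\alpha\colon f\Rightarrow g\colon\Gamma\to\Delta$ are judgements $x:\Gamma\vdash\alpha(x):\mathrm{Id}_\Delta(fx,gx)$.
   Context: **Type theory.** $\mathrm S$ is a dependent type theory with the four judgement forms $A\ \mathsf{type}$, $a:A$, $A=B\ \mathsf{type}$, $a=b:A$ (the last two are definitional equality), made relative to contexts $\Gamma=(x_1:A_1,\dots,x_n:A_n)$ with each $A_i$ a type in context $(x_1:A_1,\dots,x_{i-1}:A_{i-1})$. It has the equality rules (definitional equality is a congruence) and the structural rules (weakening, contraction, exchange, substitution). Every rule is read relative to an arbitrary ambient context and every operation is stable under substitution in it. Furthermore $\mathrm S$ has: - identity types: from $a,b:A$ form $\mathrm{Id}_A(a,b)$; $\mathrm r(a):\mathrm{Id}_A(a,a)$; from $x,y:A,\,p:\mathrm{Id}_A(x,y),\,\Delta\vdash C(x,y,p)\ \mathsf{type}$ and $x:A,\,\Delta[x,x,\mathrm r(x)/x,y,p]\vdash d(x):C(x,x,\mathrm r(x))$ infer $x,y:A,\,p:\mathrm{Id}_A(x,y),\,\Delta\vdash\mathrm J_d(x,y,p):C(x,y,p)$, with $\mathrm J_d(x,x,\mathrm r(x))=d(x)$; - discrete identity types: if $p,q:\mathrm{Id}_A(a,b)$ and $\alpha:\mathrm{Id}_{\mathrm{Id}_A(a,b)}(p,q)$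 then $p=q$ and $\alpha=\mathrm r(p)$ definitionally. Vector notation is used: an element $a:\Gamma$ of a context is a list of terms of the successive types, and $x:\Gamma\vdash\Delta(x)\ \mathsf{ctxt}$ denotes a telescope over $\Gamma$. All categorical structures built from the syntax are taken modulo $\alpha$-conversion and definitional equality. **Category of contexts $\mathcal C_{\mathrm S}$.** Objects: contexts; morphisms $\Gamma\to\Delta$: judgements $x:\Gamma\vdash f(x):\Delta$; composition is substitution, and the identity on $\Gamma$ is $x:\Gamma\vdash x:\Gamma$. **Identity contexts.** The identity rules extend from types to contexts by induction on length. For a single type, elimination into a context $\Theta=(u:\Lambda,v:D(u))$ is componentwise: from $d=(d_1,d_2)$ form $\mathrm J_{d_1}$, then $\mathrm J_{d_2}$ eliminating into $D(x,y,p,\mathrm J_{d_1}(x,y,p))$. For the empty context, $\mathrm{Id}_{()}=()$ and $\mathrm J_d=d$. For $\Phi=(x:\Lambda,y:D(x))$: transport $p^*(z):\Upsilon(x)$ for $x:\Lambda\vdash\Upsilon(x)\ \mathsf{ctxt}$, $p:\mathrm{Id}_\Lambda(x,x')$, $z:\Upsilon(x')$ is defined by $\mathrm{Id}_\Lambda$-elimination from $\mathrm r(x)^*(z)=z$; $\mathrm{Id}_\Phi((x,y),(x',y')):=(p:\mathrm{Id}_\Lambda(x,x'),\,q:\mathrm{Id}_{D(x)}(y,p^*y'))$; $\mathrm r(x,y):=(\mathrm r(x),\mathrm r(y))$; elimination for $\mathrm{Id}_\Phi$ is obtained by first applying elimination for $\mathrm{Id}_{D(x)}$ to $d$, giving $d'(x,y,y',q)$,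 and then applying $\mathrm{Id}_\Lambda$-elimination with post-context $(y,y',q)$ to $d'$. -}

module Defs where

open import Data.Fin using (Fin; zero; suc; _↑ˡ_; _↑ʳ_)
open import Data.Nat using (ℕ; zero; suc; _+_)
open import Data.Product using (Σ; _×_; _,_; ∃; ∃-syntax; proj₁; proj₂)
open import Data.Vec using (Vec; []; _∷_; _++_; lookup; map; tabulate)
open import Data.Vec.Properties
  using (map-∘; map-cong; map-id; lookup-map; tabulate-∘; tabulate∘lookup;
         lookup∘tabulate)
open import Function using (_∘_)
open import Level using (0ℓ)
open import Relation.Binary.Bundles using (Setoid)
open import Relation.Binary.Indexed.Heterogeneous
  using (IRel; IndexedSetoid; IsIndexedEquivalence)
open import Relation.Binary.PropositionalEquality
  using (_≡_; refl; sym; trans; cong; cong₂; subst; subst₂)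

-- Objects form a setoid and arrows a family of setoids over it, so that
-- the quotient is an ordinary (strict) category.  Equality of arrows is
-- heterogeneous: f ≈₁ f′ includes equality of domains and codomains.
-- Arrows composable up to ≈₀ compose after a transport along `coe₁`.

record Category : Set₁ where
  infixr 9 _∘₁_
  infix  4 _≈₁_

  field
    objects : Setoid 0ℓ 0ℓ

  open Setoid objects public using () renaming (Carrier to Obj; _≈_ to _≈₀_)

  field
    arrows : IndexedSetoid (Obj × Obj) 0ℓ 0ℓ

  Hom : Obj → Obj → Set
  Hom A B = IndexedSetoid.Carrier arrows (A , B)

  _≈₁_ : ∀ {A B A′ B′} → Hom A B → Hom A′ B′ → Set
  _≈₁_ {A} {B} {A′} {B′} = IndexedSetoid._≈_ arrows {A , B} {A′ , B′}

  field
    ≈₁-ends : ∀ {A B A′ B′} {f : Hom A B} {f′ : Hom A′ B′} →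
              f ≈₁ f′ → A ≈₀ A′ × B ≈₀ B′
    coe₁    : ∀ {A B A′ B′} → A ≈₀ A′ → B ≈₀ B′ → (f : Hom A B) →
              ∃[ f′ ] _≈₁_ {A} {B} {A′} {B′} f f′

    id₁     : ∀ A → Hom A A
    _∘₁_    : ∀ {A B C} → Hom B C → Hom A B → Hom A C

    id₁-cong : ∀ {A A′} → A ≈₀ A′ → id₁ A ≈₁ id₁ A′
    ∘₁-cong  : ∀ {A B C A′ B′ C′} {g : Hom B C} {g′ : Hom B′ C′}
               {f : Hom A B} {f′ : Hom A′ B′} →
               g ≈₁ g′ → f ≈₁ f′ → g ∘₁ f ≈₁ g′ ∘₁ f′

    identityˡ : ∀ {A B} (f : Hom A B) → id₁ B ∘₁ f ≈₁ f
    identityʳ : ∀ {A B} (f : Hom A B) → f ∘₁ id₁ A ≈₁ f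
    assoc     : ∀ {A B C D} (h : Hom C D) (g : Hom B C) (f : Hom A B) →
                (h ∘₁ g) ∘₁ f ≈₁ h ∘₁ (g ∘₁ f)

module _ (𝒞 : Category) where
  open Category 𝒞

  Parallel : Set
  Parallel = Σ (Obj × Obj) λ (A , B) → Hom A B × Hom A B

  -- A 2-category with underlying category 𝒞 and with prescribed 2-cells,
  -- taken modulo a prescribed (again heterogeneous) relation.

  record TwoCategory (Cell : Parallel → Set) (_≈_ : IRel Cell 0ℓ) : Set where
    infix  4 _⇒_ _≈₂_
    infixr 9 _∙_ _⋆_

    _⇒_ : ∀ {A B} → Hom A B → Hom A B → Set
    f ⇒ g = Cell (_ , f , g)

    _≈₂_ : ∀ {A B A′ B′} {f g : Hom A B} {f′ g′ : Hom A′ B′} →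
           f ⇒ g → f′ ⇒ g′ → Set
    _≈₂_ {f = f} {g} {f′} {g′} = _≈_ {_ , f , g} {_ , f′ , g′}

    field
      isEquivalence : IsIndexedEquivalence Cell _≈_

      ≈₂-ends : ∀ {A B A′ B′} {f g : Hom A B} {f′ g′ : Hom A′ B′}
                {α : f ⇒ g} {α′ : f′ ⇒ g′} →
                α ≈₂ α′ → f ≈₁ f′ × g ≈₁ g′
      coe₂    : ∀ {A B A′ B′} {f g : Hom A B} {f′ g′ : Hom A′ B′} →
                f ≈₁ f′ → g ≈₁ g′ → (α : f ⇒ g) →
                ∃[ α′ ] _≈₂_ {f = f} {g} {f′} {g′} α α′

      id₂ : ∀ {A B} (f : Hom A B) → f ⇒ f
      _∙_ : ∀ {A B} {f g h : Hom A B} → g ⇒ h → f ⇒ g → f ⇒ h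
      _⋆_ : ∀ {A B C} {f f′ : Hom A B} {g g′ : Hom B C} →
            g ⇒ g′ → f ⇒ f′ → g ∘₁ f ⇒ g′ ∘₁ f′

      id₂-cong : ∀ {A B A′ B′} {f : Hom A B} {f′ : Hom A′ B′} →
                 f ≈₁ f′ → id₂ f ≈₂ id₂ f′
      ∙-cong   : ∀ {A B A′ B′} {f g h : Hom A B} {f′ g′ h′ : Hom A′ B′}
                 {β : g ⇒ h} {β′ : g′ ⇒ h′} {α : f ⇒ g} {α′ : f′ ⇒ g′} →
                 β ≈₂ β′ → α ≈₂ α′ → β ∙ α ≈₂ β′ ∙ α′
      ⋆-cong   : ∀ {A B C A′ B′ C′}
                 {f₁ f₂ : Hom A B} {g₁ g₂ : Hom B C}
                 {f₁′ f₂′ : Hom A′ B′} {g₁′ g₂′ : Hom B′ C′}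
                 {β : g₁ ⇒ g₂} {β′ : g₁′ ⇒ g₂′}
                 {α : f₁ ⇒ f₂} {α′ : f₁′ ⇒ f₂′} →
                 β ≈₂ β′ → α ≈₂ α′ → β ⋆ α ≈₂ β′ ⋆ α′

      ∙-identityˡ : ∀ {A B} {f g : Hom A B} (α : f ⇒ g) → id₂ g ∙ α ≈₂ α
      ∙-identityʳ : ∀ {A B} {f g : Hom A B} (α : f ⇒ g) → α ∙ id₂ f ≈₂ α
      ∙-assoc     : ∀ {A B} {f g h k : Hom A B}
                    (γ : h ⇒ k) (β : g ⇒ h) (α : f ⇒ g) →
                    (γ ∙ β) ∙ α ≈₂ γ ∙ (β ∙ α)

      ⋆-identityˡ : ∀ {A B} {f g : Hom A B} (α : f ⇒ g) →
                    id₂ (id₁ B) ⋆ α ≈₂ α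
      ⋆-identityʳ : ∀ {A B} {f g : Hom A B} (α : f ⇒ g) →
                    α ⋆ id₂ (id₁ A) ≈₂ α
      ⋆-assoc     : ∀ {A B C D} {f f′ : Hom A B} {g g′ : Hom B C}
                    {h h′ : Hom C D} (γ : h ⇒ h′) (β : g ⇒ g′) (α : f ⇒ f′) →
                    (γ ⋆ β) ⋆ α ≈₂ γ ⋆ (β ⋆ α)

      ⋆-id₂       : ∀ {A B C} (g : Hom B C) (f : Hom A B) →
                    id₂ g ⋆ id₂ f ≈₂ id₂ (g ∘₁ f)
      interchange : ∀ {A B C} {f g h : Hom A B} {k l m : Hom B C}
                    (δ : l ⇒ m) (γ : k ⇒ l) (β : g ⇒ h) (α : f ⇒ g) →
                    (δ ∙ γ) ⋆ (β ∙ α) ≈₂ (δ ⋆ β) ∙ (γ ⋆ α)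

  LocallyGroupoidal : ∀ {Cell} {_≈_ : IRel Cell 0ℓ} →
                      TwoCategory Cell _≈_ → Set
  LocallyGroupoidal 𝔈 =
    ∀ {A B} {f g : Hom A B} (α : f ⇒ g) →
    ∃[ β ] (β ∙ α ≈₂ id₂ f) × (α ∙ β ≈₂ id₂ g)
    where open TwoCategory 𝔈

-- Raw (not necessarily well-typed) type and term expressions in n free
-- variables, up to α-conversion, with simultaneous substitution.  Nothing
-- is assumed about which further expression formers there are.
-- Variables are de Bruijn indices: the head of a substitution is
-- substituted for the most recently declared variable.

record Expressions : Set₁ where
  infixl 8 _[_] _[_]ᵗ
  infixr 9 _⊙_

  field
    Ty Tm : ℕ → Set
    var   : ∀ {n} → Fin n → Tm n

  Sub : ℕ → ℕ → Set
  Sub m n = Vec (Tm m) n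

  field
    _[_]  : ∀ {m n} → Ty n → Sub m n → Ty m
    _[_]ᵗ : ∀ {m n} → Tm n → Sub m n → Tm m

  idˢ : ∀ {n} → Sub n n
  idˢ = tabulate var

  _⊙_ : ∀ {l m n} → Sub m n → Sub l m → Sub l n
  σ ⊙ τ = map _[ τ ]ᵗ σ

  field
    []-id  : ∀ {n} (A : Ty n) → A [ idˢ ] ≡ A
    []-⊙   : ∀ {l m n} (A : Ty n) (σ : Sub m n) (τ : Sub l m) →
             A [ σ ] [ τ ] ≡ A [ σ ⊙ τ ]
    []ᵗ-id : ∀ {n} (a : Tm n) → a [ idˢ ]ᵗ ≡ a
    []ᵗ-⊙  : ∀ {l m n} (a : Tm n) (σ : Sub m n) (τ : Sub l m) →
             a [ σ ]ᵗ [ τ ]ᵗ ≡ a [ σ ⊙ τ ]ᵗ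
    var-[] : ∀ {m n} (i : Fin n) (σ : Sub m n) → var i [ σ ]ᵗ ≡ lookup σ i

  wk : ∀ {n} → Sub (suc n) n
  wk = tabulate (var ∘ suc)

  lift : ∀ {m n} → Sub m n → Sub (suc m) (suc n)
  lift σ = var zero ∷ σ ⊙ wk

  v₀ : ∀ {n} → Tm (suc n)
  v₀ = var zero

  v₁ : ∀ {n} → Tm (suc (suc n))
  v₁ = var (suc zero)

  -- l + n, by accumulation: the scope after extending scope n by a
  -- telescope of length l.
  infixr 5 _⊹_
  _⊹_ : ℕ → ℕ → ℕ
  zero  ⊹ n = n
  suc l ⊹ n = l ⊹ suc n

  lifts : ∀ {m n} l → Sub m n → Sub (l ⊹ m) (l ⊹ n)
  lifts zero    σ = σ
  lifts (suc l) σ = lifts l (lift σ)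

module Telescopes (E : Expressions) where
  open Expressions E
  infixl 5 _▹_ _▸_
  infixr 5 _∷_
  infixl 8 _[_]*

  data Ctx : ℕ → Set where
    ε   : Ctx zero
    _▹_ : ∀ {n} → Ctx n → Ty n → Ctx (suc n)

  data Tel (n : ℕ) : ℕ → Set where
    ε   : Tel n zero
    _∷_ : ∀ {l} → Ty n → Tel (suc n) l → Tel n (suc l)

  _▸_ : ∀ {n l} → Ctx n → Tel n l → Ctx (l ⊹ n)
  Γ ▸ ε       = Γ
  Γ ▸ (A ∷ Δ) = (Γ ▹ A) ▸ Δ

  _[_]* : ∀ {m n l} → Tel n l → Sub m n → Tel m l
  ε       [ σ ]* = ε
  (A ∷ Δ) [ σ ]* = A [ σ ] ∷ Δ [ lift σ ]*

  _!_ : ∀ {n} → Ctx n → Fin n → Ty n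
  (Γ ▹ A) ! zero  = A [ wk ]
  (Γ ▹ A) ! suc i = (Γ ! i) [ wk ]

record Judgements (E : Expressions) : Set₁ where
  open Expressions E
  open Telescopes E
  infix 3 _⊢_type _⊢_∶_ _⊢_≐_type _⊢_≐_∶_
  field
    _⊢_type   : ∀ {n} → Ctx n → Ty n → Set
    _⊢_∶_     : ∀ {n} → Ctx n → Tm n → Ty n → Set
    _⊢_≐_type : ∀ {n} → Ctx n → Ty n → Ty n → Set
    _⊢_≐_∶_   : ∀ {n} → Ctx n → Tm n → Tm n → Ty n → Set

module ContextJudgements {E : Expressions} (𝒥 : Judgements E) where
  open Expressions E
  open Telescopes E
  open Judgements 𝒥
  infix 3 _ctxt _≐_ctxt _⊢_∶∶_ _⊢_≐_∶∶_ _⊢_≐_tel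

  data _ctxt : ∀ {n} → Ctx n → Set where
    ε   : ε ctxt
    _▹_ : ∀ {n} {Γ : Ctx n} {A} → Γ ctxt → Γ ⊢ A type → Γ ▹ A ctxt

  data _≐_ctxt : ∀ {n} → Ctx n → Ctx n → Set where
    ε   : ε ≐ ε ctxt
    _▹_ : ∀ {n} {Γ Γ′ : Ctx n} {A A′} →
          Γ ≐ Γ′ ctxt → Γ ⊢ A ≐ A′ type → Γ ▹ A ≐ Γ′ ▹ A′ ctxt

  data _⊢_∶∶_ {m} (Γ : Ctx m) : ∀ {n} → Sub m n → Ctx n → Set where
    []  : Γ ctxt → Γ ⊢ [] ∶∶ ε
    _∷_ : ∀ {n a A} {σ : Sub m n} {Δ} →
          Γ ⊢ a ∶ A [ σ ] → Γ ⊢ σ ∶∶ Δ → Γ ⊢ a ∷ σ ∶∶ Δ ▹ A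

  data _⊢_≐_∶∶_ {m} (Γ : Ctx m) : ∀ {n} → Sub m n → Sub m n → Ctx n → Set where
    []  : Γ ctxt → Γ ⊢ [] ≐ [] ∶∶ ε
    _∷_ : ∀ {n a b A} {σ τ : Sub m n} {Δ} →
          Γ ⊢ a ≐ b ∶ A [ σ ] → Γ ⊢ σ ≐ τ ∶∶ Δ →
          Γ ⊢ a ∷ σ ≐ b ∷ τ ∶∶ Δ ▹ A

  data _⊢_≐_tel {m} (Γ : Ctx m) : ∀ {l} → Tel m l → Tel m l → Set where
    ε   : Γ ⊢ ε ≐ ε tel
    _∷_ : ∀ {l A A′} {Δ Δ′ : Tel (suc m) l} →
          Γ ⊢ A ≐ A′ type → Γ ▹ A ⊢ Δ ≐ Δ′ tel → Γ ⊢ A ∷ Δ ≐ A′ ∷ Δ′ tel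

-- The judgements are any family closed under the rules below, so a type
-- theory may have further formers, rules and axioms.  Substitution along
-- context morphisms subsumes weakening, contraction, exchange and
-- substitution for a single variable.

record TypeTheory : Set₁ where
  field
    expressions : Expressions
    judgements  : Judgements expressions

  open Expressions expressions public
  open Telescopes expressions public
  open Judgements judgements public
  open ContextJudgements judgements public

  field
    type⇒ctxt : ∀ {n} {Γ : Ctx n} {A} → Γ ⊢ A type → Γ ctxt
    tm⇒type   : ∀ {n} {Γ : Ctx n} {a A} → Γ ⊢ a ∶ A → Γ ⊢ A type
    ≐type⇒ˡ   : ∀ {n} {Γ : Ctx n} {A B} → Γ ⊢ A ≐ B type → Γ ⊢ A type
    ≐type⇒ʳ   : ∀ {n} {Γ : Ctx n} {A B} → Γ ⊢ A ≐ B type → Γ ⊢ B type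
    ≐tm⇒ˡ     : ∀ {n} {Γ : Ctx n} {a b A} → Γ ⊢ a ≐ b ∶ A → Γ ⊢ a ∶ A
    ≐tm⇒ʳ     : ∀ {n} {Γ : Ctx n} {a b A} → Γ ⊢ a ≐ b ∶ A → Γ ⊢ b ∶ A

    ≐type-refl  : ∀ {n} {Γ : Ctx n} {A} → Γ ⊢ A type → Γ ⊢ A ≐ A type
    ≐type-sym   : ∀ {n} {Γ : Ctx n} {A B} → Γ ⊢ A ≐ B type → Γ ⊢ B ≐ A type
    ≐type-trans : ∀ {n} {Γ : Ctx n} {A B C} →
                  Γ ⊢ A ≐ B type → Γ ⊢ B ≐ C type → Γ ⊢ A ≐ C type
    ≐tm-refl    : ∀ {n} {Γ : Ctx n} {a A} → Γ ⊢ a ∶ A → Γ ⊢ a ≐ a ∶ A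
    ≐tm-sym     : ∀ {n} {Γ : Ctx n} {a b A} → Γ ⊢ a ≐ b ∶ A → Γ ⊢ b ≐ a ∶ A
    ≐tm-trans   : ∀ {n} {Γ : Ctx n} {a b c A} →
                  Γ ⊢ a ≐ b ∶ A → Γ ⊢ b ≐ c ∶ A → Γ ⊢ a ≐ c ∶ A
    tm-conv     : ∀ {n} {Γ : Ctx n} {a A B} →
                  Γ ⊢ a ∶ A → Γ ⊢ A ≐ B type → Γ ⊢ a ∶ B
    ≐tm-conv    : ∀ {n} {Γ : Ctx n} {a b A B} →
                  Γ ⊢ a ≐ b ∶ A → Γ ⊢ A ≐ B type → Γ ⊢ a ≐ b ∶ B

    var-rule : ∀ {n} {Γ : Ctx n} → Γ ctxt → ∀ i → Γ ⊢ var i ∶ Γ ! i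

    type-sub  : ∀ {m n} {Γ : Ctx m} {Δ : Ctx n} {σ A} →
                Δ ⊢ A type → Γ ⊢ σ ∶∶ Δ → Γ ⊢ A [ σ ] type
    tm-sub    : ∀ {m n} {Γ : Ctx m} {Δ : Ctx n} {σ a A} →
                Δ ⊢ a ∶ A → Γ ⊢ σ ∶∶ Δ → Γ ⊢ a [ σ ]ᵗ ∶ A [ σ ]
    ≐type-sub : ∀ {m n} {Γ : Ctx m} {Δ : Ctx n} {σ A B} →
                Δ ⊢ A ≐ B type → Γ ⊢ σ ∶∶ Δ → Γ ⊢ A [ σ ] ≐ B [ σ ] type
    ≐tm-sub   : ∀ {m n} {Γ : Ctx m} {Δ : Ctx n} {σ a b A} →
                Δ ⊢ a ≐ b ∶ A → Γ ⊢ σ ∶∶ Δ →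
                Γ ⊢ a [ σ ]ᵗ ≐ b [ σ ]ᵗ ∶ A [ σ ]
    type-cong : ∀ {m n} {Γ : Ctx m} {Δ : Ctx n} {σ τ A} →
                Δ ⊢ A type → Γ ⊢ σ ≐ τ ∶∶ Δ → Γ ⊢ A [ σ ] ≐ A [ τ ] type
    tm-cong   : ∀ {m n} {Γ : Ctx m} {Δ : Ctx n} {σ τ a A} →
                Δ ⊢ a ∶ A → Γ ⊢ σ ≐ τ ∶∶ Δ →
                Γ ⊢ a [ σ ]ᵗ ≐ a [ τ ]ᵗ ∶ A [ σ ]

-- `J A Δ C d` is J_d in the scope x, y : A, p : Id_A(x,y), Δ.  It has to be
-- able to depend on A, Δ and C: if J were determined by d alone, then the
-- transports of z along p with motives B(x) and B(y) would be one and the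
-- same expression, and every loop would be trivial.

record IdentityTypes (S : TypeTheory) : Set where
  open TypeTheory S

  field
    Id : ∀ {n} → Ty n → Tm n → Tm n → Ty n
    r  : ∀ {n} → Ty n → Tm n → Tm n
    J  : ∀ {n l} (A : Ty n) (Δ : Tel (3 + n) l) (C : Ty (l ⊹ 3 + n))
         (d : Tm (l ⊹ 1 + n)) → Tm (l ⊹ 3 + n)

  -- x, y : A, p : Id_A(x,y)
  pathCtx : ∀ {n} → Ctx n → Ty n → Ctx (3 + n)
  pathCtx Γ A = Γ ▹ A ▹ A [ wk ] ▹ Id (A [ wk ] [ wk ]) v₁ v₀

  -- x, x, r(x) / x, y, p
  diag : ∀ {n} → Ty n → Sub (1 + n) (3 + n)
  diag A = r (A [ wk ]) v₀ ∷ v₀ ∷ v₀ ∷ wk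

  field
    Id-[] : ∀ {m n} (A : Ty n) a b (σ : Sub m n) →
            Id A a b [ σ ] ≡ Id (A [ σ ]) (a [ σ ]ᵗ) (b [ σ ]ᵗ)
    r-[]  : ∀ {m n} (A : Ty n) a (σ : Sub m n) →
            r A a [ σ ]ᵗ ≡ r (A [ σ ]) (a [ σ ]ᵗ)
    J-[]  : ∀ {m n l} (A : Ty n) (Δ : Tel (3 + n) l) C d (σ : Sub m n) →
            J A Δ C d [ lifts l (lift (lift (lift σ))) ]ᵗ
              ≡ J (A [ σ ]) (Δ [ lift (lift (lift σ)) ]*)
                  (C [ lifts l (lift (lift (lift σ))) ])
                  (d [ lifts l (lift σ) ]ᵗ)

    Id-form : ∀ {n} {Γ : Ctx n} {A a b} →
              Γ ⊢ a ∶ A → Γ ⊢ b ∶ A → Γ ⊢ Id A a b type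
    Id-cong : ∀ {n} {Γ : Ctx n} {A A′ a a′ b b′} →
              Γ ⊢ A ≐ A′ type → Γ ⊢ a ≐ a′ ∶ A → Γ ⊢ b ≐ b′ ∶ A →
              Γ ⊢ Id A a b ≐ Id A′ a′ b′ type

    r-intro : ∀ {n} {Γ : Ctx n} {A a} → Γ ⊢ a ∶ A → Γ ⊢ r A a ∶ Id A a a
    r-cong  : ∀ {n} {Γ : Ctx n} {A A′ a a′} →
              Γ ⊢ A ≐ A′ type → Γ ⊢ a ≐ a′ ∶ A →
              Γ ⊢ r A a ≐ r A′ a′ ∶ Id A a a

    J-elim  : ∀ {n l} {Γ : Ctx n} {A} {Δ : Tel (3 + n) l} {C d} →
              pathCtx Γ A ▸ Δ ⊢ C type →
              Γ ▹ A ▸ Δ [ diag A ]* ⊢ d ∶ C [ lifts l (diag A) ] →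
              pathCtx Γ A ▸ Δ ⊢ J A Δ C d ∶ C
    J-comp  : ∀ {n l} {Γ : Ctx n} {A} {Δ : Tel (3 + n) l} {C d} →
              pathCtx Γ A ▸ Δ ⊢ C type →
              Γ ▹ A ▸ Δ [ diag A ]* ⊢ d ∶ C [ lifts l (diag A) ] →
              Γ ▹ A ▸ Δ [ diag A ]* ⊢
                J A Δ C d [ lifts l (diag A) ]ᵗ ≐ d ∶ C [ lifts l (diag A) ]
    J-cong  : ∀ {n l} {Γ : Ctx n} {A A′} {Δ Δ′ : Tel (3 + n) l} {C C′ d d′} →
              Γ ⊢ A ≐ A′ type →
              pathCtx Γ A ⊢ Δ ≐ Δ′ tel →
              pathCtx Γ A ▸ Δ ⊢ C ≐ C′ type →
              Γ ▹ A ▸ Δ [ diag A ]* ⊢ d ≐ d′ ∶ C [ lifts l (diag A) ] →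
              pathCtx Γ A ▸ Δ ⊢ J A Δ C d ≐ J A′ Δ′ C′ d′ ∶ C

record DiscreteIdentityTypes {S : TypeTheory} (I : IdentityTypes S) : Set where
  open TypeTheory S
  open IdentityTypes I
  field
    reflection : ∀ {n} {Γ : Ctx n} {A a b p q α} →
                 Γ ⊢ p ∶ Id A a b → Γ ⊢ q ∶ Id A a b →
                 Γ ⊢ α ∶ Id (Id A a b) p q →
                 Γ ⊢ p ≐ q ∶ Id A a b
    uniqueness : ∀ {n} {Γ : Ctx n} {A a b p q α} →
                 Γ ⊢ p ∶ Id A a b → Γ ⊢ q ∶ Id A a b →
                 Γ ⊢ α ∶ Id (Id A a b) p q →
                 Γ ⊢ α ≐ r (Id A a b) p ∶ Id (Id A a b) p q

module ContextCategory (S : TypeTheory) where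
  open TypeTheory S

  wk-⊙ : ∀ {m n} (a : Tm m) (σ : Sub m n) → wk ⊙ (a ∷ σ) ≡ σ
  wk-⊙ a σ =
    trans (sym (tabulate-∘ _[ a ∷ σ ]ᵗ (var ∘ suc)))
   (trans (tabulate-cong′ λ i → var-[] (suc i) (a ∷ σ))
          (tabulate∘lookup σ))
    where
    tabulate-cong′ : ∀ {X : Set} {k} {f g : Fin k → X} →
                     (∀ i → f i ≡ g i) → tabulate f ≡ tabulate g
    tabulate-cong′ {k = zero}  h = refl
    tabulate-cong′ {k = suc k} h =
      cong₂ _∷_ (h zero) (tabulate-cong′ (h ∘ suc))

  idˢ-⊙ : ∀ {m n} (σ : Sub m n) → idˢ ⊙ σ ≡ σ
  idˢ-⊙ []      = refl
  idˢ-⊙ (a ∷ σ) = cong₂ _∷_ (var-[] zero (a ∷ σ)) (wk-⊙ a σ)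

  ⊙-idˢ : ∀ {m n} (σ : Sub m n) → σ ⊙ idˢ ≡ σ
  ⊙-idˢ σ = trans (map-cong []ᵗ-id σ) (map-id σ)

  ⊙-assoc : ∀ {k l m n} (ρ : Sub m n) (σ : Sub l m) (τ : Sub k l) →
            (ρ ⊙ σ) ⊙ τ ≡ ρ ⊙ (σ ⊙ τ)
  ⊙-assoc ρ σ τ =
    trans (sym (map-∘ _[ τ ]ᵗ _[ σ ]ᵗ ρ)) (map-cong (λ a → []ᵗ-⊙ a σ τ) ρ)

  sub-⊙ : ∀ {l m n} {Θ : Ctx l} {Γ : Ctx m} {Δ : Ctx n} {σ τ} →
          Γ ⊢ σ ∶∶ Δ → Θ ⊢ τ ∶∶ Γ → Θ ⊢ σ ⊙ τ ∶∶ Δ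
  sub-⊙ ([] _) τ = [] (ctxt-of τ)
    where
    ctxt-of : ∀ {m n} {Γ : Ctx m} {Δ : Ctx n} {σ} → Γ ⊢ σ ∶∶ Δ → Γ ctxt
    ctxt-of ([] Γ)  = Γ
    ctxt-of (_ ∷ σ) = ctxt-of σ
  sub-⊙ (a ∷ σ) τ = subst (_ ⊢ _ ∶_) ([]-⊙ _ _ _) (tm-sub a τ) ∷ sub-⊙ σ τ

  ≐sub-⊙ : ∀ {l m n} {Θ : Ctx l} {Γ : Ctx m} {Δ : Ctx n} {σ σ′ τ} →
           Γ ⊢ σ ≐ σ′ ∶∶ Δ → Θ ⊢ τ ∶∶ Γ → Θ ⊢ σ ⊙ τ ≐ σ′ ⊙ τ ∶∶ Δ
  ≐sub-⊙ ([] Γ) τ with sub-⊙ ([] Γ) τ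
  ... | [] Θ = [] Θ
  ≐sub-⊙ (a ∷ σ) τ =
    subst (_ ⊢ _ ≐ _ ∶_) ([]-⊙ _ _ _) (≐tm-sub a τ) ∷ ≐sub-⊙ σ τ

  sub-≐⊙ : ∀ {l m n} {Θ : Ctx l} {Γ : Ctx m} {Δ : Ctx n} {σ τ τ′} →
           Γ ⊢ σ ∶∶ Δ → Θ ⊢ τ ≐ τ′ ∶∶ Γ → Θ ⊢ σ ⊙ τ ≐ σ ⊙ τ′ ∶∶ Δ
  sub-≐⊙ ([] _) τ = [] (ctxt-of τ)
    where
    ctxt-of : ∀ {m n} {Γ : Ctx m} {Δ : Ctx n} {σ τ} → Γ ⊢ σ ≐ τ ∶∶ Δ → Γ ctxt
    ctxt-of ([] Γ)  = Γ
    ctxt-of (_ ∷ σ) = ctxt-of σ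
  sub-≐⊙ (a ∷ σ) τ =
    subst (_ ⊢ _ ≐ _ ∶_) ([]-⊙ _ _ _) (tm-cong a τ) ∷ sub-≐⊙ σ τ

  private
    from-lookup : ∀ {m n} {Θ : Ctx m} (Γ : Ctx n) (σ : Sub m n) → Θ ctxt →
                  (∀ i → Θ ⊢ lookup σ i ∶ (Γ ! i) [ σ ]) → Θ ⊢ σ ∶∶ Γ
    from-lookup ε       []      Θ h = [] Θ
    from-lookup (Γ ▹ A) (a ∷ σ) Θ h =
      subst (_ ⊢ _ ∶_) (drop A) (h zero)
      ∷ from-lookup Γ σ Θ λ i → subst (_ ⊢ _ ∶_) (drop (Γ ! i)) (h (suc i))
      where
      drop : ∀ B → B [ wk ] [ a ∷ σ ] ≡ B [ σ ]
      drop B = trans ([]-⊙ B wk (a ∷ σ)) (cong (B [_]) (wk-⊙ a σ))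

  sub-wk : ∀ {n} {Γ : Ctx n} {A} → Γ ▹ A ctxt → Γ ▹ A ⊢ wk ∶∶ Γ
  sub-wk {Γ = Γ} ΓA = from-lookup Γ wk ΓA λ i →
    subst (λ a → Γ ▹ _ ⊢ a ∶ (Γ ! i) [ wk ]) (sym (lookup∘tabulate (var ∘ suc) i))
          (var-rule ΓA (suc i))

  sub-conv : ∀ {n} {Γ Γ′ : Ctx n} → Γ ≐ Γ′ ctxt → Γ′ ctxt → Γ′ ⊢ idˢ ∶∶ Γ
  sub-conv ε       ε          = [] ε
  sub-conv (Γ ▹ A) (Γ′ ▹ A′) =
    tm-conv (var-rule (Γ′ ▹ A′) zero) (≐type-sym (≐type-sub A w)) ∷ w
    where
    w = subst (_ ⊢_∶∶ _) (idˢ-⊙ wk)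
              (sub-⊙ (sub-conv Γ Γ′) (sub-wk (Γ′ ▹ A′)))

  ≐ctxt-refl : ∀ {n} {Γ : Ctx n} → Γ ctxt → Γ ≐ Γ ctxt
  ≐ctxt-refl ε       = ε
  ≐ctxt-refl (Γ ▹ A) = ≐ctxt-refl Γ ▹ ≐type-refl A

  sub-id : ∀ {n} {Γ : Ctx n} → Γ ctxt → Γ ⊢ idˢ ∶∶ Γ
  sub-id Γ = sub-conv (≐ctxt-refl Γ) Γ

  ≐ctxt-sym : ∀ {n} {Γ Γ′ : Ctx n} → Γ′ ctxt → Γ ≐ Γ′ ctxt → Γ′ ≐ Γ ctxt
  ≐ctxt-sym ε        ε       = ε
  ≐ctxt-sym (Γ′ ▹ _) (Γ ▹ A) =
    ≐ctxt-sym Γ′ Γ ▹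
    subst₂ (_ ⊢_≐_type) ([]-id _) ([]-id _)
           (≐type-sub (≐type-sym A) (sub-conv Γ Γ′))

  ≐ctxt-trans : ∀ {n} {Γ Γ′ Γ″ : Ctx n} → Γ ctxt → Γ′ ctxt →
                Γ ≐ Γ′ ctxt → Γ′ ≐ Γ″ ctxt → Γ ≐ Γ″ ctxt
  ≐ctxt-trans _       _        ε        ε          = ε
  ≐ctxt-trans (Γ ▹ _) (Γ′ ▹ _) (ΓΓ′ ▹ A) (Γ′Γ″ ▹ A′) =
    ≐ctxt-trans Γ Γ′ ΓΓ′ Γ′Γ″ ▹
    ≐type-trans A
      (subst₂ (_ ⊢_≐_type) ([]-id _) ([]-id _)
              (≐type-sub A′ (sub-conv (≐ctxt-sym Γ′ ΓΓ′) Γ)))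

  ≐sub-refl : ∀ {m n} {Γ : Ctx m} {Δ : Ctx n} {σ} →
              Γ ⊢ σ ∶∶ Δ → Γ ⊢ σ ≐ σ ∶∶ Δ
  ≐sub-refl ([] Γ)  = [] Γ
  ≐sub-refl (a ∷ σ) = ≐tm-refl a ∷ ≐sub-refl σ

  ≐sub-sym : ∀ {m n} {Γ : Ctx m} {Δ : Ctx n} {σ τ} → Δ ctxt →
             Γ ⊢ σ ≐ τ ∶∶ Δ → Γ ⊢ τ ≐ σ ∶∶ Δ
  ≐sub-sym _       ([] Γ)  = [] Γ
  ≐sub-sym (Δ ▹ A) (a ∷ σ) =
    ≐tm-conv (≐tm-sym a) (type-cong A σ) ∷ ≐sub-sym Δ σ

  ≐sub-trans : ∀ {m n} {Γ : Ctx m} {Δ : Ctx n} {ρ σ τ} → Δ ctxt →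
               Γ ⊢ ρ ≐ σ ∶∶ Δ → Γ ⊢ σ ≐ τ ∶∶ Δ → Γ ⊢ ρ ≐ τ ∶∶ Δ
  ≐sub-trans _       ([] Γ)  ([] _)  = [] Γ
  ≐sub-trans (Δ ▹ A) (a ∷ σ) (b ∷ τ) =
    ≐tm-trans a (≐tm-conv b (≐type-sym (type-cong A σ))) ∷ ≐sub-trans Δ σ τ

  sub-convert : ∀ {m n} {Γ Γ′ : Ctx m} {Δ Δ′ : Ctx n} {σ} →
                Γ ≐ Γ′ ctxt → Γ′ ctxt → Δ ≐ Δ′ ctxt → Δ ctxt → Δ′ ctxt →
                Γ ⊢ σ ∶∶ Δ → Γ′ ⊢ σ ∶∶ Δ′
  sub-convert {σ = σ} ΓΓ′ Γ′ ΔΔ′ Δ Δ′ s =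
    subst (_ ⊢_∶∶ _) (trans (⊙-assoc idˢ σ idˢ) (trans (idˢ-⊙ _) (⊙-idˢ σ)))
      (sub-⊙ (sub-⊙ (sub-conv (≐ctxt-sym Δ′ ΔΔ′) Δ) s) (sub-conv ΓΓ′ Γ′))

  ≐sub-convert : ∀ {m n} {Γ Γ′ : Ctx m} {Δ Δ′ : Ctx n} {σ τ} →
                 Γ ≐ Γ′ ctxt → Γ′ ctxt → Δ ≐ Δ′ ctxt → Δ ctxt → Δ′ ctxt →
                 Γ ⊢ σ ≐ τ ∶∶ Δ → Γ′ ⊢ σ ≐ τ ∶∶ Δ′
  ≐sub-convert {σ = σ} {τ} ΓΓ′ Γ′ ΔΔ′ Δ Δ′ s =
    subst₂ (_ ⊢_≐_∶∶ _) (e σ) (e τ)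
      (≐sub-⊙ (sub-≐⊙ (sub-conv (≐ctxt-sym Δ′ ΔΔ′) Δ) s) (sub-conv ΓΓ′ Γ′))
    where
    e : ∀ ρ → (idˢ ⊙ ρ) ⊙ idˢ ≡ ρ
    e ρ = trans (⊙-assoc idˢ ρ idˢ) (trans (idˢ-⊙ _) (⊙-idˢ ρ))

  record Context : Set where
    constructor mkContext
    field
      {length} : ℕ
      ctx      : Ctx length
      isCtxt   : ctx ctxt

  open Context public

  record Morphism (Γ Δ : Context) : Set where
    constructor mkMorphism
    field
      terms     : Sub (length Γ) (length Δ)
      derivable : ctx Γ ⊢ terms ∶∶ ctx Δ

  open Morphism public

  data _≈ᵒ_ : Context → Context → Set where
    equal : ∀ {n} {Γ Γ′ : Ctx n} {w w′} → Γ ≐ Γ′ ctxt →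
            mkContext Γ w ≈ᵒ mkContext Γ′ w′

  data _≈ᵐ_ : ∀ {Γ Δ Γ′ Δ′} → Morphism Γ Δ → Morphism Γ′ Δ′ → Set where
    equal : ∀ {m n} {Γ Γ′ : Ctx m} {Δ Δ′ : Ctx n} {u u′ v v′ f f′ w w′} →
            Γ ≐ Γ′ ctxt → Δ ≐ Δ′ ctxt → Γ ⊢ f ≐ f′ ∶∶ Δ →
            mkMorphism {mkContext Γ u} {mkContext Δ v} f w
              ≈ᵐ mkMorphism {mkContext Γ′ u′} {mkContext Δ′ v′} f′ w′

  private
    ≈ᵐ-≡ : ∀ {Γ Δ} (f g : Morphism Γ Δ) → terms f ≡ terms g → f ≈ᵐ g
    ≈ᵐ-≡ {Γ} {Δ} (mkMorphism f w) (mkMorphism .f _) refl =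
      equal (≐ctxt-refl (isCtxt Γ)) (≐ctxt-refl (isCtxt Δ)) (≐sub-refl w)

  𝒞 : Category
  𝒞 = record
    { objects = record
        { Carrier = Context
        ; _≈_ = _≈ᵒ_
        ; isEquivalence = record
            { refl  = λ {Γ} → equal (≐ctxt-refl (isCtxt Γ))
            ; sym   = λ { {_} {mkContext _ w} (equal p) →
                          equal (≐ctxt-sym w p) }
            ; trans = λ { {mkContext _ w} {mkContext _ w′} (equal p) (equal q) →
                          equal (≐ctxt-trans w w′ p q) }
            }
        }
    ; arrows = record
        { Carrier = λ (Γ , Δ) → Morphism Γ Δ
        ; _≈_ = _≈ᵐ_
        ; isEquivalence = record
            { refl  = λ {_} {f} → ≈ᵐ-≡ f f refl
            ; sym   = λ { (equal {u′ = u′} {v} {v′} p q s) →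
                equal (≐ctxt-sym u′ p) (≐ctxt-sym v′ q)
                      (≐sub-convert p u′ q v v′ (≐sub-sym v s)) }
            ; trans = λ { (equal {u = u} {u′} {v} {v′} p q s) (equal p′ q′ s′) →
                equal (≐ctxt-trans u u′ p p′) (≐ctxt-trans v v′ q q′)
                      (≐sub-trans v s
                        (≐sub-convert (≐ctxt-sym u′ p) u
                                      (≐ctxt-sym v′ q) v′ v s′)) }
            }
        }
    ; ≈₁-ends = λ { (equal p q _) → equal p , equal q }
    ; coe₁ = λ { (equal {w = u} {u′} p) (equal {w = v} {v′} q)
                 (mkMorphism f w) →
          mkMorphism f (sub-convert p u′ q v v′ w) ,
          equal p q (≐sub-refl w) }
    ; id₁ = λ Γ → mkMorphism idˢ (sub-id (isCtxt Γ))
    ; _∘₁_ = λ g f →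
        mkMorphism (terms g ⊙ terms f) (sub-⊙ (derivable g) (derivable f))
    ; id₁-cong = λ { (equal {w = w} p) → equal p p (≐sub-refl (sub-id w)) }
    ; ∘₁-cong = λ { (equal {u = u} {u′} {v} {v′} {w′ = w′} p q s)
                    (equal {w = w} p′ q′ s′) →
        equal p′ q
          (≐sub-trans v (≐sub-⊙ s w)
            (sub-≐⊙ (sub-convert (≐ctxt-sym u′ p) u (≐ctxt-sym v′ q) v′ v w′)
                    s′)) }
    ; identityˡ = λ f → ≈ᵐ-≡ _ _ (idˢ-⊙ (terms f))
    ; identityʳ = λ f → ≈ᵐ-≡ _ _ (⊙-idˢ (terms f))
    ; assoc = λ h g f → ≈ᵐ-≡ _ _ (⊙-assoc (terms h) (terms g) (terms f))
    }

module IdentityContexts {S : TypeTheory} (I : IdentityTypes S) where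
  open TypeTheory S
  open IdentityTypes I
  open ContextCategory S

  -- The context (x, x′ : Λ, p : Id_Λ(x,x′)) is presented, by exchange,
  -- with its variables interleaved: x₁, x₁′, p₁, x₂, x₂′, p₂, …
  triple : ℕ → ℕ
  triple zero    = zero
  triple (suc k) = 3 + triple k

  ⟨_,_,_⟩ : ∀ {n k} → Sub n k → Sub n k → Sub n k → Sub n (triple k)
  ⟨ []    , []    , []    ⟩ = []
  ⟨ s ∷ f , t ∷ g , q ∷ p ⟩ = q ∷ t ∷ s ∷ ⟨ f , g , p ⟩

  src : ∀ {k} → Sub (triple k) k
  src {zero}  = []
  src {suc k} = var (suc (suc zero)) ∷ src ⊙ wk ⊙ wk ⊙ wk

  tgt : ∀ {k} → Sub (triple k) k
  tgt {zero}  = []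
  tgt {suc k} = var (suc zero) ∷ tgt ⊙ wk ⊙ wk ⊙ wk

  -- x, x, r(x) / x, x′, p
  diagᶜ : ∀ {k} → Ctx k → Sub k (triple k)
  diagᶜ ε       = []
  diagᶜ (Λ ▹ D) = r (D [ wk ]) v₀ ∷ v₀ ∷ v₀ ∷ diagᶜ Λ ⊙ wk

  mutual
    -- Elimination for Id_Λ, with post-context Δ, into the type C, in the
    -- scope x, x′ : Λ, p : Id_Λ(x,x′), Δ.
    Jᶜ : ∀ {k l} (Λ : Ctx k) (Δ : Tel (triple k) l) (C : Ty (l ⊹ triple k))
         (d : Tm (l ⊹ k)) → Tm (l ⊹ triple k)
    Jᶜ ε       Δ C d = d
    Jᶜ {l = l} (Λ ▹ D) Δ C d =
      Jᶜ Λ (D [ src ] ∷ D [ tgt ] [ wk ] ∷ IdOver Λ D ∷ Δ) C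
         (J D (Δ [ δ ]*) (C [ lifts l δ ]) d)
      where δ = lift (lift (lift (diagᶜ Λ)))

    -- p*(z) : D(x), in the scope x, x′ : Λ, p : Id_Λ(x,x′), z : D(x′).
    transport : ∀ {k} → Ctx k → Ty k → Tm (suc (triple k))
    transport Λ D = Jᶜ Λ (D [ tgt ] ∷ ε) (D [ src ] [ wk ]) v₀

    -- Id_{D(x)}(y, p*y′), in the scope
    -- x, x′ : Λ, p : Id_Λ(x,x′), y : D(x), y′ : D(x′).
    IdOver : ∀ {k} → Ctx k → Ty k → Ty (2 + triple k)
    IdOver Λ D =
      Id (D [ src ] [ wk ] [ wk ]) v₁ (transport Λ D [ lift wk ]ᵗ)

  wks : ∀ {n} k → Sub (k + n) n
  wks k = tabulate (var ∘ (k ↑ʳ_))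

  lastVars : ∀ {n} k → Sub (k + n) k
  lastVars {n} k = tabulate (var ∘ (_↑ˡ n))

  -- The context (x : Γ, p : Id_Δ(f(x), g(x))).
  IdCtx : ∀ {n k} → Ctx n → Ctx k → Sub n k → Sub n k → Ctx (k + n)
  IdCtx Γ ε             []      []      = Γ
  IdCtx Γ (_▹_ {k} Λ D) (s ∷ f) (t ∷ g) =
    IdCtx Γ Λ f g ▹
    Id (D [ f ⊙ wks k ]) (s [ wks k ]ᵗ)
       (transport Λ D
          [ t [ wks k ]ᵗ ∷ ⟨ f ⊙ wks k , g ⊙ wks k , lastVars k ⟩ ]ᵗ)

  -- x : Γ ⊢ α(x) : Id_Δ(f(x), g(x)), expressed by saying that (x, α(x)) is
  -- an element of the context above; likewise for definitional equality.
  infix 3 _⊢_∶Id⟨_⟩_∼_ _⊢_≐_∶Id⟨_⟩_∼_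

  _⊢_∶Id⟨_⟩_∼_ : ∀ {n k} → Ctx n → Vec (Tm n) k → Ctx k →
                 Sub n k → Sub n k → Set
  Γ ⊢ α ∶Id⟨ Δ ⟩ f ∼ g = Γ ⊢ α ++ idˢ ∶∶ IdCtx Γ Δ f g

  _⊢_≐_∶Id⟨_⟩_∼_ : ∀ {n k} → Ctx n → Vec (Tm n) k → Vec (Tm n) k → Ctx k →
                   Sub n k → Sub n k → Set
  Γ ⊢ α ≐ β ∶Id⟨ Δ ⟩ f ∼ g = Γ ⊢ α ++ idˢ ≐ β ++ idˢ ∶∶ IdCtx Γ Δ f g

  record IdCell {Γ Δ : Context} (f g : Morphism Γ Δ) : Set where
    constructor mkIdCell
    field
      cell          : Vec (Tm (length Γ)) (length Δ)
      cellDerivable : ctx Γ ⊢ cell ∶Id⟨ ctx Δ ⟩ terms f ∼ terms g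

  data _≈ⁱ_ : ∀ {Γ Δ Γ′ Δ′} {f g : Morphism Γ Δ} {f′ g′ : Morphism Γ′ Δ′} →
              IdCell f g → IdCell f′ g′ → Set where
    equal : ∀ {m n} {Γ Γ′ : Ctx m} {Δ Δ′ : Ctx n} {u u′ v v′}
              {f f′ g g′ wf wf′ wg wg′ α α′ wα wα′} →
            Γ ≐ Γ′ ctxt → Δ ≐ Δ′ ctxt →
            Γ ⊢ f ≐ f′ ∶∶ Δ → Γ ⊢ g ≐ g′ ∶∶ Δ →
            Γ ⊢ α ≐ α′ ∶Id⟨ Δ ⟩ f ∼ g →
            mkIdCell {mkContext Γ u} {mkContext Δ v}
                     {mkMorphism f wf} {mkMorphism g wg} α wα
              ≈ⁱ mkIdCell {mkContext Γ′ u′} {mkContext Δ′ v′}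
                          {mkMorphism f′ wf′} {mkMorphism g′ wg′} α′ wα′

  IdCells : Parallel 𝒞 → Set
  IdCells (_ , f , g) = IdCell f g

  _≈₂ᵢ_ : IRel IdCells 0ℓ
  α ≈₂ᵢ β = α ≈ⁱ β

{-# OPTIONS --safe #-}
module Submission where

-- For a context Δ let P Δ be the context (x, x′ : Δ, p : Id_Δ(x,x′)).  A 2-cell
-- f ⇒ g : Γ → Δ is a morphism Γ → P Δ lying over (f , g).  By J, terms of every
-- type extend along r : Δ → P Δ, also in the presence of a post-context.  For the
-- types Id_A(a,b) the extension is unique: if p and q agree on the diagonal, then
-- J extends reflexivity to a proof of p = q, and discreteness turns that into a
-- definitional equality.  By induction on Δ, maps into P Δ over given ends extend
-- uniquely along r.  Existence provides composition and inverses of paths and the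
-- action P Γ → P Δ of every f : Γ → Δ; uniqueness provides the groupoid laws,
-- functoriality and naturality, because each equation holds on the diagonal.

open import Defs
open import Data.Fin using (Fin; zero; suc; _↑ˡ_; _↑ʳ_)
open import Data.Nat using (ℕ; zero; suc; _+_)
open import Data.Product using (Σ; _,_; _×_; proj₁; proj₂; ∃-syntax)
open import Data.Vec using ([]; _∷_; _++_; lookup; tabulate)
open import Data.Vec.Properties
  using (lookup-++ˡ; lookup-++ʳ; tabulate-∘; tabulate-cong; tabulate∘lookup)
open import Relation.Binary.Indexed.Heterogeneous using (IndexedSetoid)
open import Relation.Binary.PropositionalEquality
  using (_≡_; refl; sym; trans; cong; cong₂; subst₂)
open import Relation.Binary.Structures using (IsEquivalence)

-- Reflection applies one dimension up: two paths that are connected by a path are equal, but two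
-- terms of an arbitrary type connected by a path need not be. Uniqueness of extensions can
-- therefore hold only among maps with the same ends, and each law has its ends matched before it is
-- tested on the diagonal. Composition and associativity concern composable pairs and triples rather
-- than single paths, so extension along r must survive base change along the source projection.
-- That is what the post-contexts are for, and why pullbacks of the source projection are built as
-- context extensions. The second obstacle is that `J` depends on type expressions. Every operation
-- made from it depends on the presentation of the contexts, yet cells are compared across
-- definitionally equal contexts. The syntactic facts are collected in `PathCategory`, from whose
-- axioms the laws are derived by diagram chases.

cong₃ : ∀ {X Y Z W : Set} (f : X → Y → Z → W) {x x′ y y′ z z′} →
        x ≡ x′ → y ≡ y′ → z ≡ z′ → f x y z ≡ f x′ y′ z′
cong₃ f refl refl refl = refl

-- Calculus of simultaneous substitutions and derivable judgements

module Substitution (S : TypeTheory) where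
  open TypeTheory S
  open ContextCategory S

  lift-∷ : ∀ {l m n} (σ : Sub m n) a (τ : Sub l m) →
           lift σ ⊙ (a ∷ τ) ≡ a ∷ σ ⊙ τ
  lift-∷ σ a τ =
    cong₂ _∷_ (var-[] _ _)
      (trans (⊙-assoc σ wk (a ∷ τ)) (cong (σ ⊙_) (wk-⊙ a τ)))

  lift-⊙ : ∀ {l m n} (σ : Sub m n) (τ : Sub l m) →
           lift σ ⊙ lift τ ≡ lift (σ ⊙ τ)
  lift-⊙ σ τ = trans (lift-∷ σ _ _) (cong (_ ∷_) (sym (⊙-assoc σ τ wk)))

  lift-id : ∀ {n} → lift (idˢ {n}) ≡ idˢ
  lift-id = cong (v₀ ∷_) (idˢ-⊙ wk)

  lift³-∷ : ∀ {l m n} (σ : Sub m n) a b c (τ : Sub l m) →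
            lift (lift (lift σ)) ⊙ (a ∷ b ∷ c ∷ τ) ≡ a ∷ b ∷ c ∷ σ ⊙ τ
  lift³-∷ σ a b c τ =
    trans (lift-∷ _ a _)
      (cong (a ∷_) (trans (lift-∷ _ b _) (cong (b ∷_) (lift-∷ σ c τ))))

  lifts-⊙ : ∀ {k m n} l (σ : Sub m n) (τ : Sub k m) →
            lifts l σ ⊙ lifts l τ ≡ lifts l (σ ⊙ τ)
  lifts-⊙ zero    σ τ = refl
  lifts-⊙ (suc l) σ τ = trans (lifts-⊙ l (lift σ) (lift τ)) (cong (lifts l) (lift-⊙ σ τ))

  lifts-id : ∀ {n} l → lifts l (idˢ {n}) ≡ idˢ
  lifts-id zero    = refl
  lifts-id (suc l) = trans (cong (lifts l) lift-id) (lifts-id l)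

  wk²-⊙ : ∀ {m n} a b (σ : Sub m n) → (wk ⊙ wk) ⊙ (a ∷ b ∷ σ) ≡ σ
  wk²-⊙ a b σ =
    trans (⊙-assoc wk wk _) (trans (cong (wk ⊙_) (wk-⊙ a _)) (wk-⊙ b σ))

  wk³-⊙ : ∀ {m n} a b c (σ : Sub m n) →
          (wk ⊙ wk ⊙ wk) ⊙ (a ∷ b ∷ c ∷ σ) ≡ σ
  wk³-⊙ a b c σ =
    trans (⊙-assoc wk (wk ⊙ wk) _)
      (trans (cong (wk ⊙_) (wk²-⊙ a b _)) (wk-⊙ c σ))

  []-≡ : ∀ {l m n} (A : Ty n) {σ : Sub m n} {τ : Sub l m} {ρ} →
         σ ⊙ τ ≡ ρ → A [ σ ] [ τ ] ≡ A [ ρ ]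
  []-≡ A e = trans ([]-⊙ A _ _) (cong (A [_]) e)

  []ᵗ-≡ : ∀ {l m n} (a : Tm n) {σ : Sub m n} {τ : Sub l m} {ρ} →
          σ ⊙ τ ≡ ρ → a [ σ ]ᵗ [ τ ]ᵗ ≡ a [ ρ ]ᵗ
  []ᵗ-≡ a e = trans ([]ᵗ-⊙ a _ _) (cong (a [_]ᵗ) e)

  []*-≡ : ∀ {k m n l} (Θ : Tel n l) {σ : Sub m n} {τ : Sub k m} {ρ} →
          σ ⊙ τ ≡ ρ → Θ [ σ ]* [ τ ]* ≡ Θ [ ρ ]*
  []*-≡ ε       e    = refl
  []*-≡ (A ∷ Θ) refl = cong₂ _∷_ ([]-⊙ A _ _) ([]*-≡ Θ (lift-⊙ _ _))

  []*-id : ∀ {n l} (Θ : Tel n l) → Θ [ idˢ ]* ≡ Θ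
  []*-id ε       = refl
  []*-id (A ∷ Θ) = cong₂ _∷_ ([]-id A) (trans (cong (Θ [_]*) lift-id) ([]*-id Θ))

  lifts-id-[] : ∀ {n} l (C : Ty (l ⊹ n)) → C [ lifts l idˢ ] ≡ C
  lifts-id-[] l C = trans (cong (C [_]) (lifts-id l)) ([]-id C)

  wk-∷ : ∀ {m n} (A : Ty n) {a} {σ : Sub m n} → A [ wk ] [ a ∷ σ ] ≡ A [ σ ]
  wk-∷ A = []-≡ A (wk-⊙ _ _)

  tm-≡ : ∀ {n} {Γ : Ctx n} {a A B} → A ≡ B → Γ ⊢ a ∶ A → Γ ⊢ a ∶ B
  tm-≡ refl a = a

  ≐tm-≡ : ∀ {n} {Γ : Ctx n} {a b A B} → A ≡ B → Γ ⊢ a ≐ b ∶ A → Γ ⊢ a ≐ b ∶ B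
  ≐tm-≡ refl a = a

  ≐tm-≡₃ : ∀ {n} {Γ : Ctx n} {a b c d A B} → a ≡ c → b ≡ d → A ≡ B →
           Γ ⊢ a ≐ b ∶ A → Γ ⊢ c ≐ d ∶ B
  ≐tm-≡₃ refl refl refl a = a

  sub-≡ : ∀ {m n} {Γ : Ctx m} {Δ : Ctx n} {σ τ} → σ ≡ τ →
          Γ ⊢ σ ∶∶ Δ → Γ ⊢ τ ∶∶ Δ
  sub-≡ refl s = s

  ≐sub-≡ : ∀ {m n} {Γ : Ctx m} {Δ : Ctx n} {σ τ σ′ τ′} → σ ≡ σ′ → τ ≡ τ′ →
           Γ ⊢ σ ≐ τ ∶∶ Δ → Γ ⊢ σ′ ≐ τ′ ∶∶ Δ
  ≐sub-≡ refl refl s = s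

  type-≡ : ∀ {n} {Γ : Ctx n} {A B} → A ≡ B → Γ ⊢ A type → Γ ⊢ B type
  type-≡ refl a = a

  dom-ctxt : ∀ {m n} {Γ : Ctx m} {Δ : Ctx n} {σ} → Γ ⊢ σ ∶∶ Δ → Γ ctxt
  dom-ctxt ([] Γ)  = Γ
  dom-ctxt (_ ∷ σ) = dom-ctxt σ

  ≐sub-dom : ∀ {m n} {Γ : Ctx m} {Δ : Ctx n} {σ τ} → Γ ⊢ σ ≐ τ ∶∶ Δ → Γ ctxt
  ≐sub-dom ([] Γ)  = Γ
  ≐sub-dom (_ ∷ σ) = ≐sub-dom σ

  ≐sub⇒ˡ : ∀ {m n} {Γ : Ctx m} {Δ : Ctx n} {σ τ} → Γ ⊢ σ ≐ τ ∶∶ Δ → Γ ⊢ σ ∶∶ Δ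
  ≐sub⇒ˡ ([] Γ)  = [] Γ
  ≐sub⇒ˡ (a ∷ σ) = ≐tm⇒ˡ a ∷ ≐sub⇒ˡ σ

  ≐sub⇒ʳ : ∀ {m n} {Γ : Ctx m} {Δ : Ctx n} {σ τ} → Δ ctxt →
           Γ ⊢ σ ≐ τ ∶∶ Δ → Γ ⊢ τ ∶∶ Δ
  ≐sub⇒ʳ Δ s = ≐sub⇒ˡ (≐sub-sym Δ s)

  tail-ctxt : ∀ {n} {Γ : Ctx n} {A} → Γ ▹ A ctxt → Γ ctxt
  tail-ctxt (Γ ▹ _) = Γ

  head-type : ∀ {n} {Γ : Ctx n} {A} → Γ ▹ A ctxt → Γ ⊢ A type
  head-type (_ ▹ A) = A

  ▸-ctxt⇒ˡ : ∀ {n l} {Γ : Ctx n} (Θ : Tel n l) → Γ ▸ Θ ctxt → Γ ctxt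
  ▸-ctxt⇒ˡ ε       w = w
  ▸-ctxt⇒ˡ (A ∷ Θ) w = tail-ctxt (▸-ctxt⇒ˡ Θ w)

  extend : ∀ {n} {Γ : Ctx n} {A} → Γ ⊢ A type → Γ ▹ A ctxt
  extend A = type⇒ctxt A ▹ A

  v₀-rule : ∀ {n} {Γ : Ctx n} {A} → Γ ⊢ A type → Γ ▹ A ⊢ v₀ ∶ A [ wk ]
  v₀-rule A = var-rule (extend A) _

  wk-rule : ∀ {n} {Γ : Ctx n} {A} → Γ ⊢ A type → Γ ▹ A ⊢ wk ∶∶ Γ
  wk-rule A = sub-wk (extend A)

  wk-type : ∀ {n} {Γ : Ctx n} {A B} → Γ ⊢ A type → Γ ⊢ B type → Γ ▹ A ⊢ B [ wk ] type
  wk-type A B = type-sub B (wk-rule A)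

  lift-rule : ∀ {m n} {Γ : Ctx m} {Δ : Ctx n} {σ A} →
              Δ ⊢ A type → Γ ⊢ σ ∶∶ Δ → Γ ▹ A [ σ ] ⊢ lift σ ∶∶ Δ ▹ A
  lift-rule {A = A} hA s =
    tm-≡ ([]-⊙ A _ _) (v₀-rule (type-sub hA s)) ∷ sub-⊙ s (wk-rule (type-sub hA s))

  lift-cong : ∀ {m n} {Γ : Ctx m} {Δ : Ctx n} {σ τ A} →
              Δ ⊢ A type → Γ ⊢ σ ≐ τ ∶∶ Δ →
              Γ ▹ A [ σ ] ⊢ lift σ ≐ lift τ ∶∶ Δ ▹ A
  lift-cong {A = A} hA s =
    ≐tm-refl (tm-≡ ([]-⊙ A _ _) (v₀-rule hA′)) ∷ ≐sub-⊙ s (wk-rule hA′)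
    where hA′ = type-sub hA (≐sub⇒ˡ s)

  lifts-rule : ∀ {m n l} {Γ : Ctx m} {Δ : Ctx n} {σ} (Θ : Tel n l) →
               Δ ▸ Θ ctxt → Γ ⊢ σ ∶∶ Δ → Γ ▸ Θ [ σ ]* ⊢ lifts l σ ∶∶ Δ ▸ Θ
  lifts-rule ε       w s = s
  lifts-rule (A ∷ Θ) w s = lifts-rule Θ w (lift-rule (head-type (▸-ctxt⇒ˡ Θ w)) s)

  lifts-cong : ∀ {m n l} {Γ : Ctx m} {Δ : Ctx n} {σ τ} (Θ : Tel n l) →
               Δ ▸ Θ ctxt → Γ ⊢ σ ≐ τ ∶∶ Δ →
               Γ ▸ Θ [ σ ]* ⊢ lifts l σ ≐ lifts l τ ∶∶ Δ ▸ Θ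
  lifts-cong ε       w s = s
  lifts-cong (A ∷ Θ) w s = lifts-cong Θ w (lift-cong (head-type (▸-ctxt⇒ˡ Θ w)) s)

  type-cong₂ : ∀ {m n} {Γ : Ctx m} {Δ : Ctx n} {σ τ A B} →
               Δ ⊢ A ≐ B type → Γ ⊢ σ ≐ τ ∶∶ Δ → Γ ⊢ A [ σ ] ≐ B [ τ ] type
  type-cong₂ p s = ≐type-trans (≐type-sub p (≐sub⇒ˡ s)) (type-cong (≐type⇒ʳ p) s)

  ⊙-cong : ∀ {l m n} {Θ : Ctx l} {Γ : Ctx m} {Δ : Ctx n} {σ σ′ τ τ′} → Δ ctxt →
           Γ ⊢ σ ≐ σ′ ∶∶ Δ → Θ ⊢ τ ≐ τ′ ∶∶ Γ → Θ ⊢ σ ⊙ τ ≐ σ′ ⊙ τ′ ∶∶ Δ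
  ⊙-cong Δ s t = ≐sub-trans Δ (≐sub-⊙ s (≐sub⇒ˡ t)) (sub-≐⊙ (≐sub⇒ʳ Δ s) t)

  ≐type-≡ : ∀ {n} {Γ : Ctx n} {A B A′ B′} → A ≡ A′ → B ≡ B′ →
            Γ ⊢ A ≐ B type → Γ ⊢ A′ ≐ B′ type
  ≐type-≡ refl refl p = p

  ≐type-reflexive : ∀ {n} {Γ : Ctx n} {A B} → A ≡ B → Γ ⊢ A type → Γ ⊢ A ≐ B type
  ≐type-reflexive refl = ≐type-refl

  tel-cong : ∀ {m n l} {Γ : Ctx m} {Δ : Ctx n} {σ τ} {Θ Θ′ : Tel n l} →
             Δ ⊢ Θ ≐ Θ′ tel → Γ ⊢ σ ≐ τ ∶∶ Δ → Γ ⊢ Θ [ σ ]* ≐ Θ′ [ τ ]* tel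
  tel-cong ε       s = ε
  tel-cong (A ∷ Θ) s = type-cong₂ A s ∷ tel-cong Θ (lift-cong (≐type⇒ˡ A) s)

  module Convert {n} {Γ Γ′ : Ctx n} (p : Γ ≐ Γ′ ctxt) (w : Γ′ ctxt) where
    private i = sub-conv p w

    type-convert : ∀ {A} → Γ ⊢ A type → Γ′ ⊢ A type
    type-convert {A} a = type-≡ ([]-id A) (type-sub a i)

    tm-convert : ∀ {a A} → Γ ⊢ a ∶ A → Γ′ ⊢ a ∶ A
    tm-convert {a} {A} t = subst₂ (Γ′ ⊢_∶_) ([]ᵗ-id a) ([]-id A) (tm-sub t i)

    ≐tm-convert : ∀ {a b A} → Γ ⊢ a ≐ b ∶ A → Γ′ ⊢ a ≐ b ∶ A
    ≐tm-convert {a} {b} {A} t =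
      ≐tm-≡₃ ([]ᵗ-id a) ([]ᵗ-id b) ([]-id A) (≐tm-sub t i)

    ≐dom-convert : ∀ {k} {Δ : Ctx k} {σ τ} → Γ ⊢ σ ≐ τ ∶∶ Δ → Γ′ ⊢ σ ≐ τ ∶∶ Δ
    ≐dom-convert s = ≐sub-≡ (⊙-idˢ _) (⊙-idˢ _) (≐sub-⊙ s i)

  open Convert public

  ▸-convert : ∀ {n l} {Γ Γ′ : Ctx n} (Θ : Tel n l) → Γ ≐ Γ′ ctxt → Γ′ ctxt →
              Γ ▸ Θ ctxt → (Γ ▸ Θ ≐ Γ′ ▸ Θ ctxt) × (Γ′ ▸ Θ ctxt)
  ▸-convert ε       p w v = p , w
  ▸-convert (A ∷ Θ) p w v =
    ▸-convert Θ (p ▹ ≐type-refl hA) (w ▹ type-convert p w hA) v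
    where hA = head-type (▸-ctxt⇒ˡ Θ v)

-- Path contexts and the rules of identity contexts

module PathContexts {S : TypeTheory} (I : IdentityTypes S) where
  open TypeTheory S
  open IdentityTypes I
  open ContextCategory S
  open IdentityContexts I
  open Substitution S

  -- x, x′ : Λ, p : Id_Λ(x,x′), with the variables interleaved as in `triple`.
  P : ∀ {k} → Ctx k → Ctx (triple k)
  P ε       = ε
  P (Λ ▹ D) = P Λ ▹ D [ src ] ▹ D [ tgt ] [ wk ] ▹ IdOver Λ D

  src-∷ : ∀ {m k} q t s (ρ : Sub m (triple k)) →
          src {suc k} ⊙ (q ∷ t ∷ s ∷ ρ) ≡ s ∷ src ⊙ ρ
  src-∷ q t s ρ =
    cong₂ _∷_ (var-[] _ _)
      (trans (⊙-assoc src _ _) (cong (src ⊙_) (wk³-⊙ q t s ρ)))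

  tgt-∷ : ∀ {m k} q t s (ρ : Sub m (triple k)) →
          tgt {suc k} ⊙ (q ∷ t ∷ s ∷ ρ) ≡ t ∷ tgt ⊙ ρ
  tgt-∷ q t s ρ =
    cong₂ _∷_ (var-[] _ _)
      (trans (⊙-assoc tgt _ _) (cong (tgt ⊙_) (wk³-⊙ q t s ρ)))

  src-diag : ∀ {k} (Λ : Ctx k) → src ⊙ diagᶜ Λ ≡ idˢ
  src-diag ε       = refl
  src-diag (Λ ▹ D) =
    trans (src-∷ _ _ _ _)
      (cong (_ ∷_) (trans (sym (⊙-assoc src _ _))
        (trans (cong (_⊙ wk) (src-diag Λ)) (idˢ-⊙ wk))))

  tgt-diag : ∀ {k} (Λ : Ctx k) → tgt ⊙ diagᶜ Λ ≡ idˢ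
  tgt-diag ε       = refl
  tgt-diag (Λ ▹ D) =
    trans (tgt-∷ _ _ _ _)
      (cong (_ ∷_) (trans (sym (⊙-assoc tgt _ _))
        (trans (cong (_⊙ wk) (tgt-diag Λ)) (idˢ-⊙ wk))))

  src-diag-⊙ : ∀ {m k} (Λ : Ctx k) (σ : Sub m k) → src ⊙ diagᶜ Λ ⊙ σ ≡ σ
  src-diag-⊙ Λ σ =
    trans (sym (⊙-assoc src _ _)) (trans (cong (_⊙ σ) (src-diag Λ)) (idˢ-⊙ σ))

  tgt-diag-⊙ : ∀ {m k} (Λ : Ctx k) (σ : Sub m k) → tgt ⊙ diagᶜ Λ ⊙ σ ≡ σ
  tgt-diag-⊙ Λ σ =
    trans (sym (⊙-assoc tgt _ _)) (trans (cong (_⊙ σ) (tgt-diag Λ)) (idˢ-⊙ σ))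

  -- The diagonal of an extended context factors as the diagonal of the last type over a fixed base
  -- point, followed by the diagonal of the base. The two-stage elimination `Jᶜ` mirrors this
  -- factorisation.
  diag-step : ∀ {k} (Λ : Ctx k) D →
              lift (lift (lift (diagᶜ Λ))) ⊙ diag D ≡ diagᶜ (Λ ▹ D)
  diag-step Λ D = lift³-∷ (diagᶜ Λ) _ _ _ wk

  IdOver-[] : ∀ {m k} (Λ : Ctx k) D t s (ρ : Sub m (triple k)) →
              IdOver Λ D [ t ∷ s ∷ ρ ] ≡
              Id (D [ src ⊙ ρ ]) s (transport Λ D [ t ∷ ρ ]ᵗ)
  IdOver-[] Λ D t s ρ =
    trans (Id-[] _ _ _ _)
      (cong₃ Id
        (trans (wk-∷ (D [ src ] [ wk ])) (trans (wk-∷ (D [ src ])) ([]-⊙ D _ _)))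
        (var-[] _ _)
        ([]ᵗ-≡ (transport Λ D)
          (trans (lift-∷ wk t (s ∷ ρ)) (cong (t ∷_) (wk-⊙ s ρ)))))

  tgt-wk : ∀ {m k} (D : Ty k) {s} {ρ : Sub m (triple k)} →
           D [ tgt ] [ wk ] [ s ∷ ρ ] ≡ D [ tgt ⊙ ρ ]
  tgt-wk D = trans (wk-∷ (D [ tgt ])) ([]-⊙ D _ _)

  P-∷ : ∀ {m k} {X : Ctx m} {Λ : Ctx k} {D q t s ρ} → X ⊢ ρ ∶∶ P Λ →
        X ⊢ s ∶ D [ src ⊙ ρ ] → X ⊢ t ∶ D [ tgt ⊙ ρ ] →
        X ⊢ q ∶ IdOver Λ D [ t ∷ s ∷ ρ ] → X ⊢ q ∷ t ∷ s ∷ ρ ∶∶ P (Λ ▹ D)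
  P-∷ {D = D} ρ s t q =
    q ∷ tm-≡ (sym (tgt-wk D)) t ∷ tm-≡ (sym ([]-⊙ D _ _)) s ∷ ρ

  P-≐∷ : ∀ {m k} {X : Ctx m} {Λ : Ctx k} {D q t s ρ q′ t′ s′ ρ′} →
         X ⊢ ρ ≐ ρ′ ∶∶ P Λ →
         X ⊢ s ≐ s′ ∶ D [ src ⊙ ρ ] → X ⊢ t ≐ t′ ∶ D [ tgt ⊙ ρ ] →
         X ⊢ q ≐ q′ ∶ IdOver Λ D [ t ∷ s ∷ ρ ] →
         X ⊢ q ∷ t ∷ s ∷ ρ ≐ q′ ∷ t′ ∷ s′ ∷ ρ′ ∶∶ P (Λ ▹ D)
  P-≐∷ {D = D} ρ s t q =
    q ∷ ≐tm-≡ (sym (tgt-wk D)) t ∷ ≐tm-≡ (sym ([]-⊙ D _ _)) s ∷ ρ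

  -- These rules are proved together, by induction on Λ: the next path type of `P` contains
  -- `transport`, which is well typed by elimination over the shorter context.
  record PathRules {k} (Λ : Ctx k) : Set where
    field
      base-ctxt : Λ ctxt
      P-ctxt   : P Λ ctxt
      src-rule : P Λ ⊢ src ∶∶ Λ
      tgt-rule : P Λ ⊢ tgt ∶∶ Λ
      diag-rule : Λ ⊢ diagᶜ Λ ∶∶ P Λ
      Jᶜ-elim : ∀ {l} {Θ : Tel (triple k) l} {C d} →
                P Λ ▸ Θ ⊢ C type →
                Λ ▸ Θ [ diagᶜ Λ ]* ⊢ d ∶ C [ lifts l (diagᶜ Λ) ] →
                P Λ ▸ Θ ⊢ Jᶜ Λ Θ C d ∶ C
      Jᶜ-comp : ∀ {l} {Θ : Tel (triple k) l} {C d} →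
                P Λ ▸ Θ ⊢ C type →
                Λ ▸ Θ [ diagᶜ Λ ]* ⊢ d ∶ C [ lifts l (diagᶜ Λ) ] →
                Λ ▸ Θ [ diagᶜ Λ ]* ⊢ Jᶜ Λ Θ C d [ lifts l (diagᶜ Λ) ]ᵗ ≐ d
                  ∶ C [ lifts l (diagᶜ Λ) ]

  module Transport {k} {Λ : Ctx k} {D} (R : PathRules Λ) (hD : Λ ⊢ D type) where
    open PathRules R

    δ = diagᶜ Λ

    D-src : P Λ ⊢ D [ src ] type
    D-src = type-sub hD src-rule

    D-tgt : P Λ ⊢ D [ tgt ] type
    D-tgt = type-sub hD tgt-rule

    D-tgt-wk : P Λ ▹ D [ src ] ⊢ D [ tgt ] [ wk ] type
    D-tgt-wk = wk-type D-src D-tgt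

    motive : P Λ ▹ D [ tgt ] ⊢ D [ src ] [ wk ] type
    motive = wk-type D-tgt D-src

    D-src-δ : ∀ {m} {a} {σ : Sub m k} → D [ src ] [ wk ] [ a ∷ δ ⊙ σ ] ≡ D [ σ ]
    D-src-δ = trans (wk-∷ (D [ src ])) ([]-≡ D (src-diag-⊙ Λ _))

    D-tgt-δ : D [ tgt ] [ δ ] ≡ D
    D-tgt-δ = trans ([]-≡ D (tgt-diag Λ)) ([]-id D)

    method : Λ ▹ D [ tgt ] [ δ ] ⊢ v₀ ∶ D [ src ] [ wk ] [ lift δ ]
    method =
      tm-≡ (trans (cong (_[ wk ]) D-tgt-δ) (sym D-src-δ))
           (v₀-rule (type-sub D-tgt diag-rule))

    transport-rule : P Λ ▹ D [ tgt ] ⊢ transport Λ D ∶ D [ src ] [ wk ]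
    transport-rule = Jᶜ-elim motive method

    transport-diag : ∀ {m} {X : Ctx m} {t σ} → X ⊢ σ ∶∶ Λ → X ⊢ t ∶ D [ σ ] →
                     X ⊢ transport Λ D [ t ∷ δ ⊙ σ ]ᵗ ≐ t ∶ D [ σ ]
    transport-diag {t = t} {σ} hσ ht =
      ≐tm-≡₃ ([]ᵗ-≡ (transport Λ D) (lift-∷ δ t σ)) (var-[] _ _)
        (trans ([]-≡ (D [ src ] [ wk ]) (lift-∷ δ t σ)) D-src-δ)
        (≐tm-sub (Jᶜ-comp motive method)
          (tm-≡ (cong (_[ σ ]) (sym D-tgt-δ)) ht ∷ hσ))

    IdOver-rule : P Λ ▹ D [ src ] ▹ D [ tgt ] [ wk ] ⊢ IdOver Λ D type
    IdOver-rule =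
      Id-form (var-rule (extend D-tgt-wk) (suc zero))
        (tm-≡ (trans ([]-≡ (D [ src ]) (wk-⊙ _ _)) (sym ([]-⊙ (D [ src ]) _ _)))
          (tm-sub transport-rule (lift-rule D-tgt (wk-rule D-src))))

    P▹-ctxt : P (Λ ▹ D) ctxt
    P▹-ctxt = extend IdOver-rule

    IdOver-diag : ∀ {m} {X : Ctx m} {t s σ} → X ⊢ σ ∶∶ Λ →
                  X ⊢ s ∶ D [ σ ] → X ⊢ t ∶ D [ σ ] →
                  X ⊢ Id (D [ σ ]) s t ≐ IdOver Λ D [ t ∷ s ∷ δ ⊙ σ ] type
    IdOver-diag {t = t} {s} {σ} hσ hs ht =
      ≐type-≡ refl (sym (IdOver-[] Λ D t s (δ ⊙ σ)))
        (Id-cong (≐type-reflexive (cong (D [_]) (sym (src-diag-⊙ Λ σ))) (type-sub hD hσ))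
                 (≐tm-refl hs) (≐tm-sym (transport-diag hσ ht)))

    src▹-rule : P (Λ ▹ D) ⊢ src ∶∶ Λ ▹ D
    src▹-rule =
      tm-≡ (trans ([]-≡ (D [ src ] [ wk ]) refl)
             (trans ([]-≡ (D [ src ]) refl) ([]-⊙ D _ _)))
           (var-rule P▹-ctxt (suc (suc zero)))
      ∷ sub-⊙ src-rule
          (sub-⊙ (wk-rule D-src)
            (sub-⊙ (wk-rule D-tgt-wk) (wk-rule IdOver-rule)))

    tgt▹-rule : P (Λ ▹ D) ⊢ tgt ∶∶ Λ ▹ D
    tgt▹-rule =
      tm-≡ (trans ([]-≡ (D [ tgt ] [ wk ]) refl)
             (trans ([]-≡ (D [ tgt ]) refl) ([]-⊙ D _ _)))
           (var-rule P▹-ctxt (suc zero))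
      ∷ sub-⊙ tgt-rule
          (sub-⊙ (wk-rule D-src)
            (sub-⊙ (wk-rule D-tgt-wk) (wk-rule IdOver-rule)))

    diag▹-rule : Λ ▹ D ⊢ diagᶜ (Λ ▹ D) ∶∶ P (Λ ▹ D)
    diag▹-rule =
      P-∷ (sub-⊙ diag-rule w)
        (tm-≡ (cong (D [_]) (sym (src-diag-⊙ Λ wk))) v)
        (tm-≡ (cong (D [_]) (sym (tgt-diag-⊙ Λ wk))) v)
        (tm-conv (r-intro v) (IdOver-diag w v v))
      where
      w = wk-rule hD
      v = v₀-rule hD

    path-ctxt : pathCtx Λ D ctxt
    path-ctxt = extend (Id-form (var-rule (extend (wk-type hD hD)) (suc zero))
                                (v₀-rule (wk-type hD hD)))

    -- On the diagonal transport is the identity, so that IdOver becomes Id.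
    path-≐ : pathCtx Λ D ≐
             Λ ▸ ((D [ src ] ∷ D [ tgt ] [ wk ] ∷ IdOver Λ D ∷ ε) [ δ ]*) ctxt
    path-≐ =
      ≐ctxt-refl base-ctxt
      ▹ ≐type-reflexive (sym (trans ([]-≡ D (src-diag Λ)) ([]-id D))) hD
      ▹ ≐type-reflexive (sym (trans (tgt-wk D) (cong (D [_]) (tgt-diag-⊙ Λ wk))))
                        (wk-type hD hD)
      ▹ ≐type-≡ (cong (λ A → Id A v₁ v₀) (sym ([]-⊙ D wk wk)))
                (cong (λ σ → IdOver Λ D [ v₀ ∷ σ ])
                  (cong₂ _∷_ (sym (var-[] zero wk)) (sym (⊙-assoc δ wk wk))))
          (IdOver-diag (sub-⊙ (wk-rule hD) (wk-rule (wk-type hD hD)))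
            (tm-≡ ([]-⊙ D wk wk) (var-rule (extend (wk-type hD hD)) (suc zero)))
            (tm-≡ ([]-⊙ D wk wk) (v₀-rule (wk-type hD hD))))

    diag-D-rule : Λ ▹ D ⊢ diag D ∶∶ pathCtx Λ D
    diag-D-rule =
      tm-≡ (sym (trans (Id-[] _ _ _ _)
             (cong₃ Id (trans (wk-∷ (D [ wk ])) (wk-∷ D))
                       (var-[] (suc zero) _) (var-[] zero _))))
           (r-intro v)
      ∷ tm-≡ (sym (wk-∷ D)) v ∷ v ∷ wk-rule hD
      where v = v₀-rule hD

    -- `J` lives over the identity context of the single type D, whereas elimination over Λ expects
    -- its method over Θ restricted to the diagonal. By `path-≐` these contexts are definitionally
    -- equal but not identical, so judgements are converted in both directions.
    module Method {l} {Δ : Tel (triple (suc k)) l} {C d}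
             (hC : P (Λ ▹ D) ▸ Δ ⊢ C type)
             (hd : (Λ ▹ D) ▸ Δ [ diagᶜ (Λ ▹ D) ]* ⊢ d ∶ C [ lifts l (diagᶜ (Λ ▹ D)) ])
             where
      δ³ = lift (lift (lift δ))

      Θ : Tel (triple k) (3 + l)
      Θ = D [ src ] ∷ D [ tgt ] [ wk ] ∷ IdOver Λ D ∷ Δ

      C[δ³]-type : Λ ▸ Θ [ δ ]* ⊢ C [ lifts l δ³ ] type
      C[δ³]-type = type-sub hC (lifts-rule Θ (type⇒ctxt hC) diag-rule)

      X-ctxt = type⇒ctxt C[δ³]-type
      pathX-ctxt = ▸-ctxt⇒ˡ (Δ [ δ³ ]*) X-ctxt

      X≐Y : (Λ ▸ Θ [ δ ]* ≐ pathCtx Λ D ▸ Δ [ δ³ ]* ctxt)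
            × (pathCtx Λ D ▸ Δ [ δ³ ]* ctxt)
      X≐Y = ▸-convert (Δ [ δ³ ]*) (≐ctxt-sym pathX-ctxt path-≐) path-ctxt X-ctxt

      Y≐X = ≐ctxt-sym (proj₂ X≐Y) (proj₁ X≐Y)

      hC′ : pathCtx Λ D ▸ Δ [ δ³ ]* ⊢ C [ lifts l δ³ ] type
      hC′ = type-convert (proj₁ X≐Y) (proj₂ X≐Y) C[δ³]-type

      Δ-eq : Δ [ δ³ ]* [ diag D ]* ≡ Δ [ diagᶜ (Λ ▹ D) ]*
      Δ-eq = []*-≡ Δ (diag-step Λ D)

      lifts-eq : lifts l δ³ ⊙ lifts l (diag D) ≡ lifts l (diagᶜ (Λ ▹ D))
      lifts-eq = trans (lifts-⊙ l δ³ (diag D)) (cong (lifts l) (diag-step Λ D))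

      C-eq : C [ lifts l δ³ ] [ lifts l (diag D) ] ≡ C [ lifts l (diagᶜ (Λ ▹ D)) ]
      C-eq = []-≡ C lifts-eq

      hd′ : (Λ ▹ D) ▸ Δ [ δ³ ]* [ diag D ]* ⊢ d ∶ C [ lifts l δ³ ] [ lifts l (diag D) ]
      hd′ = subst₂ (λ Ξ A → (Λ ▹ D) ▸ Ξ ⊢ d ∶ A) (sym Δ-eq) (sym C-eq) hd

      j : Tm (l ⊹ 3 + k)
      j = J D (Δ [ δ³ ]*) (C [ lifts l δ³ ]) d

      -- Elimination in D, with the base held on its diagonal, supplies the method for elimination
      -- in Λ.
      hj : Λ ▸ Θ [ δ ]* ⊢ j ∶ C [ lifts l δ³ ]
      hj = tm-convert Y≐X X-ctxt (J-elim hC′ hd′)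

      Jᶜ▹-elim : P (Λ ▹ D) ▸ Δ ⊢ Jᶜ (Λ ▹ D) Δ C d ∶ C
      Jᶜ▹-elim = Jᶜ-elim {Θ = Θ} hC hj

      Jᶜ▹-comp : (Λ ▹ D) ▸ Δ [ diagᶜ (Λ ▹ D) ]* ⊢
                 Jᶜ (Λ ▹ D) Δ C d [ lifts l (diagᶜ (Λ ▹ D)) ]ᵗ ≐ d
                   ∶ C [ lifts l (diagᶜ (Λ ▹ D)) ]
      Jᶜ▹-comp =
        subst₂ (λ Ξ A → (Λ ▹ D) ▸ Ξ ⊢ Jᶜ (Λ ▹ D) Δ C d [ lifts l (diagᶜ (Λ ▹ D)) ]ᵗ ≐ d ∶ A)
          Δ-eq C-eq
          -- Restricting along the whole diagonal is restricting along that of Λ and then along that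
          -- of D; the two computation rules apply in this order.
          (≐tm-trans
            (≐tm-≡₃ ([]ᵗ-≡ (Jᶜ (Λ ▹ D) Δ C d) lifts-eq) refl refl
              (≐tm-sub (≐tm-convert (proj₁ X≐Y) (proj₂ X≐Y) (Jᶜ-comp {Θ = Θ} hC hj))
                       (lifts-rule (Δ [ δ³ ]*) (proj₂ X≐Y) diag-D-rule)))
            (J-comp hC′ hd′))

  pathRules : ∀ {k} {Λ : Ctx k} → Λ ctxt → PathRules Λ
  pathRules ε = record
    { base-ctxt = ε ; P-ctxt = ε ; src-rule = [] ε ; tgt-rule = [] ε ; diag-rule = [] ε
    ; Jᶜ-elim = λ {l} {Θ} {C} {d} hC hd →
        subst₂ (λ Ξ A → ε ▸ Ξ ⊢ d ∶ A) ([]*-id Θ) (lifts-id-[] l C) hd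
    ; Jᶜ-comp = λ {l} {Θ} {C} {d} hC hd →
        ≐tm-≡₃ (sym (trans (cong (d [_]ᵗ) (lifts-id l)) ([]ᵗ-id d))) refl refl
               (≐tm-refl hd)
    }
  pathRules (w ▹ hD) = record
    { base-ctxt = w ▹ hD
    ; P-ctxt = P▹-ctxt ; src-rule = src▹-rule ; tgt-rule = tgt▹-rule
    ; diag-rule = diag▹-rule
    ; Jᶜ-elim = Method.Jᶜ▹-elim ; Jᶜ-comp = Method.Jᶜ▹-comp
    }
    where open Transport (pathRules w) hD

-- Invariance under definitional equality of contexts

module PathCongruence {S : TypeTheory} (I : IdentityTypes S) where
  open TypeTheory S
  open IdentityTypes I
  open ContextCategory S
  open IdentityContexts I
  open Substitution S
  open PathContexts I

  -- `P` contains instances of `J`, and `diagᶜ` instances of `r`, all of which mention the types of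
  -- Λ. Passing from equal contexts to equal path contexts thus needs the congruence rules, again by
  -- a simultaneous induction.
  record PathCong {k} (Λ Λ′ : Ctx k) : Set where
    field
      P-cong    : P Λ ≐ P Λ′ ctxt
      diag-cong : Λ ⊢ diagᶜ Λ ≐ diagᶜ Λ′ ∶∶ P Λ
      Jᶜ-cong   : ∀ {l} {Θ Θ′ : Tel (triple k) l} {C C′ d d′} →
                  P Λ ⊢ Θ ≐ Θ′ tel → P Λ ▸ Θ ⊢ C ≐ C′ type →
                  Λ ▸ Θ [ diagᶜ Λ ]* ⊢ d ≐ d′ ∶ C [ lifts l (diagᶜ Λ) ] →
                  P Λ ▸ Θ ⊢ Jᶜ Λ Θ C d ≐ Jᶜ Λ′ Θ′ C′ d′ ∶ C

  module CongStep {k} {Λ Λ′ : Ctx k} {D D′} (R : PathRules Λ) (K : PathCong Λ Λ′)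
                  (D≐ : Λ ⊢ D ≐ D′ type) where
    open PathRules R
    open PathCong K

    hD = ≐type⇒ˡ D≐

    open Transport R hD

    D-src≐ : P Λ ⊢ D [ src ] ≐ D′ [ src ] type
    D-src≐ = ≐type-sub D≐ src-rule

    D-tgt≐ : P Λ ⊢ D [ tgt ] ≐ D′ [ tgt ] type
    D-tgt≐ = ≐type-sub D≐ tgt-rule

    transport-cong : P Λ ▹ D [ tgt ] ⊢
                     transport Λ D ≐ transport Λ′ D′ ∶ D [ src ] [ wk ]
    transport-cong =
      Jᶜ-cong (D-tgt≐ ∷ ε) (≐type-sub D-src≐ (wk-rule D-tgt)) (≐tm-refl method)

    IdOver-cong : P Λ ▹ D [ src ] ▹ D [ tgt ] [ wk ] ⊢
                  IdOver Λ D ≐ IdOver Λ′ D′ type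
    IdOver-cong =
      Id-cong (≐type-sub (≐type-sub D-src≐ (wk-rule D-src)) (wk-rule D-tgt-wk))
              (≐tm-refl (var-rule (extend D-tgt-wk) (suc zero)))
              (≐tm-≡ (trans ([]-≡ (D [ src ]) (wk-⊙ _ _)) (sym ([]-⊙ (D [ src ]) _ _)))
                (≐tm-sub transport-cong (lift-rule D-tgt (wk-rule D-src))))

    P▹-cong : P (Λ ▹ D) ≐ P (Λ′ ▹ D′) ctxt
    P▹-cong = P-cong ▹ D-src≐ ▹ ≐type-sub D-tgt≐ (wk-rule D-src) ▹ IdOver-cong

    diag▹-cong : Λ ▹ D ⊢ diagᶜ (Λ ▹ D) ≐ diagᶜ (Λ′ ▹ D′) ∶∶ P (Λ ▹ D)
    diag▹-cong =
      P-≐∷ (≐sub-⊙ diag-cong w)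
        (≐tm-refl (tm-≡ (cong (D [_]) (sym (src-diag-⊙ Λ wk))) v))
        (≐tm-refl (tm-≡ (cong (D [_]) (sym (tgt-diag-⊙ Λ wk))) v))
        (≐tm-conv (r-cong (≐type-sub D≐ w) (≐tm-refl v)) (IdOver-diag w v v))
      where
      w = wk-rule hD
      v = v₀-rule hD

    Jᶜ▹-cong : ∀ {l} {Δ Δ′ : Tel (triple (suc k)) l} {C C′ d d′} →
               P (Λ ▹ D) ⊢ Δ ≐ Δ′ tel → P (Λ ▹ D) ▸ Δ ⊢ C ≐ C′ type →
               (Λ ▹ D) ▸ Δ [ diagᶜ (Λ ▹ D) ]* ⊢ d ≐ d′ ∶ C [ lifts l (diagᶜ (Λ ▹ D)) ] →
               P (Λ ▹ D) ▸ Δ ⊢ Jᶜ (Λ ▹ D) Δ C d ≐ Jᶜ (Λ′ ▹ D′) Δ′ C′ d′ ∶ C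
    Jᶜ▹-cong {l} {Δ} {Δ′} {C} {C′} {d} {d′} Δ≐ C≐ d≐ =
      Jᶜ-cong (D-src≐ ∷ ≐type-sub D-tgt≐ (wk-rule D-src) ∷ IdOver-cong ∷ Δ≐) C≐
        (≐tm-convert Y≐X X-ctxt
          -- Telescope, motive and diagonal change at once: Δ and Δ′ are restricted along two
          -- different, definitionally equal substitutions.
          (J-cong D≐ (tel-cong Δ≐ δ³-cong) C[δ³]≐ d≐′))
      where
      open Method {l} {Δ} (≐type⇒ˡ C≐) (≐tm⇒ˡ d≐)
      δ³-cong : pathCtx Λ D ⊢ lift (lift (lift (diagᶜ Λ))) ≐ lift (lift (lift (diagᶜ Λ′)))
                  ∶∶ P (Λ ▹ D)
      δ³-cong = ≐dom-convert (≐ctxt-sym pathX-ctxt path-≐) path-ctxt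
        (lift-cong IdOver-rule (lift-cong D-tgt-wk (lift-cong D-src diag-cong)))
      C[δ³]≐ : pathCtx Λ D ▸ Δ [ lift (lift (lift (diagᶜ Λ))) ]* ⊢
               C [ lifts l (lift (lift (lift (diagᶜ Λ)))) ] ≐
               C′ [ lifts l (lift (lift (lift (diagᶜ Λ′)))) ] type
      C[δ³]≐ = type-cong₂ C≐ (lifts-cong Δ (type⇒ctxt (≐type⇒ˡ C≐)) δ³-cong)
      d≐′ : (Λ ▹ D) ▸ Δ [ lift (lift (lift (diagᶜ Λ))) ]* [ diag D ]* ⊢ d ≐ d′
              ∶ C [ lifts l (lift (lift (lift (diagᶜ Λ)))) ] [ lifts l (diag D) ]
      d≐′ = subst₂ (λ Ξ A → (Λ ▹ D) ▸ Ξ ⊢ d ≐ d′ ∶ A) (sym Δ-eq) (sym C-eq) d≐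

  pathCong : ∀ {k} {Λ Λ′ : Ctx k} → Λ ctxt → Λ ≐ Λ′ ctxt → PathCong Λ Λ′
  pathCong ε ε = record
    { P-cong = ε
    ; diag-cong = [] ε
    ; Jᶜ-cong = λ {l} {Θ} {C = C} _ _ d≐ →
        subst₂ (λ Ξ A → ε ▸ Ξ ⊢ _ ≐ _ ∶ A) ([]*-id Θ) (lifts-id-[] l C) d≐
    }
  pathCong (w ▹ _) (p ▹ D≐) = record
    { P-cong = P▹-cong ; diag-cong = diag▹-cong ; Jᶜ-cong = Jᶜ▹-cong }
    where open CongStep (pathRules w) (pathCong w p) D≐

  P-≐ : ∀ {k} {Λ Λ′ : Ctx k} → Λ ctxt → Λ ≐ Λ′ ctxt → P Λ ≐ P Λ′ ctxt
  P-≐ w p = PathCong.P-cong (pathCong w p)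

  diagᶜ-≐ : ∀ {k} {Λ Λ′ : Ctx k} → Λ ctxt → Λ ≐ Λ′ ctxt →
            Λ ⊢ diagᶜ Λ ≐ diagᶜ Λ′ ∶∶ P Λ
  diagᶜ-≐ w p = PathCong.diag-cong (pathCong w p)

-- Existence and uniqueness of extensions along anodyne maps

module AnodyneMaps {S : TypeTheory} (I : IdentityTypes S) where
  open TypeTheory S
  open IdentityTypes I
  open ContextCategory S
  open IdentityContexts I
  open Substitution S
  open PathContexts I

  -- The extension property that J gives to the diagonals.
  record Anodyne {m n} (X : Ctx m) (Y : Ctx n) (i : Sub m n) : Set where
    field
      rule : X ⊢ i ∶∶ Y
      fill : ∀ {l} {Θ : Tel n l} {C d} → Y ▸ Θ ⊢ C type →
             X ▸ Θ [ i ]* ⊢ d ∶ C [ lifts l i ] →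
             ∃[ j ] (Y ▸ Θ ⊢ j ∶ C) ×
                    (X ▸ Θ [ i ]* ⊢ j [ lifts l i ]ᵗ ≐ d ∶ C [ lifts l i ])

  open Anodyne

  diag-anodyne : ∀ {k} {Λ : Ctx k} → Λ ctxt → Anodyne Λ (P Λ) (diagᶜ Λ)
  diag-anodyne w = record
    { rule = diag-rule
    ; fill = λ {_} {Θ} hC hd → _ , Jᶜ-elim {Θ = Θ} hC hd , Jᶜ-comp {Θ = Θ} hC hd }
    where open PathRules (pathRules w)

  -- A post-context Θ over Y ▹ A is the post-context A ∷ Θ over Y. Quantifying over post-contexts
  -- thus makes anodyne maps stable under base change along context extensions.
  lift-anodyne : ∀ {m n} {X : Ctx m} {Y : Ctx n} {i A} → Y ⊢ A type →
                 Anodyne X Y i → Anodyne (X ▹ A [ i ]) (Y ▹ A) (lift i)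
  lift-anodyne {A = A} hA a = record
    { rule = lift-rule hA (rule a)
    ; fill = λ {_} {Θ} → fill a {Θ = A ∷ Θ} }

  ≐head : ∀ {m n} {Γ : Ctx m} {Δ : Ctx n} {A a b σ τ} →
          Γ ⊢ a ∷ σ ≐ b ∷ τ ∶∶ Δ ▹ A → Γ ⊢ a ≐ b ∶ A [ σ ]
  ≐head (a ∷ _) = a

  ≐tail : ∀ {m n} {Γ : Ctx m} {Δ : Ctx n} {A a b σ τ} →
          Γ ⊢ a ∷ σ ≐ b ∷ τ ∶∶ Δ ▹ A → Γ ⊢ σ ≐ τ ∶∶ Δ
  ≐tail (_ ∷ σ) = σ

  ends-≐ : ∀ {m k} {X : Ctx m} {Λ : Ctx k} (D : Ty k) {t s ρ t′ s′ ρ′} →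
           X ⊢ ρ ≐ ρ′ ∶∶ P Λ →
           X ⊢ s ≐ s′ ∶ D [ src ⊙ ρ ] → X ⊢ t ≐ t′ ∶ D [ tgt ⊙ ρ ] →
           X ⊢ t ∷ s ∷ ρ ≐ t′ ∷ s′ ∷ ρ′ ∶∶ P Λ ▹ D [ src ] ▹ D [ tgt ] [ wk ]
  ends-≐ D ρ s t =
    ≐tm-≡ (sym (tgt-wk D)) t ∷ ≐tm-≡ (sym ([]-⊙ D _ _)) s ∷ ρ

  -- The end components are copied from f and g, so the ends of the extension are right on the nose.
  -- Only the path components come from the extension property, one identity type at a time, and
  -- they restrict to those of d up to definitional equality.
  fillP : ∀ {m n k} {X : Ctx m} {Y : Ctx n} {i} {Δ : Ctx k} {f g d} →
          Anodyne X Y i → Δ ctxt → Y ⊢ f ∶∶ Δ → Y ⊢ g ∶∶ Δ → X ⊢ d ∶∶ P Δ →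
          X ⊢ src ⊙ d ≐ f ⊙ i ∶∶ Δ → X ⊢ tgt ⊙ d ≐ g ⊙ i ∶∶ Δ →
          ∃[ h ] (Y ⊢ h ∶∶ P Δ) × (src ⊙ h ≡ f) × (tgt ⊙ h ≡ g) ×
                 (X ⊢ h ⊙ i ≐ d ∶∶ P Δ)
  fillP {d = []} a ε ([] w) ([] _) ([] v) _ _ =
    [] , [] w , refl , refl , [] v
  fillP {i = i} {Δ = Λ ▹ D} {d = q ∷ t₀ ∷ s₀ ∷ d} a (w ▹ hD)
        (_∷_ {a = s} hs hf) (_∷_ {a = t} ht hg) (hq ∷ _ ∷ _ ∷ hd) es et
    with fillP a w hf hg hd (≐tail es′) (≐tail et′)
    where
    es′ = ≐sub-≡ (src-∷ q t₀ s₀ d) refl es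
    et′ = ≐sub-≡ (tgt-∷ q t₀ s₀ d) refl et
  ... | h , hh , refl , refl , hi =
    j ∷ t ∷ s ∷ h , P-∷ hh hs ht hj , src-∷ j t s h , tgt-∷ j t s h ,
    ≐sub-sym P▹-ctxt
      (P-≐∷ (≐sub-sym P-ctxt hi) s₀≐ t₀≐
        (≐tm-sym (≐tm-conv (≐tm-≡ ([]-⊙ (IdOver Λ D) _ _) ej) (≐type-sym IdOver≐))))
    where
    open Transport (pathRules w) hD
    open PathRules (pathRules w) using (P-ctxt)
    s₀≐ = ≐head (≐sub-≡ (src-∷ q t₀ s₀ d) refl es)
    t₀≐ = ≐head (≐sub-≡ (tgt-∷ q t₀ s₀ d) refl et)
    -- The path component q lies over the ends of d. On X these equal the restricted ends of f and
    -- g, so q can be converted before it is extended.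
    IdOver≐ = type-cong IdOver-rule (ends-≐ D (≐sub-sym P-ctxt hi) s₀≐ t₀≐)
    filler = fill a {Θ = ε}
      (type-sub IdOver-rule
        (tm-≡ (sym (tgt-wk D)) ht ∷ tm-≡ (sym ([]-⊙ D _ _)) hs ∷ hh))
      (tm-conv hq (≐type-≡ refl (sym ([]-⊙ (IdOver Λ D) _ _)) IdOver≐))
    j = proj₁ filler
    hj = proj₁ (proj₂ filler)
    ej = proj₂ (proj₂ filler)

  module _ (disc : DiscreteIdentityTypes I) where
    open DiscreteIdentityTypes disc

    -- Extend r(p) : p[i] = q[i] along i and apply reflection.
    uniqueId : ∀ {m n} {X : Ctx m} {Y : Ctx n} {i A a b p q} →
               Anodyne X Y i → Y ⊢ p ∶ Id A a b → Y ⊢ q ∶ Id A a b →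
               X ⊢ p [ i ]ᵗ ≐ q [ i ]ᵗ ∶ Id A a b [ i ] → Y ⊢ p ≐ q ∶ Id A a b
    uniqueId {i = i} {A} {a} {b} {p} {q} an hp hq e
      with fill an {Θ = ε} (Id-form hp hq)
             (tm-≡ (sym (Id-[] _ _ _ _))
               (tm-conv (r-intro (≐tm⇒ˡ e))
                 (Id-cong (≐type-refl (tm⇒type (≐tm⇒ˡ e))) (≐tm-refl (≐tm⇒ˡ e)) e)))
    ... | α , hα , _ = reflection hp hq hα

    -- Discreteness says nothing about the end components, whose equality is therefore assumed.
    -- Given it, the types of the two path components coincide definitionally, layer by layer, and
    -- each layer is an instance of `uniqueId`.
    uniqueP : ∀ {m n k} {X : Ctx m} {Y : Ctx n} {i} {Δ : Ctx k} {ρ ρ′} →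
              Anodyne X Y i → Δ ctxt → Y ⊢ ρ ∶∶ P Δ → Y ⊢ ρ′ ∶∶ P Δ →
              Y ⊢ src ⊙ ρ ≐ src ⊙ ρ′ ∶∶ Δ → Y ⊢ tgt ⊙ ρ ≐ tgt ⊙ ρ′ ∶∶ Δ →
              X ⊢ ρ ⊙ i ≐ ρ′ ⊙ i ∶∶ P Δ → Y ⊢ ρ ≐ ρ′ ∶∶ P Δ
    uniqueP a ε ([] w) ([] _) _ _ _ = [] w
    uniqueP {Δ = Λ ▹ D} {q ∷ t ∷ s ∷ ρ} {q′ ∷ t′ ∷ s′ ∷ ρ′} a (w ▹ hD)
            (hq ∷ _ ∷ _ ∷ hρ) (hq′ ∷ _ ∷ _ ∷ hρ′) es et (eq ∷ _ ∷ _ ∷ eρ) =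
      -- Substituting the ends turns `IdOver` into a literal `Id`, the form that `uniqueId` asks
      -- for.
      P-≐∷ ρ≐ s≐ t≐ (≐tm-≡ (sym IdOver≡)
        (uniqueId a (tm-≡ IdOver≡ hq)
          (tm-≡ IdOver≡ (tm-conv hq′ (≐type-sym (type-cong IdOver-rule (ends-≐ D ρ≐ s≐ t≐)))))
          (≐tm-≡ (trans (sym ([]-⊙ (IdOver Λ D) _ _)) (cong (_[ _ ]) IdOver≡)) eq)))
      where
      open Transport (pathRules w) hD
      es′ = ≐sub-≡ (src-∷ q t s ρ) (src-∷ q′ t′ s′ ρ′) es
      et′ = ≐sub-≡ (tgt-∷ q t s ρ) (tgt-∷ q′ t′ s′ ρ′) et
      ρ≐ = uniqueP a w hρ hρ′ (≐tail es′) (≐tail et′) eρ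
      s≐ = ≐head es′
      t≐ = ≐head et′
      IdOver≡ = IdOver-[] Λ D t s ρ

-- Pullbacks of the source projection

module PathPullback {S : TypeTheory} (I : IdentityTypes S) where
  open TypeTheory S
  open IdentityTypes I
  open ContextCategory S
  open IdentityContexts I
  open Substitution S
  open PathContexts I
  open AnodyneMaps I

  -- W ×_Λ P Λ, the pullback of src along y : W → Λ: only the variables x′ₖ
  -- and pₖ of P Λ are adjoined to W.
  pullSize : ℕ → ℕ → ℕ
  pullSize zero    n = n
  pullSize (suc k) n = 2 + pullSize k n

  π₁ : ∀ {n} k → Sub (pullSize k n) n
  π₁ zero    = idˢ
  π₁ (suc k) = π₁ k ⊙ wk ⊙ wk

  -- The source components missing from the pullback are filled in from y, which makes the pullback
  -- square commute strictly.
  π₂ : ∀ {k n} → Sub n k → Sub (pullSize k n) (triple k)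
  π₂ []                = []
  π₂ {suc k} (y ∷ ys) = v₀ ∷ v₁ ∷ y [ π₁ (suc k) ]ᵗ ∷ π₂ ys ⊙ wk ⊙ wk

  -- Contexts need not have pullbacks. This one exists because, after exchange, P Λ extends Λ by the
  -- types of the targets and paths, and a context extension can be pulled back by substitution.
  Pull : ∀ {n k} → Ctx n → Ctx k → Sub n k → Ctx (pullSize k n)
  Pull             W ε       []       = W
  Pull {k = suc k} W (Λ ▹ D) (y ∷ ys) =
    Pull W Λ ys ▹ D [ tgt ⊙ π₂ ys ]
      ▹ IdOver Λ D [ v₀ ∷ y [ π₁ k ⊙ wk ]ᵗ ∷ π₂ ys ⊙ wk ]

  src-π₂ : ∀ {k n} (y : Sub n k) → src ⊙ π₂ y ≡ y ⊙ π₁ k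
  src-π₂ []       = refl
  src-π₂ {suc k} (y ∷ ys) =
    trans (src-∷ _ _ _ _)
      (cong (_ ∷_)
        (trans (sym (⊙-assoc src (π₂ ys) (wk ⊙ wk)))
          (trans (cong (_⊙ (wk ⊙ wk)) (src-π₂ ys)) (⊙-assoc ys (π₁ k) (wk ⊙ wk)))))

  record PullRules {n k} (W : Ctx n) (Λ : Ctx k) (y : Sub n k) : Set where
    field
      Pull-ctxt : Pull W Λ y ctxt
      π₁-rule   : Pull W Λ y ⊢ π₁ k ∶∶ W
      π₂-rule   : Pull W Λ y ⊢ π₂ y ∶∶ P Λ

  module PullStep {n k} {W : Ctx n} {Λ : Ctx k} {D y ys} (w : Λ ctxt)
                  (hD : Λ ⊢ D type) (hy : W ⊢ y ∶ D [ ys ]) (hys : W ⊢ ys ∶∶ Λ)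
                  (R : PullRules W Λ ys) where
    open PathRules (pathRules w)
    open Transport (pathRules w) hD
    open PullRules R

    end-type : Pull W Λ ys ⊢ D [ tgt ⊙ π₂ ys ] type
    end-type = type-sub hD (sub-⊙ tgt-rule π₂-rule)

    ends-rule : Pull W Λ ys ▹ D [ tgt ⊙ π₂ ys ] ⊢
                v₀ ∷ y [ π₁ k ⊙ wk ]ᵗ ∷ π₂ ys ⊙ wk
                  ∶∶ P Λ ▹ D [ src ] ▹ D [ tgt ] [ wk ]
    ends-rule =
      tm-≡ (trans ([]-≡ D (⊙-assoc tgt (π₂ ys) wk)) (sym (tgt-wk D)))
           (v₀-rule end-type)
      ∷ tm-≡ (trans ([]-≡ D start) (sym ([]-⊙ D _ _)))
             (tm-sub hy (sub-⊙ π₁-rule (wk-rule end-type)))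
      ∷ sub-⊙ π₂-rule (wk-rule end-type)
      where
      start : ys ⊙ π₁ k ⊙ wk ≡ src ⊙ π₂ ys ⊙ wk
      start = trans (sym (⊙-assoc ys (π₁ k) wk))
                (trans (cong (_⊙ wk) (sym (src-π₂ ys))) (⊙-assoc src (π₂ ys) wk))

    path-type : Pull W Λ ys ▹ D [ tgt ⊙ π₂ ys ] ⊢
                IdOver Λ D [ v₀ ∷ y [ π₁ k ⊙ wk ]ᵗ ∷ π₂ ys ⊙ wk ] type
    path-type = type-sub IdOver-rule ends-rule

    ends-wk : (v₀ ∷ y [ π₁ k ⊙ wk ]ᵗ ∷ π₂ ys ⊙ wk) ⊙ wk ≡
              v₁ ∷ y [ π₁ (suc k) ]ᵗ ∷ π₂ ys ⊙ wk ⊙ wk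
    ends-wk = cong₂ _∷_ (var-[] zero wk)
      (cong₂ _∷_ ([]ᵗ-≡ y (⊙-assoc (π₁ k) wk wk)) (⊙-assoc (π₂ ys) wk wk))

    pullRules▹ : PullRules W (Λ ▹ D) (y ∷ ys)
    pullRules▹ = record
      { Pull-ctxt = extend path-type
      ; π₁-rule = sub-⊙ π₁-rule (sub-⊙ (wk-rule end-type) (wk-rule path-type))
      ; π₂-rule =
          tm-≡ ([]-≡ (IdOver Λ D) ends-wk) (v₀-rule path-type)
          ∷ sub-≡ ends-wk (sub-⊙ ends-rule (wk-rule path-type))
      }

  pullRules : ∀ {n k} {W : Ctx n} {Λ : Ctx k} {y} → Λ ctxt → W ⊢ y ∶∶ Λ →
              PullRules W Λ y
  pullRules ε ([] w) = record
    { Pull-ctxt = w ; π₁-rule = sub-id w ; π₂-rule = [] w }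
  pullRules (w ▹ hD) (hy ∷ hys) = PullStep.pullRules▹ w hD hy hys (pullRules w hys)

  pair : ∀ {x n} k → Sub x n → Sub x (triple k) → Sub x (pullSize k n)
  pair zero    σ ρ               = σ
  pair (suc k) σ (q ∷ t ∷ s ∷ ρ) = q ∷ t ∷ pair k σ ρ

  ⊙wk²-∷ : ∀ {l m n} (σ : Sub m n) a b (τ : Sub l m) →
           (σ ⊙ wk ⊙ wk) ⊙ (a ∷ b ∷ τ) ≡ σ ⊙ τ
  ⊙wk²-∷ σ a b τ = trans (⊙-assoc σ (wk ⊙ wk) _) (cong (σ ⊙_) (wk²-⊙ a b τ))

  π₁-pair : ∀ {x n} k (σ : Sub x n) (ρ : Sub x (triple k)) → π₁ k ⊙ pair k σ ρ ≡ σ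
  π₁-pair zero    σ ρ               = idˢ-⊙ σ
  π₁-pair (suc k) σ (q ∷ t ∷ s ∷ ρ) =
    trans (⊙wk²-∷ (π₁ k) q t _) (π₁-pair k σ ρ)

  π₂-∷ : ∀ {x n k} (y : Tm n) (ys : Sub n k) q t (u : Sub x (pullSize k n)) →
         π₂ (y ∷ ys) ⊙ (q ∷ t ∷ u) ≡ q ∷ t ∷ y [ π₁ k ⊙ u ]ᵗ ∷ π₂ ys ⊙ u
  π₂-∷ {k = k} y ys q t u =
    cong₂ _∷_ (var-[] _ _) (cong₂ _∷_ (var-[] _ _)
      (cong₂ _∷_ ([]ᵗ-≡ y (⊙wk²-∷ (π₁ k) q t u)) (⊙wk²-∷ (π₂ ys) q t u)))

  -- `pair` discards the source components of ρ, so the types of the others must be rewritten with y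
  -- ⊙ σ in their place. Typing at each stage uses the recovery of ρ at the previous one, hence a
  -- single induction for both.
  pair-rules : ∀ {x n k} {X : Ctx x} {W : Ctx n} {Λ : Ctx k} {y σ ρ} →
               Λ ctxt → W ⊢ y ∶∶ Λ → X ⊢ σ ∶∶ W → X ⊢ ρ ∶∶ P Λ →
               X ⊢ src ⊙ ρ ≐ y ⊙ σ ∶∶ Λ →
               (X ⊢ pair k σ ρ ∶∶ Pull W Λ y) ×
               (X ⊢ ρ ≐ π₂ y ⊙ pair k σ ρ ∶∶ P Λ)
  pair-rules {ρ = []} ε ([] _) hσ ([] w) e = hσ , [] w
  pair-rules {k = suc k} {X} {W} {Λ ▹ D} {y ∷ ys} {σ} {q ∷ t ∷ s ∷ ρ} (w ▹ hD)
             (hy ∷ hys) hσ (hq ∷ ht ∷ hs ∷ hρ) e =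
    (tm-conv hq (≐type-≡ refl (sym ([]-≡ (IdOver Λ D) ends-eq)) (type-cong IdOver-rule ends))
     ∷ ht′ ∷ hpair)
    , ≐sub-≡ refl
        (sym (trans (π₂-∷ y ys q t _)
          (cong (λ τ → q ∷ t ∷ y [ τ ]ᵗ ∷ π₂ ys ⊙ pair k σ ρ) (π₁-pair k σ ρ))))
        (P-≐∷ ρ≐ (≐head e′) (≐tm-refl (tm-≡ (tgt-wk D) ht)) (≐tm-refl hq))
    where
    open PathRules (pathRules w)
    open Transport (pathRules w) hD
    e′ = ≐sub-≡ (src-∷ q t s ρ) refl e
    rec = pair-rules w hys hσ hρ (≐tail e′)
    hpair = proj₁ rec
    ρ≐ = proj₂ rec
    ht′ : X ⊢ t ∶ D [ tgt ⊙ π₂ ys ] [ pair k σ ρ ]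
    ht′ = tm-conv (tm-≡ (tgt-wk D) ht)
            (≐type-≡ refl (sym ([]-≡ D (⊙-assoc tgt (π₂ ys) _)))
              (type-cong hD (sub-≐⊙ tgt-rule ρ≐)))
    ends : X ⊢ t ∷ s ∷ ρ ≐ t ∷ y [ σ ]ᵗ ∷ π₂ ys ⊙ pair k σ ρ
             ∶∶ P Λ ▹ D [ src ] ▹ D [ tgt ] [ wk ]
    ends = ends-≐ D ρ≐ (≐head e′) (≐tm-refl (tm-≡ (tgt-wk D) ht))
    ends-eq : (v₀ ∷ y [ π₁ k ⊙ wk ]ᵗ ∷ π₂ ys ⊙ wk) ⊙ (t ∷ pair k σ ρ) ≡
              t ∷ y [ σ ]ᵗ ∷ π₂ ys ⊙ pair k σ ρ
    ends-eq = cong₂ _∷_ (var-[] _ _)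
      (cong₂ _∷_
        ([]ᵗ-≡ y (trans (⊙-assoc (π₁ k) wk _)
          (trans (cong (π₁ k ⊙_) (wk-⊙ t _)) (π₁-pair k σ ρ))))
        (trans (⊙-assoc (π₂ ys) wk _) (cong (π₂ ys ⊙_) (wk-⊙ t _))))

  Pull-ext : ∀ {x n k} {X : Ctx x} {W : Ctx n} {Λ : Ctx k} {y u v} →
             W ⊢ y ∶∶ Λ → X ⊢ π₁ k ⊙ u ≐ π₁ k ⊙ v ∶∶ W →
             X ⊢ π₂ y ⊙ u ≐ π₂ y ⊙ v ∶∶ P Λ → X ⊢ u ≐ v ∶∶ Pull W Λ y
  Pull-ext ([] _) e _ = ≐sub-≡ (idˢ-⊙ _) (idˢ-⊙ _) e
  Pull-ext {k = suc k} {Λ = Λ ▹ D} {y ∷ ys} {q ∷ t ∷ u} {q′ ∷ t′ ∷ v} (_ ∷ hys) e₁ e₂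
    with ≐sub-≡ (π₂-∷ y ys q t u) (π₂-∷ y ys q′ t′ v) e₂
  ... | q≐ ∷ t≐ ∷ _ ∷ u≐ =
    ≐tm-≡ (sym ([]-≡ (IdOver Λ D) (cong₂ _∷_ (var-[] _ _)
            (cong₂ _∷_ ([]ᵗ-≡ y (trans (⊙-assoc (π₁ k) wk _) (cong (π₁ k ⊙_) (wk-⊙ t u))))
              (trans (⊙-assoc (π₂ ys) wk _) (cong (π₂ ys ⊙_) (wk-⊙ t u)))))))
          q≐
    ∷ ≐tm-≡ (trans (tgt-wk D) (sym ([]-≡ D (⊙-assoc tgt (π₂ ys) u)))) t≐
    ∷ Pull-ext hys (≐sub-≡ (⊙wk²-∷ (π₁ k) q t u) (⊙wk²-∷ (π₁ k) q′ t′ v) e₁) u≐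

  pullMap : ∀ {m n} k → Sub m n → Sub (pullSize k m) (pullSize k n)
  pullMap zero    i = i
  pullMap (suc k) i = lift (lift (pullMap k i))

  ⊙wk²-lift² : ∀ {l m n} (σ : Sub m n) (τ : Sub l m) →
               (σ ⊙ wk ⊙ wk) ⊙ lift (lift τ) ≡ (σ ⊙ τ) ⊙ wk ⊙ wk
  ⊙wk²-lift² σ τ =
    trans (⊙wk²-∷ σ _ _ _)
      (trans (cong (σ ⊙_) (⊙-assoc τ wk wk)) (sym (⊙-assoc σ τ (wk ⊙ wk))))

  π₁-pullMap : ∀ {m n} k (i : Sub m n) → π₁ k ⊙ pullMap k i ≡ i ⊙ π₁ k
  π₁-pullMap zero    i = trans (idˢ-⊙ i) (sym (⊙-idˢ i))
  π₁-pullMap (suc k) i =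
    trans (⊙wk²-lift² (π₁ k) (pullMap k i))
      (trans (cong (_⊙ (wk ⊙ wk)) (π₁-pullMap k i)) (⊙-assoc i (π₁ k) (wk ⊙ wk)))

  π₂-pullMap : ∀ {m n k} (y : Sub n k) (i : Sub m n) →
               π₂ y ⊙ pullMap k i ≡ π₂ (y ⊙ i)
  π₂-pullMap [] i = refl
  π₂-pullMap {k = suc k} (y ∷ ys) i =
    cong₂ _∷_ (var-[] _ _) (cong₂ _∷_ (trans (var-[] _ _) (var-[] zero wk))
      (cong₂ _∷_
        (trans ([]ᵗ-≡ y (π₁-pullMap (suc k) i)) (sym ([]ᵗ-⊙ y i (π₁ (suc k)))))
        (trans (⊙wk²-lift² (π₂ ys) (pullMap k i))
               (cong (_⊙ (wk ⊙ wk)) (π₂-pullMap ys i)))))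

  Anodyne-≡ : ∀ {m n} {X X′ : Ctx m} {Y : Ctx n} {i} → X ≡ X′ →
              Anodyne X Y i → Anodyne X′ Y i
  Anodyne-≡ refl a = a

  -- Each type of Λ adds an end and a path to both pullbacks, and `pullMap` is i lifted over them,
  -- so `lift-anodyne` is applied twice per type. The resulting domain agrees with
  -- `Pull X Λ (y ⊙ i)` only propositionally, whence `Anodyne-≡`.
  pullMap-anodyne : ∀ {m n k} {X : Ctx m} {W : Ctx n} {Λ : Ctx k} {y i} → Λ ctxt →
                    W ⊢ y ∶∶ Λ → Anodyne X W i →
                    Anodyne (Pull X Λ (y ⊙ i)) (Pull W Λ y) (pullMap k i)
  pullMap-anodyne ε ([] _) a = a
  pullMap-anodyne {k = suc k} {X} {W} {Λ ▹ D} {y ∷ ys} {i} (w ▹ hD) (hy ∷ hys) a =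
    Anodyne-≡
      (cong₂-▹ (cong (Pull X Λ (ys ⊙ i) ▹_)
                 ([]-≡ D (trans (⊙-assoc tgt (π₂ ys) _) (cong (tgt ⊙_) (π₂-pullMap ys i)))))
               ([]-≡ (IdOver Λ D)
                 (cong₂ _∷_ (var-[] _ _)
                   (cong₂ _∷_
                     (trans ([]ᵗ-≡ y (wk-lift (π₁ k) (i ⊙ π₁ k) (π₁-pullMap k i)))
                       (trans (cong (y [_]ᵗ) (⊙-assoc i (π₁ k) wk))
                              (sym ([]ᵗ-⊙ y i (π₁ k ⊙ wk)))))
                     (wk-lift (π₂ ys) (π₂ (ys ⊙ i)) (π₂-pullMap ys i))))))
      (lift-anodyne (PullStep.path-type w hD hy hys R)
        (lift-anodyne (PullStep.end-type w hD hy hys R)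
          (pullMap-anodyne w hys a)))
    where
    R = pullRules w hys
    cong₂-▹ : ∀ {n} {Γ Γ′ : Ctx n} {A A′} → Γ ≡ Γ′ → A ≡ A′ → Γ ▹ A ≡ Γ′ ▹ A′
    cong₂-▹ refl refl = refl
    wk-lift : ∀ {j} (σ : Sub _ j) (τ : Sub _ j) → σ ⊙ pullMap k i ≡ τ →
              (σ ⊙ wk) ⊙ lift (pullMap k i) ≡ τ ⊙ wk
    wk-lift σ τ e =
      trans (⊙-assoc σ wk _)
        (trans (cong (σ ⊙_) (wk-⊙ _ _))
          (trans (sym (⊙-assoc σ _ wk)) (cong (_⊙ wk) e)))

-- Two-cells as morphisms into path contexts

module CellPaths {S : TypeTheory} (I : IdentityTypes S) where
  open TypeTheory S
  open IdentityTypes I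
  open ContextCategory S
  open IdentityContexts I
  open Substitution S
  open PathContexts I
  open import Function using (_∘_)

  mid : ∀ {m} k → Sub m (triple k) → Sub m k
  mid zero    []              = []
  mid (suc k) (q ∷ t ∷ s ∷ ρ) = q ∷ mid k ρ

  src-⟨⟩ : ∀ {m k} (f g p : Sub m k) → src ⊙ ⟨ f , g , p ⟩ ≡ f
  src-⟨⟩ []      []      []      = refl
  src-⟨⟩ (s ∷ f) (t ∷ g) (q ∷ p) = trans (src-∷ q t s _) (cong (s ∷_) (src-⟨⟩ f g p))

  tgt-⟨⟩ : ∀ {m k} (f g p : Sub m k) → tgt ⊙ ⟨ f , g , p ⟩ ≡ g
  tgt-⟨⟩ []      []      []      = refl
  tgt-⟨⟩ (s ∷ f) (t ∷ g) (q ∷ p) = trans (tgt-∷ q t s _) (cong (t ∷_) (tgt-⟨⟩ f g p))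

  ⟨⟩-η : ∀ {m} k (ρ : Sub m (triple k)) → ⟨ src ⊙ ρ , tgt ⊙ ρ , mid k ρ ⟩ ≡ ρ
  ⟨⟩-η zero    []              = refl
  ⟨⟩-η (suc k) (q ∷ t ∷ s ∷ ρ) =
    trans (cong₂ (λ f g → ⟨ f , g , q ∷ mid k ρ ⟩) (src-∷ q t s ρ) (tgt-∷ q t s ρ))
          (cong (λ τ → q ∷ t ∷ s ∷ τ) (⟨⟩-η k ρ))

  ⟨⟩-⊙ : ∀ {l m k} (f g p : Sub m k) (σ : Sub l m) →
         ⟨ f , g , p ⟩ ⊙ σ ≡ ⟨ f ⊙ σ , g ⊙ σ , p ⊙ σ ⟩
  ⟨⟩-⊙ []      []      []      σ = refl
  ⟨⟩-⊙ (s ∷ f) (t ∷ g) (q ∷ p) σ = cong (λ τ → _ ∷ _ ∷ _ ∷ τ) (⟨⟩-⊙ f g p σ)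

  tabulate-⊙ : ∀ {l m n} (h : Fin n → Fin m) (σ : Sub l m) →
               tabulate (var ∘ h) ⊙ σ ≡ tabulate (lookup σ ∘ h)
  tabulate-⊙ h σ =
    trans (sym (tabulate-∘ _[ σ ]ᵗ (var ∘ h))) (tabulate-cong λ i → var-[] (h i) σ)

  wks-++ : ∀ {m n k} (α : Sub m k) (σ : Sub m n) → wks k ⊙ (α ++ σ) ≡ σ
  wks-++ α σ =
    trans (tabulate-⊙ _ (α ++ σ))
      (trans (tabulate-cong (lookup-++ʳ α σ)) (tabulate∘lookup σ))

  lastVars-++ : ∀ {m n k} (α : Sub m k) (σ : Sub m n) → lastVars k ⊙ (α ++ σ) ≡ α
  lastVars-++ α σ =
    trans (tabulate-⊙ _ (α ++ σ))
      (trans (tabulate-cong (lookup-++ˡ α σ)) (tabulate∘lookup α))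

  -- The left-hand side is the last type of IdCtx.
  IdCtx-IdOver : ∀ {n k} (Λ : Ctx k) D s t (f g : Sub n k) (α : Sub n k) →
    Id (D [ f ⊙ wks k ]) (s [ wks k ]ᵗ)
       (transport Λ D [ t [ wks k ]ᵗ ∷ ⟨ f ⊙ wks k , g ⊙ wks k , lastVars k ⟩ ]ᵗ)
       [ α ++ idˢ ]
    ≡ IdOver Λ D [ t ∷ s ∷ ⟨ f , g , α ⟩ ]
  IdCtx-IdOver {k = k} Λ D s t f g α =
    trans (Id-[] _ _ _ _)
      (trans (cong₃ Id
          ([]-≡ D (trans (weakened f) (sym (src-⟨⟩ f g α))))
          (weakenedᵗ s)
          ([]ᵗ-≡ (transport Λ D)
            (cong₂ _∷_ (weakenedᵗ t)
              (trans (⟨⟩-⊙ _ _ _ _)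
                (cong₃ ⟨_,_,_⟩ (weakened f) (weakened g) (lastVars-++ α idˢ))))))
        (sym (IdOver-[] Λ D t s ⟨ f , g , α ⟩)))
    where
    weakened : ∀ {j} (h : Sub _ j) → (h ⊙ wks k) ⊙ (α ++ idˢ) ≡ h
    weakened h =
      trans (⊙-assoc h (wks k) _) (trans (cong (h ⊙_) (wks-++ α idˢ)) (⊙-idˢ h))
    weakenedᵗ : ∀ a → a [ wks k ]ᵗ [ α ++ idˢ ]ᵗ ≡ a
    weakenedᵗ a = trans ([]ᵗ-≡ a (wks-++ α idˢ)) ([]ᵗ-id a)

  -- Both sides list the same path terms; they differ in whether the ends are carried as components
  -- or substituted into the types. `IdCtx-IdOver` matches the types.
  cell⇒path : ∀ {n k} {Γ : Ctx n} {Δ : Ctx k} {f g α} → Γ ⊢ f ∶∶ Δ → Γ ⊢ g ∶∶ Δ →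
              Γ ⊢ α ∶Id⟨ Δ ⟩ f ∼ g → Γ ⊢ ⟨ f , g , α ⟩ ∶∶ P Δ
  cell⇒path {α = []} ([] w) ([] _) _ = [] w
  cell⇒path {Δ = Λ ▹ D} {s ∷ f} {t ∷ g} {q ∷ α} (hs ∷ hf) (ht ∷ hg) (hq ∷ hα) =
    P-∷ (cell⇒path hf hg hα)
      (tm-≡ (cong (D [_]) (sym (src-⟨⟩ f g α))) hs)
      (tm-≡ (cong (D [_]) (sym (tgt-⟨⟩ f g α))) ht)
      (tm-≡ (IdCtx-IdOver Λ D s t f g α) hq)

  path⇒cell : ∀ {n k} {Γ : Ctx n} {Δ : Ctx k} {f g α} → Γ ctxt →
              Γ ⊢ ⟨ f , g , α ⟩ ∶∶ P Δ → Γ ⊢ α ∶Id⟨ Δ ⟩ f ∼ g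
  path⇒cell {Δ = ε}     {[]}    {[]}    {[]}    w _ = sub-id w
  path⇒cell {Δ = Λ ▹ D} {s ∷ f} {t ∷ g} {q ∷ α} w (hq ∷ _ ∷ _ ∷ hα) =
    tm-≡ (sym (IdCtx-IdOver Λ D s t f g α)) hq ∷ path⇒cell w hα

  cell-≐⇒path : ∀ {n k} {Γ : Ctx n} {Δ : Ctx k} {f g α f′ g′ α′} →
                Γ ⊢ f ≐ f′ ∶∶ Δ → Γ ⊢ g ≐ g′ ∶∶ Δ → Γ ⊢ α ≐ α′ ∶Id⟨ Δ ⟩ f ∼ g →
                Γ ⊢ ⟨ f , g , α ⟩ ≐ ⟨ f′ , g′ , α′ ⟩ ∶∶ P Δ
  cell-≐⇒path {α = []} {α′ = []} ([] w) ([] _) _ = [] w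
  cell-≐⇒path {Δ = Λ ▹ D} {s ∷ f} {t ∷ g} {q ∷ α} {α′ = _ ∷ _} (hs ∷ hf) (ht ∷ hg) (hq ∷ hα) =
    P-≐∷ (cell-≐⇒path hf hg hα)
      (≐tm-≡ (cong (D [_]) (sym (src-⟨⟩ f g α))) hs)
      (≐tm-≡ (cong (D [_]) (sym (tgt-⟨⟩ f g α))) ht)
      (≐tm-≡ (IdCtx-IdOver Λ D s t f g α) hq)

  path-≐⇒cell : ∀ {n k} {Γ : Ctx n} {Δ : Ctx k} {f g α f′ g′ α′} → Γ ctxt →
                Γ ⊢ ⟨ f , g , α ⟩ ≐ ⟨ f′ , g′ , α′ ⟩ ∶∶ P Δ →
                Γ ⊢ α ≐ α′ ∶Id⟨ Δ ⟩ f ∼ g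
  path-≐⇒cell {Δ = ε} {[]} {[]} {[]} {[]} {[]} {[]} w _ = ≐sub-refl (sub-id w)
  path-≐⇒cell {Δ = Λ ▹ D} {s ∷ f} {t ∷ g} {q ∷ α} {_ ∷ _} {_ ∷ _} {_ ∷ _} w (hq ∷ _ ∷ _ ∷ hα) =
    ≐tm-≡ (sym (IdCtx-IdOver Λ D s t f g α)) hq ∷ path-≐⇒cell w hα

  path-ends : ∀ {n k} {Γ : Ctx n} {Δ : Ctx k} {f g α f′ g′} →
              Γ ⊢ f ≐ f′ ∶∶ Δ → Γ ⊢ g ≐ g′ ∶∶ Δ → Γ ⊢ ⟨ f , g , α ⟩ ∶∶ P Δ →
              Γ ⊢ ⟨ f , g , α ⟩ ≐ ⟨ f′ , g′ , α ⟩ ∶∶ P Δ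
  path-ends hf hg hα =
    cell-≐⇒path hf hg (≐sub-refl (path⇒cell (≐sub-dom hf) hα))

-- An axiomatic setting for path objects with unique extensions

record PathCategory : Set₁ where
  infixr 9 _∘_
  infix  4 _≋_
  field
    Ob  : Set
    Hom : Ob → Ob → Set
    _≋_ : ∀ {A B} → Hom A B → Hom A B → Set
    ≋-isEquivalence : ∀ {A B} → IsEquivalence (_≋_ {A} {B})

    id  : ∀ {A} → Hom A A
    _∘_ : ∀ {A B C} → Hom B C → Hom A B → Hom A C

    ∘-cong : ∀ {A B C} {g g′ : Hom B C} {f f′ : Hom A B} →
             g ≋ g′ → f ≋ f′ → g ∘ f ≋ g′ ∘ f′
    idˡ    : ∀ {A B} {f : Hom A B} → id ∘ f ≋ f
    idʳ    : ∀ {A B} {f : Hom A B} → f ∘ id ≋ f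
    assoc  : ∀ {A B C D} {h : Hom C D} {g : Hom B C} {f : Hom A B} →
             (h ∘ g) ∘ f ≋ h ∘ g ∘ f

    Path : Ob → Ob
    s t  : ∀ {A} → Hom (Path A) A
    r    : ∀ {A} → Hom A (Path A)
    s∘r  : ∀ {A} → s ∘ r ≋ id {A}
    t∘r  : ∀ {A} → t ∘ r ≋ id {A}

    -- By `fill` and `unique`, anodyne maps are left orthogonal to (s, t), read as a map from Path A
    -- to A × A.
    Anodyne   : ∀ {A B} → Hom A B → Set
    r-anodyne : ∀ {A} → Anodyne (r {A})
    fill      : ∀ {X Y A} {i : Hom X Y} → Anodyne i →
                (f g : Hom Y A) (d : Hom X (Path A)) →
                s ∘ d ≋ f ∘ i → t ∘ d ≋ g ∘ i →
                ∃[ h ] (s ∘ h ≋ f) × (t ∘ h ≋ g) × (h ∘ i ≋ d)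
    unique    : ∀ {X Y A} {i : Hom X Y} → Anodyne i → {h h′ : Hom Y (Path A)} →
                s ∘ h ≋ s ∘ h′ → t ∘ h ≋ t ∘ h′ → h ∘ i ≋ h′ ∘ i → h ≋ h′

    Pull     : ∀ {W A} → Hom W A → Ob
    p₁       : ∀ {W A} {y : Hom W A} → Hom (Pull y) W
    p₂       : ∀ {W A} {y : Hom W A} → Hom (Pull y) (Path A)
    p-square : ∀ {W A} {y : Hom W A} → s ∘ p₂ ≋ y ∘ p₁ {y = y}
    pair     : ∀ {X W A} {y : Hom W A} (σ : Hom X W) (ρ : Hom X (Path A)) →
               s ∘ ρ ≋ y ∘ σ → Hom X (Pull y)
    p₁-pair  : ∀ {X W A} {y : Hom W A} {σ : Hom X W} {ρ : Hom X (Path A)}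
               {e : s ∘ ρ ≋ y ∘ σ} → p₁ ∘ pair σ ρ e ≋ σ
    p₂-pair  : ∀ {X W A} {y : Hom W A} {σ : Hom X W} {ρ : Hom X (Path A)}
               {e : s ∘ ρ ≋ y ∘ σ} → p₂ ∘ pair σ ρ e ≋ ρ
    pair-ext : ∀ {X W A} {y : Hom W A} {u v : Hom X (Pull y)} →
               p₁ ∘ u ≋ p₁ ∘ v → p₂ ∘ u ≋ p₂ ∘ v → u ≋ v

    -- The base change of i along `p₁`. The last axiom keeps it anodyne, so that extension along r
    -- can be iterated over pairs and triples of paths.
    pullMap    : ∀ {X W A} (y : Hom W A) {i : Hom X W} → Anodyne i →
                 Hom (Pull (y ∘ i)) (Pull y)
    p₁-pullMap : ∀ {X W A} {y : Hom W A} {i : Hom X W} {a : Anodyne i} →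
                 p₁ ∘ pullMap y a ≋ i ∘ p₁
    p₂-pullMap : ∀ {X W A} {y : Hom W A} {i : Hom X W} {a : Anodyne i} →
                 p₂ ∘ pullMap y a ≋ p₂
    pullMap-anodyne : ∀ {X W A} {y : Hom W A} {i : Hom X W} (a : Anodyne i) →
                      Anodyne (pullMap y a)

  module _ {A B : Ob} where
    open IsEquivalence (≋-isEquivalence {A} {B}) public
      renaming (refl to ≋-refl; sym to ≋-sym; trans to ≋-trans)

  infixr 5 _⨾_
  _⨾_ : ∀ {A B} {f g h : Hom A B} → f ≋ g → g ≋ h → f ≋ h
  _⨾_ = ≋-trans

  infixr 6 _◁_
  _◁_ : ∀ {A B C} (g : Hom B C) {f f′ : Hom A B} → f ≋ f′ → g ∘ f ≋ g ∘ f′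
  g ◁ e = ∘-cong ≋-refl e

  infixl 6 _▷_
  _▷_ : ∀ {A B C} {g g′ : Hom B C} → g ≋ g′ → (f : Hom A B) → g ∘ f ≋ g′ ∘ f
  e ▷ f = ∘-cong e ≋-refl

  cancelˡ : ∀ {A B C} {g : Hom B C} {h : Hom C B} {f : Hom A B} →
            h ∘ g ≋ id → h ∘ g ∘ f ≋ f
  cancelˡ e = ≋-sym assoc ⨾ e ▷ _ ⨾ idˡ

  pullˡ : ∀ {A B C D} {h : Hom C D} {g : Hom B C} {k : Hom B D} {f : Hom A B} →
          h ∘ g ≋ k → h ∘ g ∘ f ≋ k ∘ f
  pullˡ e = ≋-sym assoc ⨾ e ▷ _

-- Groupoid structure of paths and its functoriality

module Groupoid (𝒫 : PathCategory) where
  open PathCategory 𝒫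

  module _ {A : Ob} where
    private
      -- `Pull t` consists of the composable pairs, and m includes the pairs (r(x), β). Composition
      -- is the extension along m of (r(x), β) ↦ β.
      m = pullMap (t {A}) r-anodyne

      m-anodyne : Anodyne m
      m-anodyne = pullMap-anodyne r-anodyne

      filler = fill m-anodyne (s ∘ p₁) (t ∘ p₂) p₂
        (p-square ⨾ assoc ⨾ cancelˡ t∘r ⨾ ≋-sym (assoc ⨾ s ◁ p₁-pullMap ⨾ cancelˡ s∘r))
        (≋-sym (assoc ⨾ t ◁ p₂-pullMap))

      ∘ᵍ : Hom (Pull (t {A})) (Path A)
      ∘ᵍ = proj₁ filler

    -- Diagrammatic order: α comes first. The vertical composite of cells takes its arguments in the
    -- opposite order, which exchanges the two unit laws.
    comp : ∀ {X} (α β : Hom X (Path A)) → s ∘ β ≋ t ∘ α → Hom X (Path A)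
    comp α β e = ∘ᵍ ∘ pair α β e

    s-comp : ∀ {X} {α β : Hom X (Path A)} {e} → s ∘ comp α β e ≋ s ∘ α
    s-comp = pullˡ (proj₁ (proj₂ filler)) ⨾ assoc ⨾ s ◁ p₁-pair

    t-comp : ∀ {X} {α β : Hom X (Path A)} {e} → t ∘ comp α β e ≋ t ∘ β
    t-comp = pullˡ (proj₁ (proj₂ (proj₂ filler))) ⨾ assoc ⨾ t ◁ p₂-pair

    -- Maps into a pullback are determined by their projections, so the two sides may carry any
    -- proofs e and e′ of composability.
    comp-cong : ∀ {X} {α β α′ β′ : Hom X (Path A)} {e e′} →
                α ≋ α′ → β ≋ β′ → comp α β e ≋ comp α′ β′ e′
    comp-cong a b =
      ∘ᵍ ◁ pair-ext (p₁-pair ⨾ a ⨾ ≋-sym p₁-pair) (p₂-pair ⨾ b ⨾ ≋-sym p₂-pair)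

    whisk : ∀ {X Y} {α β : Hom X (Path A)} → s ∘ β ≋ t ∘ α → (τ : Hom Y X) →
            s ∘ β ∘ τ ≋ t ∘ α ∘ τ
    whisk e τ = pullˡ e ⨾ assoc

    comp-∘ : ∀ {X Y} {α β : Hom X (Path A)} {e} (τ : Hom Y X) →
             comp α β e ∘ τ ≋ comp (α ∘ τ) (β ∘ τ) (whisk e τ)
    comp-∘ τ =
      assoc ⨾ ∘ᵍ ◁ pair-ext (pullˡ p₁-pair ⨾ ≋-sym p₁-pair)
                            (pullˡ p₂-pair ⨾ ≋-sym p₂-pair)

    -- A pair that starts with a reflexivity factors through m, where composition was prescribed to
    -- be the second projection.
    comp-idˡ : ∀ {X} {α β : Hom X (Path A)} {e} {x} → α ≋ r ∘ x → comp α β e ≋ β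
    comp-idˡ {α = α} {β} {e} {x} a =
      ∘ᵍ ◁ pair-ext {v = m ∘ pair x β e′}
             (p₁-pair ⨾ a ⨾ ≋-sym (pullˡ p₁-pullMap ⨾ assoc ⨾ r ◁ p₁-pair))
             (p₂-pair ⨾ ≋-sym (pullˡ p₂-pullMap ⨾ p₂-pair))
      ⨾ pullˡ (proj₂ (proj₂ (proj₂ filler))) ⨾ p₂-pair
      where
      e′ : s ∘ β ≋ (t ∘ r) ∘ x
      e′ = e ⨾ t ◁ a ⨾ ≋-sym assoc

    private
      -- The identity of Path A is the generic path: a law proved for it passes to every α by
      -- precomposition, with which composites commute by `comp-∘`. On the diagonal this law reads r
      -- · r = r, a case of the left unit.
      idʳ-generic : ∀ {e} → comp id (r ∘ t) e ≋ id
      idʳ-generic {e} = unique r-anodyne s-comp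
        (t-comp ⨾ cancelˡ t∘r ⨾ ≋-sym idʳ)
        (comp-∘ {e = e} r ⨾ comp-idˡ {x = id} (idˡ ⨾ ≋-sym idʳ)
          ⨾ assoc ⨾ r ◁ t∘r ⨾ idʳ ⨾ ≋-sym idˡ)

    comp-idʳ : ∀ {X} {α β : Hom X (Path A)} {e} {x} → β ≋ r ∘ x → comp α β e ≋ α
    comp-idʳ {α = α} {β} {e} {x} b =
      comp-cong (≋-sym idˡ) (b ⨾ r ◁ x≋ ⨾ ≋-sym assoc)
      ⨾ ≋-sym (comp-∘ {e = cancelˡ s∘r ⨾ ≋-sym idʳ} α) ⨾ idʳ-generic ▷ α ⨾ idˡ
      where
      x≋ : x ≋ t ∘ α
      -- The source of β is x, and it is also the target of α.
      x≋ = ≋-sym (s ◁ b ⨾ cancelˡ s∘r) ⨾ e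

    private
      -- `Pull (t ∘ p₂)` is the object of composable triples, and m₃ includes those whose first path
      -- is a reflexivity. There both bracketings reduce to the composite of the last two paths.
      m₃ = pullMap (t ∘ p₂) m-anodyne

      a₃ b₃ c₃ : Hom (Pull (t ∘ p₂ {y = t {A}})) (Path A)
      a₃ = p₁ ∘ p₁
      b₃ = p₂ ∘ p₁
      c₃ = p₂

      e₁ : s ∘ b₃ ≋ t ∘ a₃
      e₁ = pullˡ p-square ⨾ assoc

      e₂ : s ∘ c₃ ≋ t ∘ b₃
      e₂ = p-square ⨾ assoc

      a₃-m₃ : a₃ ∘ m₃ ≋ r ∘ p₁ ∘ p₁
      a₃-m₃ = assoc ⨾ p₁ ◁ p₁-pullMap ⨾ pullˡ p₁-pullMap ⨾ assoc

      assoc-generic : comp (comp a₃ b₃ e₁) c₃ (e₂ ⨾ ≋-sym t-comp) ≋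
                      comp a₃ (comp b₃ c₃ e₂) (s-comp ⨾ e₁)
      assoc-generic = unique (pullMap-anodyne m-anodyne)
        (s-comp ⨾ s-comp ⨾ ≋-sym s-comp)
        (t-comp ⨾ ≋-sym (t-comp ⨾ t-comp))
        (comp-∘ m₃ ⨾ comp-cong {e′ = whisk e₂ m₃} (comp-∘ m₃ ⨾ comp-idˡ a₃-m₃) ≋-refl
          ⨾ ≋-sym (comp-∘ m₃ ⨾ comp-idˡ a₃-m₃ ⨾ comp-∘ m₃))

    comp-assoc : ∀ {X} {α β γ : Hom X (Path A)} {e e′ e″ e‴} →
                 comp (comp α β e) γ e′ ≋ comp α (comp β γ e″) e‴
    comp-assoc {X} {α} {β} {γ} {e} {e″ = e″} =
      ≋-sym (comp-∘ u ⨾ comp-cong (comp-∘ u ⨾ comp-cong a b) c)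
      ⨾ assoc-generic ▷ u
      ⨾ comp-∘ u ⨾ comp-cong a (comp-∘ u ⨾ comp-cong b c)
      where
      uv : s ∘ γ ≋ (t ∘ p₂) ∘ pair α β e
      uv = e″ ⨾ ≋-sym (assoc ⨾ t ◁ p₂-pair)
      u = pair (pair α β e) γ uv
      a : a₃ ∘ u ≋ α
      a = assoc ⨾ p₁ ◁ p₁-pair ⨾ p₁-pair
      b : b₃ ∘ u ≋ β
      b = assoc ⨾ p₂ ◁ p₁-pair ⨾ p₂-pair
      c : c₃ ∘ u ≋ γ
      c = p₂-pair

    private
      -- The requested ends are interchanged, which is consistent because s and t agree on the
      -- diagonal.
      inverter = fill r-anodyne (t {A}) s r
        (s∘r ⨾ ≋-sym t∘r) (t∘r ⨾ ≋-sym s∘r)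

    inv : Hom (Path A) (Path A)
    inv = proj₁ inverter

    s-inv : s ∘ inv ≋ t
    s-inv = proj₁ (proj₂ inverter)

    t-inv : t ∘ inv ≋ s
    t-inv = proj₁ (proj₂ (proj₂ inverter))

    inv-r : inv ∘ r ≋ r
    inv-r = proj₂ (proj₂ (proj₂ inverter))

    private
      invʳ-generic : ∀ {e} → comp id inv e ≋ r ∘ s
      invʳ-generic {e} = unique r-anodyne
        (s-comp ⨾ idʳ ⨾ ≋-sym (cancelˡ s∘r))
        (t-comp ⨾ t-inv ⨾ ≋-sym (cancelˡ t∘r))
        (comp-∘ {e = e} r ⨾ comp-idˡ (idˡ ⨾ ≋-sym idʳ) ⨾ inv-r
          ⨾ ≋-sym (assoc ⨾ r ◁ s∘r ⨾ idʳ))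

      invˡ-generic : ∀ {e} → comp inv id e ≋ r ∘ t
      invˡ-generic {e} = unique r-anodyne
        (s-comp ⨾ s-inv ⨾ ≋-sym (cancelˡ s∘r))
        (t-comp ⨾ idʳ ⨾ ≋-sym (cancelˡ t∘r))
        (comp-∘ {e = e} r ⨾ comp-idˡ (inv-r ⨾ ≋-sym idʳ) ⨾ idˡ
          ⨾ ≋-sym (assoc ⨾ r ◁ t∘r ⨾ idʳ))

    comp-invʳ : ∀ {X} {α : Hom X (Path A)} {e} → comp α (inv ∘ α) e ≋ r ∘ s ∘ α
    comp-invʳ {α = α} =
      comp-cong (≋-sym idˡ) ≋-refl
      ⨾ ≋-sym (comp-∘ {e = s-inv ⨾ ≋-sym idʳ} α) ⨾ invʳ-generic ▷ α ⨾ assoc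

    comp-invˡ : ∀ {X} {α : Hom X (Path A)} {e} → comp (inv ∘ α) α e ≋ r ∘ t ∘ α
    comp-invˡ {α = α} =
      comp-cong ≋-refl (≋-sym idˡ)
      ⨾ ≋-sym (comp-∘ {e = idʳ ⨾ ≋-sym t-inv} α) ⨾ invˡ-generic ▷ α ⨾ assoc

  module _ {A B : Ob} (g : Hom A B) where
    private
      filler = fill r-anodyne (g ∘ s) (g ∘ t) (r ∘ g)
        (cancelˡ s∘r ⨾ ≋-sym (assoc ⨾ g ◁ s∘r ⨾ idʳ))
        (cancelˡ t∘r ⨾ ≋-sym (assoc ⨾ g ◁ t∘r ⨾ idʳ))

    map : Hom (Path A) (Path B)
    map = proj₁ filler

    s-map : s ∘ map ≋ g ∘ s
    s-map = proj₁ (proj₂ filler)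

    t-map : t ∘ map ≋ g ∘ t
    t-map = proj₁ (proj₂ (proj₂ filler))

    map-r : map ∘ r ≋ r ∘ g
    map-r = proj₂ (proj₂ (proj₂ filler))

    -- Functoriality of `map`, and later its agreement with the conversion between definitionally
    -- equal contexts, are checked through this characterisation.
    map-unique : ∀ {h} → s ∘ h ≋ g ∘ s → t ∘ h ≋ g ∘ t → h ∘ r ≋ r ∘ g → h ≋ map
    map-unique a b c = unique r-anodyne (a ⨾ ≋-sym s-map) (b ⨾ ≋-sym t-map) (c ⨾ ≋-sym map-r)

  map-cong : ∀ {A B} {g g′ : Hom A B} → g ≋ g′ → map g ≋ map g′
  map-cong {g = g} {g′} e = map-unique g′ (s-map g ⨾ e ▷ s) (t-map g ⨾ e ▷ t) (map-r g ⨾ r ◁ e)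

  map-id : ∀ {A} → map (id {A}) ≋ id
  map-id = ≋-sym (map-unique id (idʳ ⨾ ≋-sym idˡ) (idʳ ⨾ ≋-sym idˡ) (idˡ ⨾ ≋-sym idʳ))

  map-∘ : ∀ {A B C} {h : Hom B C} {g : Hom A B} → map (h ∘ g) ≋ map h ∘ map g
  map-∘ {h = h} {g} = ≋-sym (map-unique (h ∘ g)
    (pullˡ (s-map h) ⨾ assoc ⨾ h ◁ s-map g ⨾ ≋-sym assoc)
    (pullˡ (t-map h) ⨾ assoc ⨾ h ◁ t-map g ⨾ ≋-sym assoc)
    (assoc ⨾ map h ◁ map-r g ⨾ pullˡ (map-r h) ⨾ assoc))

  map-ends : ∀ {A B X} (g : Hom A B) {α β : Hom X (Path A)} → s ∘ β ≋ t ∘ α →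
             s ∘ map g ∘ β ≋ t ∘ map g ∘ α
  map-ends g e = pullˡ (s-map g) ⨾ assoc ⨾ g ◁ e ⨾ ≋-sym (pullˡ (t-map g) ⨾ assoc)

  map-comp : ∀ {A B X} (g : Hom A B) {α β : Hom X (Path A)} {e e′} →
             map g ∘ comp α β e ≋ comp (map g ∘ α) (map g ∘ β) e′
  map-comp {A} g {α} {β} {e} =
    map g ◁ (comp-cong (≋-sym p₁-pair) (≋-sym p₂-pair) ⨾ ≋-sym (comp-∘ u))
    ⨾ ≋-sym assoc ⨾ generic ▷ u ⨾ comp-∘ u
    ⨾ comp-cong (assoc ⨾ map g ◁ p₁-pair) (assoc ⨾ map g ◁ p₂-pair)
    where
    u = pair α β e
    generic : map g ∘ comp p₁ (p₂ {y = t {A}}) p-square ≋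
              comp (map g ∘ p₁) (map g ∘ p₂) (map-ends g p-square)
    -- It is enough to test pairs that begin with a reflexivity. `map g` preserves reflexivities, so
    -- both sides become `map g` of the second path.
    generic = unique (pullMap-anodyne r-anodyne)
      (pullˡ (s-map g) ⨾ assoc ⨾ g ◁ s-comp
        ⨾ ≋-sym (s-comp ⨾ pullˡ (s-map g) ⨾ assoc))
      (pullˡ (t-map g) ⨾ assoc ⨾ g ◁ t-comp
        ⨾ ≋-sym (t-comp ⨾ pullˡ (t-map g) ⨾ assoc))
      (assoc ⨾ map g ◁ (comp-∘ _ ⨾ comp-idˡ p₁-pullMap)
        ⨾ ≋-sym (comp-∘ _
            ⨾ comp-idˡ (assoc ⨾ map g ◁ p₁-pullMap ⨾ pullˡ (map-r g) ⨾ assoc) ⨾ assoc))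

  -- For the generic path in place of α both sides run from f ∘ s to g ∘ t, and on the diagonal both
  -- reduce to β, one by the left and the other by the right unit law.
  naturality : ∀ {A B X} {f g : Hom A B} {β : Hom A (Path B)} {α : Hom X (Path A)} {e e′} →
               s ∘ β ≋ f → t ∘ β ≋ g →
               comp (map f ∘ α) (β ∘ t ∘ α) e ≋ comp (β ∘ s ∘ α) (map g ∘ α) e′
  naturality {f = f} {g} {β} {α} sβ tβ =
    comp-cong ≋-refl (≋-sym assoc) ⨾ ≋-sym (comp-∘ α) ⨾ generic ▷ α
    ⨾ comp-∘ α ⨾ comp-cong assoc ≋-refl
    where
    e₁ : s ∘ β ∘ t ≋ t ∘ map f
    e₁ = pullˡ sβ ⨾ ≋-sym (t-map f)
    e₂ : s ∘ map g ≋ t ∘ β ∘ s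
    e₂ = s-map g ⨾ ≋-sym (pullˡ tβ)
    generic : comp (map f) (β ∘ t) e₁ ≋ comp (β ∘ s) (map g) e₂
    generic = unique r-anodyne
      (s-comp ⨾ s-map f ⨾ ≋-sym (s-comp ⨾ pullˡ sβ))
      (t-comp ⨾ pullˡ tβ ⨾ ≋-sym (t-comp ⨾ t-map g))
      (comp-∘ r ⨾ comp-idˡ (map-r f) ⨾ assoc ⨾ β ◁ t∘r ⨾ idʳ
        ⨾ ≋-sym (comp-∘ r ⨾ comp-idʳ (map-r g) ⨾ assoc ⨾ β ◁ s∘r ⨾ idʳ))

-- Cells and the laws of a locally groupoidal 2-category

module Cells (𝒫 : PathCategory) where
  open PathCategory 𝒫
  open Groupoid 𝒫

  infix 4 _≈ᶜ_

  record Cell {A B} (f g : Hom A B) : Set where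
    field
      path   : Hom A (Path B)
      s-path : s ∘ path ≋ f
      t-path : t ∘ path ≋ g

  open Cell public

  record _≈ᶜ_ {A B} {f g f′ g′ : Hom A B} (α : Cell f g) (α′ : Cell f′ g′) : Set where
    constructor mk≈
    field path-≋ : path α ≋ path α′

  open _≈ᶜ_ public

  -- When c and d are the conversions between definitionally equal contexts, a square states that α
  -- and α′ are the same cell over two presentations of its contexts.
  record Square {A B A′ B′} (c : Hom B B′) (d : Hom A A′) {f g : Hom A B} {f′ g′ : Hom A′ B′}
                (α : Cell f g) (α′ : Cell f′ g′) : Set where
    constructor mk□
    field square : map c ∘ path α ≋ path α′ ∘ d

  open Square public

  ≈ᶜ-s : ∀ {A B} {f g f′ g′ : Hom A B} {α : Cell f g} {α′ : Cell f′ g′} →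
         α ≈ᶜ α′ → f ≋ f′
  ≈ᶜ-s {α = α} {α′} e = ≋-sym (s-path α) ⨾ s ◁ path-≋ e ⨾ s-path α′

  ≈ᶜ-t : ∀ {A B} {f g f′ g′ : Hom A B} {α : Cell f g} {α′ : Cell f′ g′} →
         α ≈ᶜ α′ → g ≋ g′
  ≈ᶜ-t {α = α} {α′} e = ≋-sym (t-path α) ⨾ t ◁ path-≋ e ⨾ t-path α′

  square-s : ∀ {A B A′ B′} {c : Hom B B′} {d : Hom A A′} {f g : Hom A B} {f′ g′ : Hom A′ B′}
             {α : Cell f g} {α′ : Cell f′ g′} → Square c d α α′ → c ∘ f ≋ f′ ∘ d
  square-s {c = c} {α = α} {α′} e =
    c ◁ ≋-sym (s-path α) ⨾ ≋-sym (pullˡ (s-map c) ⨾ assoc) ⨾ s ◁ square e ⨾ pullˡ (s-path α′)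

  square-t : ∀ {A B A′ B′} {c : Hom B B′} {d : Hom A A′} {f g : Hom A B} {f′ g′ : Hom A′ B′}
             {α : Cell f g} {α′ : Cell f′ g′} → Square c d α α′ → c ∘ g ≋ g′ ∘ d
  square-t {c = c} {α = α} {α′} e =
    c ◁ ≋-sym (t-path α) ⨾ ≋-sym (pullˡ (t-map c) ⨾ assoc) ⨾ t ◁ square e ⨾ pullˡ (t-path α′)

  module _ {A B A′ B′} (c : Hom B B′) (d : Hom A A′) (κ : Hom (Path B) (Path B′))
           (κ≋ : κ ≋ map c) {f g : Hom A B} {f′ g′ : Hom A′ B′}
           (α : Cell f g) (α′ : Cell f′ g′) where
    -- κ is another description of `map c`: for a conversion of contexts it is a plain list of
    -- variables, whereas `map c` is built from the extension property.
    ≋⇒□ : κ ∘ path α ≋ path α′ ∘ d → Square c d α α′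
    ≋⇒□ e = mk□ (≋-sym κ≋ ▷ path α ⨾ e)

    □⇒≋ : Square c d α α′ → κ ∘ path α ≋ path α′ ∘ d
    □⇒≋ e = κ≋ ▷ path α ⨾ square e

  idᶜ : ∀ {A B} (f : Hom A B) → Cell f f
  idᶜ f = record { path = r ∘ f ; s-path = cancelˡ s∘r ; t-path = cancelˡ t∘r }

  inverse : ∀ {A B} {f g : Hom A B} → Cell f g → Cell g f
  inverse α = record
    { path = inv ∘ path α
    ; s-path = pullˡ s-inv ⨾ t-path α ; t-path = pullˡ t-inv ⨾ s-path α }

  module _ {A B} {f g h : Hom A B} (β : Cell g h) (α : Cell f g) where
    ∙-ends : s ∘ path β ≋ t ∘ path α
    ∙-ends = s-path β ⨾ ≋-sym (t-path α)

    infixr 9 _∙_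
    _∙_ : Cell f h
    _∙_ = record
      { path = comp (path α) (path β) ∙-ends
      ; s-path = s-comp ⨾ s-path α ; t-path = t-comp ⨾ t-path β }

  module _ {A B C} {f f′ : Hom A B} {g g′ : Hom B C} (β : Cell g g′) (α : Cell f f′) where
    ⋆-ends : s ∘ path β ∘ f′ ≋ t ∘ map g ∘ path α
    ⋆-ends = pullˡ (s-path β) ⨾ g ◁ ≋-sym (t-path α) ⨾ ≋-sym (pullˡ (t-map g) ⨾ assoc)

    infixr 9 _⋆_
    -- Of the two ways to form the horizontal composite, this one applies g to α first and continues
    -- with β at f′. `naturality` identifies it with the other.
    _⋆_ : Cell (g ∘ f) (g′ ∘ f′)
    _⋆_ = record
      { path = comp (map g ∘ path α) (path β ∘ f′) ⋆-ends
      ; s-path = s-comp ⨾ pullˡ (s-map g) ⨾ assoc ⨾ g ◁ s-path α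
      ; t-path = t-comp ⨾ pullˡ (t-path β) }

  ≈ᶜ-refl : ∀ {A B} {f g : Hom A B} {α : Cell f g} → α ≈ᶜ α
  ≈ᶜ-refl = mk≈ ≋-refl

  ≈ᶜ-sym : ∀ {A B} {f g f′ g′ : Hom A B} {α : Cell f g} {α′ : Cell f′ g′} →
           α ≈ᶜ α′ → α′ ≈ᶜ α
  ≈ᶜ-sym (mk≈ e) = mk≈ (≋-sym e)

  ≈ᶜ-trans : ∀ {A B} {f g f′ g′ f″ g″ : Hom A B}
             {α : Cell f g} {α′ : Cell f′ g′} {α″ : Cell f″ g″} →
             α ≈ᶜ α′ → α′ ≈ᶜ α″ → α ≈ᶜ α″
  ≈ᶜ-trans (mk≈ e) (mk≈ e′) = mk≈ (e ⨾ e′)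

  -- `comp-cong` leaves the composability proof of its right side undetermined. Here it is computed
  -- from the left side, so that steps can be chained without stating it; the two forms of
  -- associativity below serve the same end.
  comp-cong-to : ∀ {X A} {α β α′ β′ : Hom X (Path A)} {e} (a : α ≋ α′) (b : β ≋ β′) →
                 comp α β e ≋ comp α′ β′ (s ◁ ≋-sym b ⨾ e ⨾ t ◁ a)
  comp-cong-to a b = comp-cong a b

  comp-assocˡ : ∀ {X A} {α β γ : Hom X (Path A)} {e e′} →
                comp (comp α β e) γ e′ ≋ comp α (comp β γ (e′ ⨾ t-comp)) (s-comp ⨾ e)
  comp-assocˡ = comp-assoc

  comp-assocʳ : ∀ {X A} {α β γ : Hom X (Path A)} {e e′} →
                comp α (comp β γ e) e′ ≋
                comp (comp α β (≋-sym s-comp ⨾ e′)) γ (e ⨾ ≋-sym t-comp)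
  comp-assocʳ = ≋-sym comp-assoc

  ∙-cong : ∀ {A B} {f g h f′ g′ h′ : Hom A B} {β : Cell g h} {β′ : Cell g′ h′}
           {α : Cell f g} {α′ : Cell f′ g′} →
           β ≈ᶜ β′ → α ≈ᶜ α′ → β ∙ α ≈ᶜ β′ ∙ α′
  ∙-cong (mk≈ eβ) (mk≈ eα) = mk≈ (comp-cong eα eβ)

  ⋆-cong : ∀ {A B C} {f₁ f₂ f₁′ f₂′ : Hom A B} {g₁ g₂ g₁′ g₂′ : Hom B C}
           {β : Cell g₁ g₂} {β′ : Cell g₁′ g₂′} {α : Cell f₁ f₂} {α′ : Cell f₁′ f₂′} →
           β ≈ᶜ β′ → α ≈ᶜ α′ → β ⋆ α ≈ᶜ β′ ⋆ α′
  ⋆-cong eβ eα =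
    mk≈ (comp-cong (∘-cong (map-cong (≈ᶜ-s eβ)) (path-≋ eα)) (∘-cong (path-≋ eβ) (≈ᶜ-t eα)))

  ∙-identityˡ : ∀ {A B} {f g : Hom A B} (α : Cell f g) → idᶜ g ∙ α ≈ᶜ α
  ∙-identityˡ α = mk≈ (comp-idʳ ≋-refl)

  ∙-identityʳ : ∀ {A B} {f g : Hom A B} (α : Cell f g) → α ∙ idᶜ f ≈ᶜ α
  ∙-identityʳ α = mk≈ (comp-idˡ ≋-refl)

  ∙-assoc : ∀ {A B} {f g h k : Hom A B} (γ : Cell h k) (β : Cell g h) (α : Cell f g) →
            (γ ∙ β) ∙ α ≈ᶜ γ ∙ (β ∙ α)
  ∙-assoc γ β α = mk≈ (≋-sym comp-assoc)

  inverseˡ : ∀ {A B} {f g : Hom A B} (α : Cell f g) → inverse α ∙ α ≈ᶜ idᶜ f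
  inverseˡ α = mk≈ (comp-invʳ ⨾ r ◁ s-path α)

  inverseʳ : ∀ {A B} {f g : Hom A B} (α : Cell f g) → α ∙ inverse α ≈ᶜ idᶜ g
  inverseʳ α = mk≈ (comp-invˡ ⨾ r ◁ t-path α)

  ⋆-identityˡ : ∀ {A B} {f g : Hom A B} (α : Cell f g) → idᶜ id ⋆ α ≈ᶜ α
  ⋆-identityˡ α = mk≈ (comp-idʳ assoc ⨾ map-id ▷ path α ⨾ idˡ)

  ⋆-identityʳ : ∀ {A B} {f g : Hom A B} (α : Cell f g) → α ⋆ idᶜ id ≈ᶜ α
  ⋆-identityʳ {f = f} α = mk≈ (comp-idˡ (pullˡ (map-r f) ⨾ assoc) ⨾ idʳ)

  ⋆-id : ∀ {A B C} (g : Hom B C) (f : Hom A B) → idᶜ g ⋆ idᶜ f ≈ᶜ idᶜ (g ∘ f)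
  ⋆-id g f = mk≈ (comp-idˡ (pullˡ (map-r g) ⨾ assoc) ⨾ assoc)

  ⋆-assoc : ∀ {A B C D} {f f′ : Hom A B} {g g′ : Hom B C} {h h′ : Hom C D}
            (γ : Cell h h′) (β : Cell g g′) (α : Cell f f′) →
            (γ ⋆ β) ⋆ α ≈ᶜ γ ⋆ (β ⋆ α)
  ⋆-assoc {f′ = f′} {h = h} γ β α = mk≈
    -- Both sides are bracketings of α under h ∘ g, then β under h and at f′, then γ at g′ ∘ f′.
    (comp-cong-to (map-∘ ▷ path α ⨾ assoc) (comp-∘ f′)
     ⨾ comp-assocʳ
     ⨾ comp-cong (comp-cong-to ≋-refl assoc ⨾ ≋-sym (map-comp h)) assoc)

  -- Associativity isolates b and c between a and d, where the given equation applies.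
  middle-four : ∀ {X A} {a b c d b′ c′ : Hom X (Path A)} {e₁ e₂ e₃ e₄ e₅ e₆ e e′} →
                comp b c e ≋ comp b′ c′ e′ →
                comp (comp a b e₁) (comp c d e₂) e₃ ≋ comp (comp a b′ e₄) (comp c′ d e₅) e₆
  middle-four x =
    comp-assocˡ
    ⨾ comp-cong-to ≋-refl
        (comp-assocʳ ⨾ comp-cong-to (comp-cong ≋-refl ≋-refl ⨾ x) ≋-refl ⨾ comp-assocˡ)
    ⨾ comp-assocʳ ⨾ comp-cong (comp-cong ≋-refl ≋-refl) (comp-cong ≋-refl ≋-refl)

  interchange : ∀ {A B C} {f g h : Hom A B} {k l m : Hom B C}
                (δ : Cell l m) (γ : Cell k l) (β : Cell g h) (α : Cell f g) →
                (δ ∙ γ) ⋆ (β ∙ α) ≈ᶜ (δ ⋆ β) ∙ (γ ⋆ α)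
  interchange {A} {B} {C} {f} {g} {h} {k} {l} δ γ β α =
    mk≈ (comp-cong {e′ = ends} (map-comp k) (comp-∘ h) ⨾ middle-four swap)
    where
    ends : s ∘ comp (path γ ∘ h) (path δ ∘ h) (whisk (∙-ends δ γ) h) ≋
           t ∘ comp (map k ∘ path α) (map k ∘ path β) (map-ends k (∙-ends β α))
    ends = s-comp ⨾ ⋆-ends γ β ⨾ ≋-sym t-comp
    swap-ends : s ∘ map l ∘ path β ≋ t ∘ path γ ∘ g
    swap-ends = pullˡ (s-map l) ⨾ assoc ⨾ l ◁ s-path β ⨾ ≋-sym (pullˡ (t-path γ))
    natural-ends : s ∘ path γ ∘ t ∘ path β ≋ t ∘ map k ∘ path β
    natural-ends = pullˡ (s-path γ) ⨾ ≋-sym (pullˡ (t-map k) ⨾ assoc)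
    natural-ends′ : s ∘ map l ∘ path β ≋ t ∘ path γ ∘ s ∘ path β
    natural-ends′ = pullˡ (s-map l) ⨾ assoc ⨾ ≋-sym (pullˡ (t-path γ))
    -- The middle factors are k applied to β and γ at h. Naturality of γ along β exchanges them for
    -- γ at g and l applied to β.
    swap : comp (map k ∘ path β) (path γ ∘ h) (⋆-ends γ β) ≋
           comp (path γ ∘ g) (map l ∘ path β) swap-ends
    swap =
      comp-cong ≋-refl (path γ ◁ ≋-sym (t-path β))
      ⨾ naturality {e = natural-ends} {natural-ends′} (s-path γ) (t-path γ)
      ⨾ comp-cong (path γ ◁ s-path β) ≋-refl

  id-square : ∀ {A B A′ B′} {c : Hom B B′} {d : Hom A A′} {f : Hom A B} {f′ : Hom A′ B′} →
              c ∘ f ≋ f′ ∘ d → Square c d (idᶜ f) (idᶜ f′)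
  id-square {c = c} e = mk□ (pullˡ (map-r c) ⨾ assoc ⨾ r ◁ e ⨾ ≋-sym assoc)

  ∙-square : ∀ {A B A′ B′} {c : Hom B B′} {d : Hom A A′}
             {f g h : Hom A B} {f′ g′ h′ : Hom A′ B′}
             {β : Cell g h} {β′ : Cell g′ h′} {α : Cell f g} {α′ : Cell f′ g′} →
             Square c d β β′ → Square c d α α′ → Square c d (β ∙ α) (β′ ∙ α′)
  ∙-square {c = c} {d} {β = β} {α = α} (mk□ eβ) (mk□ eα) =
    mk□ (map-comp c {e′ = map-ends c (∙-ends β α)} ⨾ comp-cong eα eβ ⨾ ≋-sym (comp-∘ d))

  ⋆-square : ∀ {A B C A′ B′ C′} {c : Hom C C′} {b : Hom B B′} {a : Hom A A′}
             {f₁ f₂ : Hom A B} {g₁ g₂ : Hom B C} {f₁′ f₂′ : Hom A′ B′} {g₁′ g₂′ : Hom B′ C′}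
             {β : Cell g₁ g₂} {β′ : Cell g₁′ g₂′} {α : Cell f₁ f₂} {α′ : Cell f₁′ f₂′} →
             Square c b β β′ → Square b a α α′ → Square c a (β ⋆ α) (β′ ⋆ α′)
  ⋆-square {c = c} {b} {a} {g₁′ = g₁′} {β = β} {β′} {α} □β □α =
    mk□ (map-comp c {e′ = map-ends c (⋆-ends β α)}
         ⨾ comp-cong
             -- The sources of the square for β give c ∘ g₁ ≋ g₁′ ∘ b, which functoriality of `map`
             -- carries over to paths.
             (pullˡ (≋-sym map-∘ ⨾ map-cong (square-s □β) ⨾ map-∘) ⨾ assoc
              ⨾ map g₁′ ◁ square □α ⨾ ≋-sym assoc)
             (pullˡ (square □β) ⨾ assoc ⨾ path β′ ◁ square-t □α ⨾ ≋-sym assoc)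
         ⨾ ≋-sym (comp-∘ a))

  ≈ᶜ-square : ∀ {A B A′ B′} {c : Hom B B′} {d : Hom A A′}
              {f g f₀ g₀ : Hom A B} {f′ g′ f₀′ g₀′ : Hom A′ B′}
              {α : Cell f g} {α₀ : Cell f₀ g₀} {α′ : Cell f′ g′} {α₀′ : Cell f₀′ g₀′} →
              α ≈ᶜ α₀ → α′ ≈ᶜ α₀′ → Square c d α₀ α₀′ → Square c d α α′
  ≈ᶜ-square {c = c} {d} (mk≈ e) (mk≈ e′) (mk□ x) = mk□ (map c ◁ e ⨾ x ⨾ ≋-sym e′ ▷ d)

  -- IdCell is not of the form Cell, but only equivalent to it up to ≈ᶜ.
  record Presentation : Set₁ where
    infixr 9 _∙′_ _⋆′_
    infix  4 _≈′_

    field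
      Cell′  : ∀ {A B} → Hom A B → Hom A B → Set
      toCell : ∀ {A B} {f g : Hom A B} → Cell′ f g → Cell f g
      fromCell : ∀ {A B} {f g : Hom A B} → Cell f g → Cell′ f g
      to-from  : ∀ {A B} {f g : Hom A B} (α : Cell f g) → toCell (fromCell α) ≈ᶜ α

    record _≈′_ {A B} {f g f′ g′ : Hom A B} (α : Cell′ f g) (α′ : Cell′ f′ g′) : Set where
      constructor mk′
      field cell-≈ : toCell α ≈ᶜ toCell α′

    open _≈′_ public

    record Square′ {A B A′ B′} (c : Hom B B′) (d : Hom A A′)
                   {f g : Hom A B} {f′ g′ : Hom A′ B′}
                   (α : Cell′ f g) (α′ : Cell′ f′ g′) : Set where
      constructor mk□′
      field cell-□ : Square c d (toCell α) (toCell α′)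

    open Square′ public

    abstract
      id′ : ∀ {A B} (f : Hom A B) → Cell′ f f
      id′ f = fromCell (idᶜ f)

      inverse′ : ∀ {A B} {f g : Hom A B} → Cell′ f g → Cell′ g f
      inverse′ α = fromCell (inverse (toCell α))

      _∙′_ : ∀ {A B} {f g h : Hom A B} → Cell′ g h → Cell′ f g → Cell′ f h
      β ∙′ α = fromCell (toCell β ∙ toCell α)

      _⋆′_ : ∀ {A B C} {f f′ : Hom A B} {g g′ : Hom B C} →
             Cell′ g g′ → Cell′ f f′ → Cell′ (g ∘ f) (g′ ∘ f′)
      β ⋆′ α = fromCell (toCell β ⋆ toCell α)

      infixr 5 _⨾ᶜ_
      _⨾ᶜ_ : ∀ {A B} {f g f′ g′ f″ g″ : Hom A B}
             {α : Cell f g} {α′ : Cell f′ g′} {α″ : Cell f″ g″} →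
             α ≈ᶜ α′ → α′ ≈ᶜ α″ → α ≈ᶜ α″
      _⨾ᶜ_ = ≈ᶜ-trans

      toCell-∙ : ∀ {A B} {f g h : Hom A B} (β : Cell′ g h) (α : Cell′ f g) →
                 toCell (β ∙′ α) ≈ᶜ toCell β ∙ toCell α
      toCell-∙ β α = to-from (toCell β ∙ toCell α)

      toCell-⋆ : ∀ {A B C} {f f′ : Hom A B} {g g′ : Hom B C}
                 (β : Cell′ g g′) (α : Cell′ f f′) →
                 toCell (β ⋆′ α) ≈ᶜ toCell β ⋆ toCell α
      toCell-⋆ β α = to-from (toCell β ⋆ toCell α)

      ≈′-refl : ∀ {A B} {f g : Hom A B} (α : Cell′ f g) → α ≈′ α
      ≈′-refl α = mk′ ≈ᶜ-refl

      ∙′-identityˡ : ∀ {A B} {f g : Hom A B} (α : Cell′ f g) → id′ g ∙′ α ≈′ α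
      ∙′-identityˡ α = mk′
        (toCell-∙ (id′ _) α ⨾ᶜ ∙-cong (to-from _) ≈ᶜ-refl ⨾ᶜ ∙-identityˡ (toCell α))

      ∙′-identityʳ : ∀ {A B} {f g : Hom A B} (α : Cell′ f g) → α ∙′ id′ f ≈′ α
      ∙′-identityʳ α = mk′
        (toCell-∙ α (id′ _) ⨾ᶜ ∙-cong ≈ᶜ-refl (to-from _) ⨾ᶜ ∙-identityʳ (toCell α))

      ∙′-assoc : ∀ {A B} {f g h k : Hom A B} (γ : Cell′ h k) (β : Cell′ g h) (α : Cell′ f g) →
                 (γ ∙′ β) ∙′ α ≈′ γ ∙′ (β ∙′ α)
      ∙′-assoc γ β α = mk′
        (toCell-∙ (γ ∙′ β) α ⨾ᶜ ∙-cong (toCell-∙ γ β) ≈ᶜ-refl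
         ⨾ᶜ ∙-assoc (toCell γ) (toCell β) (toCell α)
         ⨾ᶜ ≈ᶜ-sym (toCell-∙ γ (β ∙′ α) ⨾ᶜ ∙-cong ≈ᶜ-refl (toCell-∙ β α)))

      inverse′ˡ : ∀ {A B} {f g : Hom A B} (α : Cell′ f g) → inverse′ α ∙′ α ≈′ id′ f
      inverse′ˡ α = mk′
        (toCell-∙ (inverse′ α) α ⨾ᶜ ∙-cong (to-from _) ≈ᶜ-refl
         ⨾ᶜ inverseˡ (toCell α) ⨾ᶜ ≈ᶜ-sym (to-from _))

      inverse′ʳ : ∀ {A B} {f g : Hom A B} (α : Cell′ f g) → α ∙′ inverse′ α ≈′ id′ g
      inverse′ʳ α = mk′
        (toCell-∙ α (inverse′ α) ⨾ᶜ ∙-cong ≈ᶜ-refl (to-from _)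
         ⨾ᶜ inverseʳ (toCell α) ⨾ᶜ ≈ᶜ-sym (to-from _))

      ⋆′-identityˡ : ∀ {A B} {f g : Hom A B} (α : Cell′ f g) → id′ id ⋆′ α ≈′ α
      ⋆′-identityˡ α = mk′
        (toCell-⋆ (id′ id) α ⨾ᶜ ⋆-cong (to-from _) ≈ᶜ-refl ⨾ᶜ ⋆-identityˡ (toCell α))

      ⋆′-identityʳ : ∀ {A B} {f g : Hom A B} (α : Cell′ f g) → α ⋆′ id′ id ≈′ α
      ⋆′-identityʳ α = mk′
        (toCell-⋆ α (id′ id) ⨾ᶜ ⋆-cong ≈ᶜ-refl (to-from _) ⨾ᶜ ⋆-identityʳ (toCell α))

      ⋆′-assoc : ∀ {A B C D} {f f′ : Hom A B} {g g′ : Hom B C} {h h′ : Hom C D}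
                 (γ : Cell′ h h′) (β : Cell′ g g′) (α : Cell′ f f′) →
                 (γ ⋆′ β) ⋆′ α ≈′ γ ⋆′ (β ⋆′ α)
      ⋆′-assoc γ β α = mk′
        (toCell-⋆ (γ ⋆′ β) α ⨾ᶜ ⋆-cong (toCell-⋆ γ β) ≈ᶜ-refl
         ⨾ᶜ ⋆-assoc (toCell γ) (toCell β) (toCell α)
         ⨾ᶜ ≈ᶜ-sym (toCell-⋆ γ (β ⋆′ α) ⨾ᶜ ⋆-cong ≈ᶜ-refl (toCell-⋆ β α)))

      ⋆′-id : ∀ {A B C} (g : Hom B C) (f : Hom A B) → id′ g ⋆′ id′ f ≈′ id′ (g ∘ f)
      ⋆′-id g f = mk′
        (toCell-⋆ (id′ g) (id′ f) ⨾ᶜ ⋆-cong (to-from _) (to-from _)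
         ⨾ᶜ ⋆-id g f ⨾ᶜ ≈ᶜ-sym (to-from _))

      interchange′ : ∀ {A B C} {f g h : Hom A B} {k l m : Hom B C}
                     (δ : Cell′ l m) (γ : Cell′ k l) (β : Cell′ g h) (α : Cell′ f g) →
                     (δ ∙′ γ) ⋆′ (β ∙′ α) ≈′ (δ ⋆′ β) ∙′ (γ ⋆′ α)
      interchange′ δ γ β α = mk′
        (toCell-⋆ (δ ∙′ γ) (β ∙′ α) ⨾ᶜ ⋆-cong (toCell-∙ δ γ) (toCell-∙ β α)
         ⨾ᶜ interchange (toCell δ) (toCell γ) (toCell β) (toCell α)
         ⨾ᶜ ≈ᶜ-sym (toCell-∙ (δ ⋆′ β) (γ ⋆′ α) ⨾ᶜ ∙-cong (toCell-⋆ δ β) (toCell-⋆ γ α)))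

      id-square′ : ∀ {A B A′ B′} {c : Hom B B′} {d : Hom A A′} {f : Hom A B} {f′ : Hom A′ B′} →
                   c ∘ f ≋ f′ ∘ d → Square′ c d (id′ f) (id′ f′)
      id-square′ e = mk□′ (≈ᶜ-square (to-from _) (to-from _) (id-square e))

      ∙-square′ : ∀ {A B A′ B′} {c : Hom B B′} {d : Hom A A′}
                  {f g h : Hom A B} {f′ g′ h′ : Hom A′ B′}
                  {β : Cell′ g h} {β′ : Cell′ g′ h′} {α : Cell′ f g} {α′ : Cell′ f′ g′} →
                  Square′ c d β β′ → Square′ c d α α′ → Square′ c d (β ∙′ α) (β′ ∙′ α′)
      ∙-square′ □β □α =
        mk□′ (≈ᶜ-square (toCell-∙ _ _) (toCell-∙ _ _) (∙-square (cell-□ □β) (cell-□ □α)))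

      ⋆-square′ : ∀ {A B C A′ B′ C′} {c : Hom C C′} {b : Hom B B′} {a : Hom A A′}
                  {f₁ f₂ : Hom A B} {g₁ g₂ : Hom B C}
                  {f₁′ f₂′ : Hom A′ B′} {g₁′ g₂′ : Hom B′ C′}
                  {β : Cell′ g₁ g₂} {β′ : Cell′ g₁′ g₂′} {α : Cell′ f₁ f₂} {α′ : Cell′ f₁′ f₂′} →
                  Square′ c b β β′ → Square′ b a α α′ → Square′ c a (β ⋆′ α) (β′ ⋆′ α′)
      ⋆-square′ □β □α =
        mk□′ (≈ᶜ-square (toCell-⋆ _ _) (toCell-⋆ _ _) (⋆-square (cell-□ □β) (cell-□ □α)))

-- Contexts form a path category

module ContextPathCategory {S : TypeTheory} (I : IdentityTypes S)
                           (disc : DiscreteIdentityTypes I) where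
  open TypeTheory S
  open IdentityTypes I
  open ContextCategory S
  open IdentityContexts I
  open Substitution S
  open PathContexts I
  open PathCongruence I
  open AnodyneMaps I
  open PathPullback I

  record _≋ᵐ_ {Γ Δ : Context} (f g : Morphism Γ Δ) : Set where
    constructor mk≋
    field terms-≐ : ctx Γ ⊢ terms f ≐ terms g ∶∶ ctx Δ

  open _≋ᵐ_ public

  ≡⇒≋ : ∀ {Γ Δ} {f g : Morphism Γ Δ} → terms f ≡ terms g → f ≋ᵐ g
  ≡⇒≋ {f = f} e = mk≋ (≐sub-≡ refl e (≐sub-refl (derivable f)))

  Pᶜ : Context → Context
  Pᶜ Γ = mkContext (P (ctx Γ)) (PathRules.P-ctxt (pathRules (isCtxt Γ)))

  pullRulesᵐ : ∀ {Γ Δ} (y : Morphism Γ Δ) → PullRules (ctx Γ) (ctx Δ) (terms y)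
  pullRulesᵐ {Γ} {Δ} y = pullRules (isCtxt Δ) (derivable y)

  𝒫 : PathCategory
  𝒫 = record
    { Ob = Context
    ; Hom = Morphism
    ; _≋_ = _≋ᵐ_
    ; ≋-isEquivalence = λ {Γ} {Δ} → record
        { refl = ≡⇒≋ refl
        ; sym = λ e → mk≋ (≐sub-sym (isCtxt Δ) (terms-≐ e))
        ; trans = λ e e′ → mk≋ (≐sub-trans (isCtxt Δ) (terms-≐ e) (terms-≐ e′)) }
    ; id = λ {Γ} → mkMorphism idˢ (sub-id (isCtxt Γ))
    ; _∘_ = λ g f → mkMorphism (terms g ⊙ terms f) (sub-⊙ (derivable g) (derivable f))
    ; ∘-cong = λ {_} {_} {Θ} e e′ → mk≋ (⊙-cong (isCtxt Θ) (terms-≐ e) (terms-≐ e′))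
    ; idˡ = ≡⇒≋ (idˢ-⊙ _)
    ; idʳ = ≡⇒≋ (⊙-idˢ _)
    ; assoc = λ {_} {_} {_} {_} {h} {g} {f} → ≡⇒≋ (⊙-assoc (terms h) (terms g) (terms f))
    ; Path = Pᶜ
    ; s = λ {Γ} → mkMorphism src (PathRules.src-rule (pathRules (isCtxt Γ)))
    ; t = λ {Γ} → mkMorphism tgt (PathRules.tgt-rule (pathRules (isCtxt Γ)))
    ; r = λ {Γ} → mkMorphism (diagᶜ (ctx Γ)) (PathRules.diag-rule (pathRules (isCtxt Γ)))
    ; s∘r = λ {Γ} → ≡⇒≋ (src-diag (ctx Γ))
    ; t∘r = λ {Γ} → ≡⇒≋ (tgt-diag (ctx Γ))
    ; Anodyne = λ {Γ} {Δ} i → Anodyne (ctx Γ) (ctx Δ) (terms i)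
    ; r-anodyne = λ {Γ} → diag-anodyne (isCtxt Γ)
    ; fill = λ {_} {_} {Δ} a f g d e e′ →
        let h , hh , es , et , ed = fillP a (isCtxt Δ) (derivable f) (derivable g)
                                      (derivable d) (terms-≐ e) (terms-≐ e′)
        in mkMorphism h hh , ≡⇒≋ es , ≡⇒≋ et , mk≋ ed
    ; unique = λ {_} {_} {Δ} a {h} {h′} es et e →
        mk≋ (uniqueP disc a (isCtxt Δ) (derivable h) (derivable h′)
               (terms-≐ es) (terms-≐ et) (terms-≐ e))
    ; Pull = λ {Γ} {Δ} y →
        mkContext (Pull (ctx Γ) (ctx Δ) (terms y)) (PullRules.Pull-ctxt (pullRulesᵐ y))
    ; p₁ = λ {Γ} {Δ} {y} → mkMorphism (π₁ (length Δ)) (PullRules.π₁-rule (pullRulesᵐ y))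
    ; p₂ = λ {Γ} {Δ} {y} → mkMorphism (π₂ (terms y)) (PullRules.π₂-rule (pullRulesᵐ y))
    ; p-square = λ {Γ} {Δ} {y} → ≡⇒≋ (src-π₂ (terms y))
    ; pair = λ {_} {_} {Δ} {y} σ ρ e →
        mkMorphism (pair (length Δ) (terms σ) (terms ρ))
          (proj₁ (pair-rules (isCtxt Δ) (derivable y) (derivable σ) (derivable ρ)
                             (terms-≐ e)))
    ; p₁-pair = λ {_} {_} {Δ} {_} {σ} {ρ} → ≡⇒≋ (π₁-pair (length Δ) (terms σ) (terms ρ))
    ; p₂-pair = λ {_} {_} {Δ} {y} {σ} {ρ} {e} →
        mk≋ (≐sub-sym (PathRules.P-ctxt (pathRules (isCtxt Δ)))
          (proj₂ (pair-rules (isCtxt Δ) (derivable y) (derivable σ) (derivable ρ)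
                             (terms-≐ e))))
    ; pair-ext = λ {_} {_} {_} {y} e e′ →
        mk≋ (Pull-ext (derivable y) (terms-≐ e) (terms-≐ e′))
    ; pullMap = λ {_} {_} {Δ} y {i} a →
        mkMorphism (pullMap (length Δ) (terms i))
          (Anodyne.rule (pullMap-anodyne (isCtxt Δ) (derivable y) a))
    ; p₁-pullMap = λ {_} {_} {Δ} {_} {i} → ≡⇒≋ (π₁-pullMap (length Δ) (terms i))
    ; p₂-pullMap = λ {_} {_} {_} {y} {i} → ≡⇒≋ (π₂-pullMap (terms y) (terms i))
    ; pullMap-anodyne = λ {_} {_} {Δ} {y} a → pullMap-anodyne (isCtxt Δ) (derivable y) a
    }

-- The 2-category of contexts

module TwoCategoryOfContexts {S : TypeTheory} (I : IdentityTypes S)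
                             (disc : DiscreteIdentityTypes I) where
  open TypeTheory S using (_⊢_≐_∶∶_)
  open ContextCategory S
  open IdentityContexts I
  open Substitution S
  open PathContexts I
  open PathCongruence I
  open CellPaths I
  open ContextPathCategory I disc
  open PathCategory 𝒫 using (_∘_; _≋_; id)
  open Groupoid 𝒫 using (map; map-unique)
  open Cells 𝒫
  private
    module Hom≈ = IndexedSetoid (Category.arrows 𝒞)

  toCell : ∀ {Γ Δ} {f g : Morphism Γ Δ} → IdCell f g → Cell f g
  toCell {f = f} {g} α = record
    { path = mkMorphism _ (cell⇒path (derivable f) (derivable g) (IdCell.cellDerivable α))
    ; s-path = ≡⇒≋ (src-⟨⟩ (terms f) (terms g) (IdCell.cell α))
    ; t-path = ≡⇒≋ (tgt-⟨⟩ (terms f) (terms g) (IdCell.cell α)) }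

  module _ {Γ Δ} {f g : Morphism Γ Δ} (α : Cell f g) where
    private
      ρ = terms (path α)

      -- A `Cell` has the ends f and g only up to definitional equality, while `IdCell` needs them
      -- literally; the end components are replaced and the path components kept.
      ends : ctx Γ ⊢ ρ ≐ ⟨ terms f , terms g , mid (length Δ) ρ ⟩ ∶∶ P (ctx Δ)
      ends = ≐sub-≡ (⟨⟩-η (length Δ) ρ) refl
        (path-ends (terms-≐ (s-path α)) (terms-≐ (t-path α))
          (sub-≡ (sym (⟨⟩-η (length Δ) ρ)) (derivable (path α))))

    fromCell : IdCell f g
    fromCell = mkIdCell (mid (length Δ) ρ)
      (path⇒cell (dom-ctxt (derivable f)) (≐sub⇒ʳ (isCtxt (Pᶜ Δ)) ends))

    toCell-fromCell : toCell fromCell ≈ᶜ α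
    toCell-fromCell = mk≈ (mk≋ (≐sub-sym (isCtxt (Pᶜ Δ)) ends))

  -- The variables of Γ, read as an isomorphism onto a definitionally equal context. It turns
  -- heterogeneous equality into commuting squares inside `𝒫`.
  cast : ∀ {Γ Γ′} → Γ ≈ᵒ Γ′ → Morphism Γ Γ′
  cast (equal {w = w} {w′} p) = mkMorphism _ (sub-conv (≐ctxt-sym w′ p) w)

  Pᶜ-cong : ∀ {Γ Γ′} → Γ ≈ᵒ Γ′ → Pᶜ Γ ≈ᵒ Pᶜ Γ′
  Pᶜ-cong (equal {w = w} p) = equal (P-≐ w p)

  ≈ᵐ⇒≋ : ∀ {Γ Δ Γ′ Δ′} {f : Morphism Γ Δ} {f′ : Morphism Γ′ Δ′}
          (p : Γ ≈ᵒ Γ′) (q : Δ ≈ᵒ Δ′) → f ≈ᵐ f′ → cast q ∘ f ≋ f′ ∘ cast p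
  ≈ᵐ⇒≋ {f = f} {f′} (equal p) (equal {w = v} {v′} q) (equal _ _ e) =
    mk≋ (≐sub-≡ (sym (idˢ-⊙ (terms f))) (sym (⊙-idˢ (terms f′)))
      (≐sub-convert (≐ctxt-refl (≐sub-dom e)) (≐sub-dom e) q v v′ e))

  ≋⇒≈ᵐ : ∀ {Γ Δ Γ′ Δ′} {f : Morphism Γ Δ} {f′ : Morphism Γ′ Δ′}
          (p : Γ ≈ᵒ Γ′) (q : Δ ≈ᵒ Δ′) → cast q ∘ f ≋ f′ ∘ cast p → f ≈ᵐ f′
  ≋⇒≈ᵐ {f = f} {f′} (equal {w = w} p) (equal {w = v} {v′} q) (mk≋ e) =
    equal p q
      (≐sub-convert (≐ctxt-refl w) w (≐ctxt-sym v′ q) v′ v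
        (≐sub-≡ (idˢ-⊙ (terms f)) (⊙-idˢ (terms f′)) e))

  ≋⇒≈ᵐ-refl : ∀ {Γ Δ} {f g : Morphism Γ Δ} → f ≋ g → f ≈ᵐ g
  ≋⇒≈ᵐ-refl {Γ} {Δ} (mk≋ e) = equal (≐ctxt-refl (isCtxt Γ)) (≐ctxt-refl (isCtxt Δ)) e

  ≈ⁱ⇒≈ᵐ : ∀ {Γ Δ Γ′ Δ′} {f g : Morphism Γ Δ} {f′ g′ : Morphism Γ′ Δ′}
            {α : IdCell f g} {α′ : IdCell f′ g′} →
            α ≈ⁱ α′ → path (toCell α) ≈ᵐ path (toCell α′)
  ≈ⁱ⇒≈ᵐ (equal {v = v} p q ef eg eα) = equal p (P-≐ v q) (cell-≐⇒path ef eg eα)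

  ≈ᵐ⇒≈ⁱ : ∀ {Γ Δ Γ′ Δ′} {f g : Morphism Γ Δ} {f′ g′ : Morphism Γ′ Δ′}
            {α : IdCell f g} {α′ : IdCell f′ g′} →
            f ≈ᵐ f′ → g ≈ᵐ g′ → path (toCell α) ≈ᵐ path (toCell α′) → α ≈ⁱ α′
  ≈ᵐ⇒≈ⁱ {f = mkMorphism _ _} {mkMorphism _ _} {mkMorphism _ _} {mkMorphism _ _}
          {mkIdCell _ _} {mkIdCell _ _} (equal p q ef) (equal _ _ eg) (equal _ _ e) =
    equal p q ef eg (path-≐⇒cell (≐sub-dom e) e)

  ≈ⁱ-ends : ∀ {Γ Δ Γ′ Δ′} {f g : Morphism Γ Δ} {f′ g′ : Morphism Γ′ Δ′}
            {α : IdCell f g} {α′ : IdCell f′ g′} → α ≈ⁱ α′ → f ≈ᵐ f′ × g ≈ᵐ g′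
  ≈ⁱ-ends (equal p q ef eg _) = equal p q ef , equal p q eg

  ≈ⁱ-objects : ∀ {Γ Δ Γ′ Δ′} {f g : Morphism Γ Δ} {f′ g′ : Morphism Γ′ Δ′}
               {α : IdCell f g} {α′ : IdCell f′ g′} → α ≈ⁱ α′ → Γ ≈ᵒ Γ′ × Δ ≈ᵒ Δ′
  ≈ⁱ-objects (equal p q _ _ _) = equal p , equal q

  -- Compatibility of an operation on cells with definitional equality of
  -- contexts is thereby an instance of its naturality with respect to map.
  cast-P : ∀ {Γ Γ′} (p : Γ ≈ᵒ Γ′) → cast (Pᶜ-cong p) ≋ map (cast p)
  cast-P {mkContext Γ w} {mkContext Γ′ w′} (equal p) =
    map-unique (cast {mkContext Γ w} {mkContext Γ′ w′} (equal p))
      {h = cast (Pᶜ-cong {mkContext Γ w} {mkContext Γ′ w′} (equal p))}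
      (≡⇒≋ (trans (⊙-idˢ src) (sym (idˢ-⊙ src))))
      (≡⇒≋ (trans (⊙-idˢ tgt) (sym (idˢ-⊙ tgt))))
      (mk≋ (≐sub-≡ (sym (idˢ-⊙ (diagᶜ Γ))) (sym (⊙-idˢ (diagᶜ Γ′)))
        (≐sub-convert (≐ctxt-refl w) w (P-≐ w p) (isCtxt (Pᶜ (mkContext Γ w)))
          (isCtxt (Pᶜ (mkContext Γ′ w′))) (diagᶜ-≐ w p))))

  ≈ᶜ⇒≈ⁱ : ∀ {Γ Δ} {f g f′ g′ : Morphism Γ Δ} {α : IdCell f g} {α′ : IdCell f′ g′} →
         toCell α ≈ᶜ toCell α′ → α ≈ⁱ α′
  ≈ᶜ⇒≈ⁱ e = ≈ᵐ⇒≈ⁱ (≋⇒≈ᵐ-refl (≈ᶜ-s e)) (≋⇒≈ᵐ-refl (≈ᶜ-t e)) (≋⇒≈ᵐ-refl (path-≋ e))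

  ≈ⁱ-coerce : ∀ {Γ Δ Γ′ Δ′} {f g : Morphism Γ Δ} {f′ g′ : Morphism Γ′ Δ′} →
              f ≈ᵐ f′ → g ≈ᵐ g′ → (α : IdCell f g) → Σ (IdCell f′ g′) (α ≈ⁱ_)
  ≈ⁱ-coerce {f = mkMorphism _ _} {mkMorphism _ _} {mkMorphism _ _} {mkMorphism _ _}
            (equal {Γ = Γ} {Δ = Δ} {u′ = u′} {v} {v′} p q ef) (equal _ _ eg) α@(mkIdCell a wa) =
    -- The terms of the cell stay the same; their typing is moved first to the new ends and then to
    -- the new contexts.
    mkIdCell a (path⇒cell u′ (sub-convert p u′ (P-≐ v q) (isCtxt (Pᶜ (mkContext _ v)))
                  (isCtxt (Pᶜ (mkContext _ v′)))
                  (≐sub⇒ʳ (isCtxt (Pᶜ (mkContext _ v)))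
                    (path-ends ef eg (derivable (path (toCell α))))))) ,
    equal p q ef eg (≐sub-refl wa)

  idCells : Presentation
  idCells = record
    { Cell′ = IdCell ; toCell = toCell ; fromCell = fromCell ; to-from = toCell-fromCell }

  private module 𝒬 = Presentation idCells

  ≈′⇒≈ⁱ : ∀ {Γ Δ} {f g f′ g′ : Morphism Γ Δ} (α : IdCell f g) (α′ : IdCell f′ g′) →
         α 𝒬.≈′ α′ → α ≈ⁱ α′
  ≈′⇒≈ⁱ α α′ e = ≈ᶜ⇒≈ⁱ {α = α} {α′} (𝒬.cell-≈ e)

  ≈ⁱ⇒□ : ∀ {Γ Δ Γ′ Δ′} {f g : Morphism Γ Δ} {f′ g′ : Morphism Γ′ Δ′}
          {α : IdCell f g} {α′ : IdCell f′ g′} (p : Γ ≈ᵒ Γ′) (q : Δ ≈ᵒ Δ′) →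
          α ≈ⁱ α′ → 𝒬.Square′ (cast q) (cast p) α α′
  ≈ⁱ⇒□ {α = α} {α′} p q e = 𝒬.mk□′
    (≋⇒□ (cast q) (cast p) (cast (Pᶜ-cong q)) (cast-P q) (toCell α) (toCell α′)
      (≈ᵐ⇒≋ p (Pᶜ-cong q) (≈ⁱ⇒≈ᵐ e)))

  -- The equalities of the bounding morphisms are read off the square by composing it with the two
  -- projections.
  □⇒≈ⁱ : ∀ {Γ Δ Γ′ Δ′} {f g : Morphism Γ Δ} {f′ g′ : Morphism Γ′ Δ′}
          {α : IdCell f g} {α′ : IdCell f′ g′} (p : Γ ≈ᵒ Γ′) (q : Δ ≈ᵒ Δ′) →
          𝒬.Square′ (cast q) (cast p) α α′ → α ≈ⁱ α′
  □⇒≈ⁱ {α = α} {α′} p q e =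
    ≈ᵐ⇒≈ⁱ (≋⇒≈ᵐ p q (square-s □)) (≋⇒≈ᵐ p q (square-t □))
      (≋⇒≈ᵐ p (Pᶜ-cong q)
        (□⇒≋ (cast q) (cast p) (cast (Pᶜ-cong q)) (cast-P q) (toCell α) (toCell α′) □))
    where □ = 𝒬.cell-□ e

  ≈ⁱ-refl : ∀ {Γ Δ} {f g : Morphism Γ Δ} {α : IdCell f g} → α ≈ⁱ α
  ≈ⁱ-refl {α = α} = ≈′⇒≈ⁱ α α (𝒬.≈′-refl α)

  ≈ⁱ-sym : ∀ {Γ Δ Γ′ Δ′} {f g : Morphism Γ Δ} {f′ g′ : Morphism Γ′ Δ′}
           {α : IdCell f g} {α′ : IdCell f′ g′} → α ≈ⁱ α′ → α′ ≈ⁱ α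
  ≈ⁱ-sym e =
    let ef , eg = ≈ⁱ-ends e in
    ≈ᵐ⇒≈ⁱ (Hom≈.sym ef) (Hom≈.sym eg) (Hom≈.sym (≈ⁱ⇒≈ᵐ e))

  ≈ⁱ-trans : ∀ {Γ Δ Γ′ Δ′ Γ″ Δ″} {f g : Morphism Γ Δ} {f′ g′ : Morphism Γ′ Δ′}
             {f″ g″ : Morphism Γ″ Δ″}
             {α : IdCell f g} {α′ : IdCell f′ g′} {α″ : IdCell f″ g″} →
             α ≈ⁱ α′ → α′ ≈ⁱ α″ → α ≈ⁱ α″
  ≈ⁱ-trans e e′ =
    let ef , eg = ≈ⁱ-ends e
        ef′ , eg′ = ≈ⁱ-ends e′
    in ≈ᵐ⇒≈ⁱ (Hom≈.trans ef ef′) (Hom≈.trans eg eg′)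
             (Hom≈.trans (≈ⁱ⇒≈ᵐ e) (≈ⁱ⇒≈ᵐ e′))

  𝕮 : TwoCategory 𝒞 IdCells _≈₂ᵢ_
  𝕮 = record
    { isEquivalence = record { refl = ≈ⁱ-refl ; sym = ≈ⁱ-sym ; trans = ≈ⁱ-trans }
    ; ≈₂-ends = ≈ⁱ-ends
    ; coe₂ = ≈ⁱ-coerce
    ; id₂ = 𝒬.id′
    ; _∙_ = 𝒬._∙′_
    ; _⋆_ = 𝒬._⋆′_
    ; id₂-cong = λ e →
        let p , q = Category.≈₁-ends 𝒞 e in □⇒≈ⁱ p q (𝒬.id-square′ (≈ᵐ⇒≋ p q e))
    ; ∙-cong = λ eβ eα →
        let p , q = ≈ⁱ-objects eα in
        □⇒≈ⁱ p q (𝒬.∙-square′ (≈ⁱ⇒□ p q eβ) (≈ⁱ⇒□ p q eα))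
    ; ⋆-cong = λ eβ eα →
        let p , q = ≈ⁱ-objects eα
            _ , u = ≈ⁱ-objects eβ
        in □⇒≈ⁱ p u (𝒬.⋆-square′ (≈ⁱ⇒□ q u eβ) (≈ⁱ⇒□ p q eα))
    ; ∙-identityˡ = λ α → ≈′⇒≈ⁱ _ _ (𝒬.∙′-identityˡ α)
    ; ∙-identityʳ = λ α → ≈′⇒≈ⁱ _ _ (𝒬.∙′-identityʳ α)
    ; ∙-assoc = λ γ β α → ≈′⇒≈ⁱ _ _ (𝒬.∙′-assoc γ β α)
    ; ⋆-identityˡ = λ α → ≈′⇒≈ⁱ _ _ (𝒬.⋆′-identityˡ α)
    ; ⋆-identityʳ = λ α → ≈′⇒≈ⁱ _ _ (𝒬.⋆′-identityʳ α)
    ; ⋆-assoc = λ γ β α → ≈′⇒≈ⁱ _ _ (𝒬.⋆′-assoc γ β α)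
    ; ⋆-id₂ = λ g f → ≈′⇒≈ⁱ _ _ (𝒬.⋆′-id g f)
    ; interchange = λ δ γ β α → ≈′⇒≈ⁱ _ _ (𝒬.interchange′ δ γ β α)
    }

  𝕮-locallyGroupoidal : LocallyGroupoidal 𝒞 𝕮
  𝕮-locallyGroupoidal α =
    𝒬.inverse′ α , ≈′⇒≈ⁱ _ _ (𝒬.inverse′ˡ α) , ≈′⇒≈ⁱ _ _ (𝒬.inverse′ʳ α)

corollary3p3p3 : (S : TypeTheory) (I : IdentityTypes S) → DiscreteIdentityTypes I →
    Σ (TwoCategory (ContextCategory.𝒞 S) (IdentityContexts.IdCells I) (IdentityContexts._≈₂ᵢ_ I))
    (LocallyGroupoidal (ContextCategory.𝒞 S))
corollary3p3p3 S I disc = 𝕮 , 𝕮-locallyGroupoidal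
  where open TwoCategoryOfContexts I disc
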